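{- Let $(X,\mathbf R)$ be a symmetric association scheme with $D$ classes which is metric with respect to $A_0,\dots,A_D$ and cometric with respect to $E_0,\dots,E_D$. Fix $x\in X$, write $E_i^*=E_i^*(x)$, $T=T(x)$. Let $\chi\in V$ be a code and set $\delta_x=\delta_x(\chi)$, $\delta^*=\delta^*(\chi)$. Suppose $t\in\{1,\dots,D\}$ is such that for every $1\le r\le t$ at least one of the following holds: $$|\{r\le j\le D-r: E_j\chi\ne0\}|\le\delta_x-r,\qquad |\{r\le i\le D-r:E_i^*\chi\ne0\}|\le\delta^*-r.$$ Suppose every irreducible $T$-module with displacement zero and endpoint at most $t$ is thin. Then: (i) for every $F\in T$, $F\chi$ is orthogonal to $V_{i,D-i}\cap(M\hat x)^\perp$ whenever $1\le i\le t$; (ii) for every $F\in T$, $F\chi$ is orthogonal to $V_{D-j,j}\cap(M\hat x)^\perp$ whenever $1\le j\le t$.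
   Context: $(X,\mathbf R)$ is a symmetric association scheme with associate matrices $A_0=I,\dots,A_D$, Bose–Mesner algebra $M$, primitive idempotents $E_0=|X|^{ -1}J,\dots,E_D$. Metric: $(X,R_1)$ is distance-regular with $R_i$ its distance-$i$ relation. Cometric: each $E_j$ is a polynomial of degree exactly $j$ in $E_1$ under entrywise multiplication. $V=\mathbb C^X$ with standard basis $\{\hat y\}$ and standard Hermitian inner product; $(M\hat x)^\perp$ is the orthogonal complement of $M\hat x=\{B\hat x: B\in M\}$. $E_i^*(x)$ is diagonal with $(E_i^*(x))_{yy}=(A_i)_{xy}$; $A_i^*(x)$ diagonal with $(A_i^*(x))_{yy}=|X|(E_i)_{xy}$; $T(x)$ is the algebra generated by $M$ and the $A_i^*(x)$. For an irreducible $T$-module $W$: endpoint $r(W)=\min\{i:E_i^*W\ne0\}$, dual endpoint $r^*(W)=\min\{j:E_jW\ne0\}$, diameter $d(W)=|\{i:E_i^*W\ne0\}|-1$, displacement $\eta(W)=r(W)+r^*(W)+d(W)-D$; thin means $\dim E_i^*W\le1$ for all $i$. For $0\le i,j\le D$, $V_{ij}=\bigl(\sum_{k=0}^iE_k^*V\bigr)\cap\bigl(\sum_{\ell=0}^jE_\ell V\bigr)$. A code is $\chi\notin E_0V$ with $\chi\notin E_0^*(z)V$ for all $z$; $\delta_x(\chi)=\min\{i\ne0:E_i^*(x)\chi\ne0\}$, $\delta^*(\chi)=\min\{j\ne0:E_j\chi\ne0\}$. -}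

module Defs where

open import Level using (0ℓ) renaming (suc to lsuc)
open import Algebra.Bundles using (RawRing)
open import Algebra.Structures using (IsCommutativeRing)
import Algebra.Definitions.RawSemiring as RawSemiringDefs
open import Data.Nat.Base as ℕ using (ℕ; zero; suc)
open import Data.Integer.Base as ℤ using (ℤ)
open import Data.Fin.Base as Fin using (Fin; zero; suc; toℕ; fromℕ)
open import Data.Fin.Properties using (_≟_)
open import Data.Fin.Subset as Subset using (Subset)
open import Data.Product.Base using (Σ; ∃; ∃₂; _×_; _,_; proj₁; proj₂)
open import Data.Sum.Base using (_⊎_)
open import Data.Bool.Base using (if_then_else_)
open import Data.Vec.Functional using (Vector)
open import Function.Bundles using (_⇔_)
open import Relation.Nullary using (¬_; does)
open import Relation.Unary using (Pred; _∈_; _∉_; _⊆_; _∩_; U)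
open import Relation.Binary.Core using (Rel)
open import Relation.Binary.Structures using (IsTotalOrder)
open import Relation.Binary.PropositionalEquality using (_≡_; _≢_)

-- The reals are axiomatised up to isomorphism.  The axioms are the classical
-- ones (total order, inverses of all nonzero elements, suprema of arbitrary
-- nonempty bounded subsets), so a model is to be sought in the presence of
-- excluded middle.
record CompleteOrderedField : Set (lsuc 0ℓ) where
  infix  8 -_
  infixl 7 _*_
  infixl 6 _+_
  infix  4 _≈_ _≤_
  field
    Carrier           : Set
    _≈_ _≤_           : Rel Carrier 0ℓ
    _+_ _*_           : Carrier → Carrier → Carrier
    -_                : Carrier → Carrier
    0# 1#             : Carrier
    isCommutativeRing : IsCommutativeRing _≈_ _+_ _*_ -_ 0# 1#
    isTotalOrder      : IsTotalOrder _≈_ _≤_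
    0≉1               : ¬ (0# ≈ 1#)
    inverse           : ∀ x → ¬ (x ≈ 0#) → ∃ λ y → x * y ≈ 1#
    +-monoʳ-≤         : ∀ x {y z} → y ≤ z → x + y ≤ x + z
    *-nonneg          : ∀ {x y} → 0# ≤ x → 0# ≤ y → 0# ≤ x * y

  UpperBound : Pred Carrier 0ℓ → Carrier → Set
  UpperBound P b = ∀ {x} → x ∈ P → x ≤ b

  field
    supremum : (P : Pred Carrier 0ℓ) → ∃ P → ∃ (UpperBound P) →
               ∃ λ s → UpperBound P s × (∀ b → UpperBound P b → s ≤ b)

module Complex (ℝ : CompleteOrderedField) where
  private module R = CompleteOrderedField ℝ

  -- (a , b) is a + b i.
  rawRing : RawRing 0ℓ 0ℓ
  rawRing = record
    { Carrier = R.Carrier × R.Carrier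
    ; _≈_ = λ (a , b) (c , d) → (a R.≈ c) × (b R.≈ d)
    ; _+_ = λ (a , b) (c , d) → (a R.+ c , b R.+ d)
    ; _*_ = λ (a , b) (c , d) → (a R.* c R.+ R.- (b R.* d) , a R.* d R.+ b R.* c)
    ; -_  = λ (a , b) → (R.- a , R.- b)
    ; 0#  = (R.0# , R.0#)
    ; 1#  = (R.1# , R.0#)
    }

  open RawRing rawRing public using (_≈_; _≉_; _+_; _*_; -_; 0#; 1#; rawSemiring)
    renaming (Carrier to ℂ)
  open RawSemiringDefs rawSemiring public using (sum; _^_)
    renaming (_×_ to _·_)

  conj : ℂ → ℂ
  conj (a , b) = (a , R.- b)

-- HasCard P m: the set of all i with P i has exactly m elements.
HasCard : ∀ {n} → Pred (Fin n) 0ℓ → ℕ → Set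
HasCard {n} P m = ∃ λ (S : Subset n) → (∀ i → (i Subset.∈ S) ⇔ P i) × Subset.∣ S ∣ ≡ m

IsMin : ∀ {n} → Pred (Fin n) 0ℓ → Fin n → Set
IsMin P i = i ∈ P × (∀ j → j ∈ P → i Fin.≤ j)

module Graph {n : ℕ} (Adj : Rel (Fin n) 0ℓ) where

  Walk : ℕ → Rel (Fin n) 0ℓ
  Walk zero    y z = y ≡ z
  Walk (suc k) y z = ∃ λ w → Adj y w × Walk k w z

  Dist : ℕ → Rel (Fin n) 0ℓ
  Dist k y z = Walk k y z × (∀ m → m ℕ.< k → ¬ Walk m y z)

  Connected : Set
  Connected = ∀ y z → ∃ λ k → Walk k y z

  DistanceRegular : Set
  DistanceRegular = Connected × ∃ λ (p : ℕ → ℕ → ℕ → ℕ) →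
    ∀ i j k y z → Dist k y z → HasCard (λ w → Dist i y w × Dist j w z) (p i j k)

-- A partition of X × X into D + 1 classes, X = Fin n, is encoded by the map
-- sending a pair to the index of the class containing it.
record SymmetricAssociationScheme (n D : ℕ) : Set where
  field
    rel       : Fin n → Fin n → Fin (suc D)
    nonempty  : ∀ i → ∃₂ λ y z → rel y z ≡ i
    diagonal  : ∀ y z → rel y z ≡ zero ⇔ y ≡ z
    symmetric : ∀ y z → rel y z ≡ rel z y
    p         : Fin (suc D) → Fin (suc D) → Fin (suc D) → ℕ
    p-count   : ∀ i j k y z → rel y z ≡ k →
                HasCard (λ w → rel y w ≡ i × rel w z ≡ j) (p i j k)

  open Graph (λ y z → toℕ (rel y z) ≡ 1)

  Metric : Set
  Metric = DistanceRegular × (∀ i y z → rel y z ≡ i ⇔ Dist (toℕ i) y z)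

module LinearAlgebra (ℝ : CompleteOrderedField) (n : ℕ) where
  open Complex ℝ

  infix  4 _≈ᵛ_ _≈ᴹ_
  infixr 7 _*ᵛ_ _*ᴹ_ _∙ᵛ_ _∙ᴹ_
  infixl 6 _+ᵛ_ _+ᴹ_

  V : Set
  V = Vector ℂ n

  Mat : Set
  Mat = Fin n → Fin n → ℂ

  _≈ᵛ_ : Rel V 0ℓ
  u ≈ᵛ v = ∀ y → u y ≈ v y

  0ᵛ : V
  0ᵛ _ = 0#

  _+ᵛ_ : V → V → V
  (u +ᵛ v) y = u y + v y

  _∙ᵛ_ : ℂ → V → V
  (c ∙ᵛ v) y = c * v y

  sumᵛ : ∀ {m} → (Fin m → V) → V
  sumᵛ u y = sum (λ k → u k y)

  ⟨_,_⟩ : V → V → ℂ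
  ⟨ u , v ⟩ = sum (λ y → u y * conj (v y))

  hat : Fin n → V
  hat x y = if does (x ≟ y) then 1# else 0#

  _≈ᴹ_ : Rel Mat 0ℓ
  B ≈ᴹ C = ∀ y z → B y z ≈ C y z

  0ᴹ : Mat
  0ᴹ _ _ = 0#

  _+ᴹ_ : Mat → Mat → Mat
  (B +ᴹ C) y z = B y z + C y z

  _∙ᴹ_ : ℂ → Mat → Mat
  (c ∙ᴹ B) y z = c * B y z

  _*ᴹ_ : Mat → Mat → Mat
  (B *ᴹ C) y z = sum (λ w → B y w * C w z)

  _*ᵛ_ : Mat → V → V
  (B *ᵛ v) y = sum (λ z → B y z * v z)

  sumᴹ : ∀ {m} → (Fin m → Mat) → Mat
  sumᴹ B y z = sum (λ k → B k y z)

  diag : V → Mat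
  diag v y z = if does (y ≟ z) then v y else 0#

  record IsSubspace (W : Pred V 0ℓ) : Set where
    field
      resp-≈   : ∀ {u v} → u ≈ᵛ v → u ∈ W → v ∈ W
      0-closed : 0ᵛ ∈ W
      +-closed : ∀ {u v} → u ∈ W → v ∈ W → u +ᵛ v ∈ W
      ∙-closed : ∀ c {v} → v ∈ W → c ∙ᵛ v ∈ W

  IsZero : Pred V 0ℓ → Set
  IsZero W = ∀ {v} → v ∈ W → v ≈ᵛ 0ᵛ

  image : Mat → Pred V 0ℓ → Pred V 0ℓ
  image B W v = ∃ λ w → w ∈ W × v ≈ᵛ B *ᵛ w

  -- Σ_{k ≤ i} F k, a sum of subspaces.
  sumUpTo : ∀ {m} → ℕ → (Fin m → Pred V 0ℓ) → Pred V 0ℓ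
  sumUpTo {m} i F v = ∃ λ (u : Fin m → V) →
    (∀ k → toℕ k ℕ.≤ i → u k ∈ F k) × (∀ k → i ℕ.< toℕ k → u k ≈ᵛ 0ᵛ) × v ≈ᵛ sumᵛ u

  _⟂ : Pred V 0ℓ → Pred V 0ℓ
  (W ⟂) v = ∀ w → w ∈ W → ⟨ v , w ⟩ ≈ 0#

  HasDim : Pred V 0ℓ → ℕ → Set
  HasDim W d = ∃ λ (b : Fin d → V) →
    (∀ i → b i ∈ W) ×
    (∀ (c : Fin d → ℂ) → sumᵛ (λ i → c i ∙ᵛ b i) ≈ᵛ 0ᵛ → ∀ i → c i ≈ 0#) ×
    (∀ v → v ∈ W → ∃ λ (c : Fin d → ℂ) → v ≈ᵛ sumᵛ (λ i → c i ∙ᵛ b i))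

module BoseMesner (ℝ : CompleteOrderedField) {n D : ℕ}
                  (𝓢 : SymmetricAssociationScheme n D) where
  open Complex ℝ
  open LinearAlgebra ℝ n
  open SymmetricAssociationScheme 𝓢

  A : Fin (suc D) → Mat
  A i y z = if does (rel y z ≟ i) then 1# else 0#

  M : Pred Mat 0ℓ
  M B = ∃ λ (c : Fin (suc D) → ℂ) → B ≈ᴹ sumᴹ (λ i → c i ∙ᴹ A i)

  IsIdempotent : Pred Mat 0ℓ
  IsIdempotent B = B *ᴹ B ≈ᴹ B

  IsPrimitiveIdempotent : Pred Mat 0ℓ
  IsPrimitiveIdempotent B = B ∈ M × IsIdempotent B × ¬ (B ≈ᴹ 0ᴹ) ×
    (∀ F G → F ∈ M → G ∈ M → IsIdempotent F → IsIdempotent G →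
      F *ᴹ G ≈ᴹ 0ᴹ → B ≈ᴹ F +ᴹ G → F ≈ᴹ 0ᴹ ⊎ G ≈ᴹ 0ᴹ)

  -- An ordering E 0 , … , E D of all primitive idempotents of M, without
  -- repetition.  The last field says |X| E₀ = J.
  record IsIdempotentOrdering (E : Fin (suc D) → Mat) : Set where
    field
      isPrimitive : ∀ j → IsPrimitiveIdempotent (E j)
      distinct  : ∀ i j → E i ≈ᴹ E j → i ≡ j
      complete  : ∀ B → IsPrimitiveIdempotent B → ∃ λ j → B ≈ᴹ E j
      trivial   : ∀ y z → (n · 1#) * E zero y z ≈ 1#

  -- e is the index 1, which exists in Fin (suc D) only for D ≥ 1; the
  -- coefficient c k belongs to the k-th entrywise power of E e.
  Cometric : (Fin (suc D) → Mat) → Set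
  Cometric E = ∀ (e : Fin (suc D)) → toℕ e ≡ 1 → ∀ j →
    ∃ λ (c : Fin (suc (toℕ j)) → ℂ) → c (fromℕ (toℕ j)) ≉ 0# ×
      (∀ y z → E j y z ≈ sum (λ k → c k * (E e y z ^ toℕ k)))

  E* : Fin n → Fin (suc D) → Mat
  E* x i = diag (A i x)

  -- M x̂
  Mhat : Fin n → Pred V 0ℓ
  Mhat x v = ∃ λ B → B ∈ M × v ≈ᵛ B *ᵛ hat x

module Terwilliger (ℝ : CompleteOrderedField) {n D : ℕ}
                   (𝓢 : SymmetricAssociationScheme n D)
                   (E : Fin (suc D) → LinearAlgebra.Mat ℝ n) where
  open Complex ℝ
  open LinearAlgebra ℝ n
  open BoseMesner ℝ 𝓢

  A* : Fin n → Fin (suc D) → Mat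
  A* x i = diag (λ y → (n · 1#) * E i x y)

  data T (x : Fin n) : Pred Mat 0ℓ where
    fromM  : ∀ {B} → B ∈ M → B ∈ T x
    fromA* : ∀ i → A* x i ∈ T x
    add    : ∀ {B C} → B ∈ T x → C ∈ T x → B +ᴹ C ∈ T x
    scale  : ∀ c {B} → B ∈ T x → c ∙ᴹ B ∈ T x
    mul    : ∀ {B C} → B ∈ T x → C ∈ T x → B *ᴹ C ∈ T x
    resp   : ∀ {B C} → B ≈ᴹ C → B ∈ T x → C ∈ T x

  IsModule : Fin n → Pred V 0ℓ → Set
  IsModule x W = IsSubspace W × (∀ {B v} → B ∈ T x → v ∈ W → B *ᵛ v ∈ W)

  IsIrreducible : Fin n → Pred V 0ℓ → Set (lsuc 0ℓ)
  IsIrreducible x W = IsModule x W × ¬ IsZero W ×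
    (∀ (W′ : Pred V 0ℓ) → IsModule x W′ → W′ ⊆ W → IsZero W′ ⊎ W ⊆ W′)

  Endpoint : Fin n → Pred V 0ℓ → Fin (suc D) → Set
  Endpoint x W = IsMin (λ i → ¬ IsZero (image (E* x i) W))

  DualEndpoint : Pred V 0ℓ → Fin (suc D) → Set
  DualEndpoint W = IsMin (λ j → ¬ IsZero (image (E j) W))

  Diameter : Fin n → Pred V 0ℓ → ℕ → Set
  Diameter x W d = HasCard (λ i → ¬ IsZero (image (E* x i) W)) (suc d)

  Displacement : Fin n → Pred V 0ℓ → ℤ → Set
  Displacement x W η = ∃ λ r → ∃ λ r* → ∃ λ d →
    Endpoint x W r × DualEndpoint W r* × Diameter x W d ×
    η ≡ ℤ.+ (toℕ r ℕ.+ toℕ r* ℕ.+ d) ℤ.- ℤ.+ D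

  Thin : Fin n → Pred V 0ℓ → Set
  Thin x W = ∀ i → ∃ λ d → HasDim (image (E* x i) W) d × d ℕ.≤ 1

  Vᵢⱼ : Fin n → ℕ → ℕ → Pred V 0ℓ
  Vᵢⱼ x i j = sumUpTo i (λ k → image (E* x k) U) ∩ sumUpTo j (λ l → image (E l) U)

  IsCode : Pred V 0ℓ
  IsCode χ = χ ∉ image (E zero) U × (∀ z → χ ∉ image (E* z zero) U)

  supp* : Fin n → V → Pred (Fin (suc D)) 0ℓ
  supp* x χ i = ¬ (E* x i *ᵛ χ ≈ᵛ 0ᵛ)

  supp : V → Pred (Fin (suc D)) 0ℓ
  supp χ j = ¬ (E j *ᵛ χ ≈ᵛ 0ᵛ)

  -- δ_x(χ) and δ*(χ)
  Isδ : Fin n → V → Fin (suc D) → Set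
  Isδ x χ = IsMin (λ i → i ≢ zero × i ∈ supp* x χ)

  Isδ* : V → Fin (suc D) → Set
  Isδ* χ = IsMin (λ j → j ≢ zero × j ∈ supp χ)

  -- |{ r ≤ i ≤ D − r : i ∈ S }| ≤ δ − r.  The right-hand side may be negative,
  -- so r is moved to the left; r ≤ D where this is used, so D ∸ r is exact.
  FewBetween : Pred (Fin (suc D)) 0ℓ → ℕ → Fin (suc D) → Set
  FewBetween S r δ = ∃ λ m →
    HasCard (λ i → r ℕ.≤ toℕ i × toℕ i ℕ.≤ D ℕ.∸ r × i ∈ S) m × m ℕ.+ r ℕ.≤ toℕ δ

{-# OPTIONS --safe #-}
module Submission where

-- Every T-module splits orthogonally into irreducible ones, so it suffices to treat an irreducible
-- W ⊂ (M x̂)^⊥ containing a nonzero v ∈ V_{h,k} with h + k = D.  The sum of all V_{h,D-h} ∩ W is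
-- invariant under A₁ (which maps V_{h,k} to V_{h,k} + V_{h+1,k-1}) and dually under A₁*, hence is W.
-- With r, r* the endpoints, E*_i W ≠ 0 forces r ≤ i ≤ D - r*, and E_j W ≠ 0 forces r* ≤ j ≤ D - r.
-- On the other hand 2r + d* ≥ D and 2r* + d ≥ D, since A₁ᵏ A_D vanishes on E*_r V for k + 2r < D and
-- A_D is invertible.  So r = r*, d = D - 2r and the displacement is zero; thus W is thin, and it is
-- spanned by the E_j u for u ∈ E*_r W.  Finally ⟨A₁ᵏ u , χ⟩ = 0 for k < δ_x - r, a Vandermonde
-- system with at most δ_x - r unknowns ⟨E_j u , χ⟩, which therefore all vanish; or dually.

open import Level using (0ℓ) renaming (suc to lsuc)
open import Algebra.Bundles using (AbelianGroup; CommutativeRing; Semiring)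
open import Algebra.Structures using (IsAbelianGroup)
import Algebra.Construct.DirectProduct as DirectProduct
import Algebra.Properties.Ring
import Algebra.Properties.Semiring.Sum
import Algebra.Properties.Semiring.Exp
import Algebra.Definitions.RawSemiring
import Algebra.Solver.Ring.NaturalCoefficients.Default
import Relation.Binary.Reasoning.Setoid
open import Axiom.ExcludedMiddle using (ExcludedMiddle)
open import Data.Bool.Base using (true; false; if_then_else_)
open import Data.Empty using (⊥)
open import Data.Nat.Base as ℕ using (ℕ; zero; suc; _≤_; _<_; _∸_; z≤n; s≤s)
import Data.Nat.Properties as ℕₚ
open import Data.Integer.Base as ℤ using (0ℤ)
import Data.Integer.Properties as ℤₚ
open import Data.Fin.Base using (Fin; zero; suc; toℕ; fromℕ; fromℕ<; punchIn)
import Data.Fin.Properties as Finₚ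
open import Data.Fin.Properties using (_≟_)
open import Data.Fin.Subset as Subset using (Subset; ∣_∣)
import Data.Fin.Subset.Properties as Subsetₚ
open import Data.Product.Base using (Σ; ∃; ∃₂; _×_; _,_; proj₁; proj₂)
open import Data.Sum.Base using (_⊎_; inj₁; inj₂; [_,_]′)
open import Data.Vec.Base using ([]; _∷_; here; there; tabulate; lookup)
import Data.Vec.Properties as Vecₚ
open import Data.Vec.Functional using (Vector; insertAt)
import Data.Vec.Functional.Properties as Vectorₚ
open import Function.Base using (_∘_; id; _∋_)
open import Function.Bundles using (_⇔_; Equivalence; mk⇔)
open import Relation.Binary.Core using (Rel)
open import Relation.Binary.Structures using (IsTotalOrder)
open import Relation.Binary.Definitions using (tri<; tri≈; tri>)
open import Relation.Binary.PropositionalEquality as ≡ using (_≡_; _≢_)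
open import Relation.Nullary using (¬_; Dec; yes; no; does; contradiction)
open import Relation.Nullary.Decidable using (decidable-stable; dec-true)
open import Relation.Unary using (Pred; _∈_; _∉_; _⊆_; _∩_; U)
open import Defs

-- The hypothesis on χ may concern the E_j χ or the E*_i χ, whereas thinness is assumed for the E*_i
-- only. But a module generated by one vector under the E_j is automatically thin for the E_j, so
-- thinness crosses over. Irreducible modules are therefore treated for two abstract resolutions of
-- the identity, each with a `Companion`, and every one-sided result is used twice. On the metric
-- side the companion comes from distances between points of a sphere; on the cometric side from
-- vanishing Krein parameters, with entrywise products in place of matrix products. Counting
-- replaces dimension theory: because the eigenvalues of A₁, and dually the entries of E₁, are
-- distinct, one Vandermonde argument extracts components, bounds diameters, inverts A_D and gives
-- the orthogonality to χ. Orthogonality to M x̂ keeps the endpoint away from 0, the only index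
-- below δ_x at which χ may have a component. The bound r ≤ t comes from v: a nonzero v in V_{h,k}
-- forces r ≤ h and r ≤ k. Finally F is moved onto v as its adjoint, since v, unlike χ, decomposes
-- along the modules in question.

record StarField : Set₁ where
  field
    commutativeRing : CommutativeRing 0ℓ 0ℓ
  open CommutativeRing commutativeRing public
    using ( Carrier; _≈_; _+_; _*_; -_; 0#; 1#; refl; sym; trans; reflexive; setoid; semiring; commutativeSemiring
          ; +-assoc; +-comm; +-cong; +-congˡ; +-congʳ; +-identityˡ; +-identityʳ
          ; *-assoc; *-comm; *-cong; *-congˡ; *-congʳ; *-identityˡ; *-identityʳ
          ; distribˡ; distribʳ; zeroˡ; zeroʳ; -‿inverseʳ; -‿cong )
  field
    0≉1            : ¬ (0# ≈ 1#)
    inverse        : ∀ x → ¬ (x ≈ 0#) → ∃ λ y → x * y ≈ 1#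
    conj           : Carrier → Carrier
    conj-cong      : ∀ {x y} → x ≈ y → conj x ≈ conj y
    conj-+         : ∀ x y → conj (x + y) ≈ conj x + conj y
    conj-*         : ∀ x y → conj (x * y) ≈ conj x * conj y
    conj-conj      : ∀ x → conj (conj x) ≈ x
    -- For ℂ this means a real number that is at least 0. The axioms below serve one purpose: a
    -- vanishing sum of norms vanishes termwise.
    NonNegative    : Pred Carrier 0ℓ
    nonNeg-resp    : ∀ {x y} → x ≈ y → NonNegative x → NonNegative y
    nonNeg-0       : NonNegative 0#
    nonNeg-+       : ∀ {x y} → NonNegative x → NonNegative y → NonNegative (x + y)
    nonNeg-norm    : ∀ x → NonNegative (x * conj x)
    nonNeg-cancel  : ∀ {x y} → NonNegative x → NonNegative y → x + y ≈ 0# → x ≈ 0#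
    norm-definite  : ∀ {x} → x * conj x ≈ 0# → x ≈ 0#

-- Scalars and finite sums.

module Sums (K : StarField) where
  open StarField K public
  open Algebra.Definitions.RawSemiring (Semiring.rawSemiring semiring) public using (_^_) renaming (_×_ to _·_)
  private module ∑ = Algebra.Properties.Semiring.Sum semiring
  open Algebra.Properties.Ring (CommutativeRing.ring commutativeRing) using (-1*x≈-x; -‿involutive)
  open Algebra.Properties.Semiring.Exp semiring public using (^-homo-*; ^-congˡ)
  open Algebra.Solver.Ring.NaturalCoefficients.Default commutativeSemiring public
    using (solve; _:=_; _:+_; _:*_)
  module ≈-Reasoning = Relation.Binary.Reasoning.Setoid setoid

  -- Differences are written `x + -1# * y`, so that they fall under identities of commutative
  -- semirings with `-1#` as a variable.
  -1# : Carrier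
  -1# = - 1#

  1+-1≈0 : 1# + -1# ≈ 0#
  1+-1≈0 = -‿inverseʳ 1#

  x+-1x≈0 : ∀ x → x + -1# * x ≈ 0#
  x+-1x≈0 x = trans (+-congˡ (-1*x≈-x x)) (-‿inverseʳ x)

  x+-1y≈0⇒x≈y : ∀ {x y} → x + -1# * y ≈ 0# → x ≈ y
  x+-1y≈0⇒x≈y {x} {y} eq = begin
    x                        ≈⟨ +-identityʳ x ⟨
    x + 0#                   ≈⟨ +-congˡ (trans (+-comm _ _) (x+-1x≈0 y)) ⟨
    x + (-1# * y + y)        ≈⟨ +-assoc _ _ _ ⟨
    (x + -1# * y) + y        ≈⟨ +-congʳ eq ⟩
    0# + y                   ≈⟨ +-identityˡ y ⟩
    y                        ∎
    where open ≈-Reasoning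

  -1*-1x≈x : ∀ x → -1# * (-1# * x) ≈ x
  -1*-1x≈x x = trans (-1*x≈-x _) (trans (-‿cong (-1*x≈-x x)) (-‿involutive x))

  1≉0 : ¬ (1# ≈ 0#)
  1≉0 = 0≉1 ∘ sym

  -1≉0 : ¬ (-1# ≈ 0#)
  -1≉0 eq = 1≉0 (trans (sym (+-identityʳ 1#)) (trans (+-congˡ (sym eq)) 1+-1≈0))

  *-zeroˡ⇐ : ∀ {x} y → x ≈ 0# → x * y ≈ 0#
  *-zeroˡ⇐ y eq = trans (*-congʳ eq) (zeroˡ y)

  *-zeroʳ⇐ : ∀ x {y} → y ≈ 0# → x * y ≈ 0#
  *-zeroʳ⇐ x eq = trans (*-congˡ eq) (zeroʳ x)

  *-cancelˡ-0 : ∀ {x y} → ¬ (x ≈ 0#) → x * y ≈ 0# → y ≈ 0#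
  *-cancelˡ-0 {x} {y} x≉0 xy≈0 with x⁻¹ , inv ← inverse x x≉0 = begin
    y               ≈⟨ *-identityˡ y ⟨
    1# * y          ≈⟨ *-congʳ inv ⟨
    (x * x⁻¹) * y   ≈⟨ solve 3 (λ a b c → (a :* b) :* c := b :* (a :* c)) refl x x⁻¹ y ⟩
    x⁻¹ * (x * y)   ≈⟨ *-zeroʳ⇐ x⁻¹ xy≈0 ⟩
    0#              ∎
    where open ≈-Reasoning

  conj-0 : conj 0# ≈ 0#
  conj-0 = begin
    conj 0#                          ≈⟨ +-identityʳ _ ⟨
    conj 0# + 0#                     ≈⟨ +-congˡ (x+-1x≈0 (conj 0#)) ⟨
    conj 0# + (conj 0# + -1# * conj 0#)  ≈⟨ +-assoc _ _ _ ⟨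
    (conj 0# + conj 0#) + -1# * conj 0#  ≈⟨ +-congʳ (conj-+ 0# 0#) ⟨
    conj (0# + 0#) + -1# * conj 0#   ≈⟨ +-congʳ (conj-cong (+-identityˡ 0#)) ⟩
    conj 0# + -1# * conj 0#          ≈⟨ x+-1x≈0 (conj 0#) ⟩
    0#                               ∎
    where open ≈-Reasoning

  conj-1 : conj 1# ≈ 1#
  conj-1 = begin
    conj 1#                  ≈⟨ *-identityʳ _ ⟨
    conj 1# * 1#             ≈⟨ *-congˡ (conj-conj 1#) ⟨
    conj 1# * conj (conj 1#) ≈⟨ conj-* 1# (conj 1#) ⟨
    conj (1# * conj 1#)      ≈⟨ conj-cong (*-identityˡ _) ⟩
    conj (conj 1#)           ≈⟨ conj-conj 1# ⟩
    1#                       ∎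
    where open ≈-Reasoning

  conj-≈0 : ∀ {x} → x ≈ 0# → conj x ≈ 0#
  conj-≈0 eq = trans (conj-cong eq) conj-0

  nonNeg-1 : NonNegative 1#
  nonNeg-1 = nonNeg-resp (trans (*-identityˡ _) conj-1) (nonNeg-norm 1#)

  -- Opaque, since the library's sum reduces on the number of summands and so blocks unification.
  opaque
    sum : ∀ {m} → (Fin m → Carrier) → Carrier
    sum = ∑.sum

    sum-empty : (f : Fin 0 → Carrier) → sum f ≈ 0#
    sum-empty f = refl

    sum-suc : ∀ {m} (f : Fin (suc m) → Carrier) → sum f ≈ f zero + sum (f ∘ suc)
    sum-suc f = refl

    sum-cong : ∀ {m} {f g : Fin m → Carrier} → (∀ i → f i ≈ g i) → sum f ≈ sum g
    sum-cong = ∑.sum-cong-≋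

    sum-remove : ∀ {m} i (f : Fin (suc m) → Carrier) → sum f ≈ f i + sum (f ∘ punchIn i)
    sum-remove i f = ∑.sum-remove {i = i} f

    sum-+ : ∀ {m} (f g : Fin m → Carrier) → sum (λ i → f i + g i) ≈ sum f + sum g
    sum-+ = ∑.∑-distrib-+

    sum-comm : ∀ {m k} (f : Fin m → Fin k → Carrier) →
               sum (λ i → sum (λ j → f i j)) ≈ sum (λ j → sum (λ i → f i j))
    sum-comm = ∑.∑-comm

    *-sumˡ : ∀ {m} x (f : Fin m → Carrier) → x * sum f ≈ sum (λ i → x * f i)
    *-sumˡ = ∑.*-distribˡ-sum

    *-sumʳ : ∀ {m} x (f : Fin m → Carrier) → sum f * x ≈ sum (λ i → f i * x)
    *-sumʳ = ∑.*-distribʳ-sum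

  sum-zero : ∀ {m} {f : Fin m → Carrier} → (∀ i → f i ≈ 0#) → sum f ≈ 0#
  sum-zero {zero}  {f} f≈0 = sum-empty f
  sum-zero {suc m} {f} f≈0 = trans (sum-suc f) (trans (+-cong (f≈0 zero) (sum-zero (f≈0 ∘ suc))) (+-identityˡ 0#))

  sum-single : ∀ {m} {f : Fin m → Carrier} i → (∀ j → j ≢ i → f j ≈ 0#) → sum f ≈ f i
  sum-single {suc m} {f} i f≈0 =
    trans (sum-remove i f) (trans (+-congˡ (sum-zero (λ j → f≈0 _ (Finₚ.punchInᵢ≢i i j)))) (+-identityʳ _))

  conj-sum : ∀ {m} (f : Fin m → Carrier) → conj (sum f) ≈ sum (λ i → conj (f i))
  conj-sum {zero}  f = trans (conj-≈0 (sum-empty f)) (sym (sum-empty _))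
  conj-sum {suc m} f = trans (conj-cong (sum-suc f))
    (trans (conj-+ _ _) (trans (+-congˡ (conj-sum (f ∘ suc))) (sym (sum-suc _))))

  nonNeg-sum : ∀ {m} {f : Fin m → Carrier} → (∀ i → NonNegative (f i)) → NonNegative (sum f)
  nonNeg-sum {zero}  {f} f≥0 = nonNeg-resp (sym (sum-empty f)) nonNeg-0
  nonNeg-sum {suc m} {f} f≥0 = nonNeg-resp (sym (sum-suc f)) (nonNeg-+ (f≥0 zero) (nonNeg-sum (f≥0 ∘ suc)))

  sum-cancel : ∀ {m} {f : Fin m → Carrier} → (∀ i → NonNegative (f i)) → sum f ≈ 0# → ∀ i → f i ≈ 0#
  sum-cancel {suc m} {f} f≥0 eq i =
    nonNeg-cancel (f≥0 i) (nonNeg-sum (f≥0 ∘ punchIn i)) (trans (sym (sum-remove i f)) eq)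

  if-yes : ∀ {p} {P : Set p} (d : Dec P) {a b : Carrier} → P → (if does d then a else b) ≈ a
  if-yes (yes _) _ = refl
  if-yes (no ¬p) p = contradiction p ¬p

  if-no : ∀ {p} {P : Set p} (d : Dec P) {a b : Carrier} → ¬ P → (if does d then a else b) ≈ b
  if-no (yes p) ¬p = contradiction p ¬p
  if-no (no _)  _  = refl

  -- Associativity of row times matrix times column. It serves for matrix products, for actions on
  -- vectors and for expansions in idempotents alike.
  sum-sum-* : ∀ {m k} (f : Fin m → Carrier) (g : Fin m → Fin k → Carrier) (h : Fin k → Carrier) →
              sum (λ i → f i * sum (λ j → g i j * h j)) ≈ sum (λ j → sum (λ i → f i * g i j) * h j)
  sum-sum-* f g h = begin
    sum (λ i → f i * sum (λ j → g i j * h j))   ≈⟨ sum-cong (λ i → *-sumˡ (f i) _) ⟩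
    sum (λ i → sum (λ j → f i * (g i j * h j))) ≈⟨ sum-comm _ ⟩
    sum (λ j → sum (λ i → f i * (g i j * h j))) ≈⟨ sum-cong (λ j → sum-cong (λ i → sym (*-assoc _ _ _))) ⟩
    sum (λ j → sum (λ i → f i * g i j * h j))   ≈⟨ sum-cong (λ j → sym (*-sumʳ (h j) _)) ⟩
    sum (λ j → sum (λ i → f i * g i j) * h j)   ∎
    where open ≈-Reasoning

-- Vectors, matrices, inner product and subspaces.

module Linear (K : StarField) (n : ℕ) where
  open Sums K

  infix  4 _≈ᵛ_ _≈ᴹ_
  infixr 7 _*ᵛ_ _*ᴹ_ _∙ᵛ_ _∙ᴹ_
  infixl 6 _+ᵛ_ _+ᴹ_

  V : Set
  V = Vector Carrier n

  Mat : Set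
  Mat = Fin n → Fin n → Carrier

  _≈ᵛ_ : Rel V 0ℓ
  u ≈ᵛ v = ∀ y → u y ≈ v y

  0ᵛ : V
  0ᵛ _ = 0#

  _+ᵛ_ : V → V → V
  (u +ᵛ v) y = u y + v y

  _∙ᵛ_ : Carrier → V → V
  (c ∙ᵛ v) y = c * v y

  sumᵛ : ∀ {m} → (Fin m → V) → V
  sumᵛ u y = sum (λ k → u k y)

  ⟨_,_⟩ : V → V → Carrier
  ⟨ u , v ⟩ = sum (λ y → u y * conj (v y))

  _≈ᴹ_ : Rel Mat 0ℓ
  B ≈ᴹ C = ∀ y z → B y z ≈ C y z

  0ᴹ : Mat
  0ᴹ _ _ = 0#

  _+ᴹ_ : Mat → Mat → Mat
  (B +ᴹ C) y z = B y z + C y z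

  _∙ᴹ_ : Carrier → Mat → Mat
  (c ∙ᴹ B) y z = c * B y z

  _*ᴹ_ : Mat → Mat → Mat
  (B *ᴹ C) y z = sum (λ w → B y w * C w z)

  _*ᵛ_ : Mat → V → V
  (B *ᵛ v) y = sum (λ z → B y z * v z)

  ≈ᵛ-refl : ∀ {u} → u ≈ᵛ u
  ≈ᵛ-refl _ = refl

  ≈ᵛ-sym : ∀ {u v} → u ≈ᵛ v → v ≈ᵛ u
  ≈ᵛ-sym eq y = sym (eq y)

  ≈ᵛ-trans : ∀ {u v w} → u ≈ᵛ v → v ≈ᵛ w → u ≈ᵛ w
  ≈ᵛ-trans eq eq′ y = trans (eq y) (eq′ y)

  ∙ᵛ-zeroʳ : ∀ c {v} → v ≈ᵛ 0ᵛ → c ∙ᵛ v ≈ᵛ 0ᵛ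
  ∙ᵛ-zeroʳ c eq y = *-zeroʳ⇐ c (eq y)

  +ᵛ-zero : ∀ {u v} → u ≈ᵛ 0ᵛ → v ≈ᵛ 0ᵛ → u +ᵛ v ≈ᵛ 0ᵛ
  +ᵛ-zero eq eq′ y = trans (+-cong (eq y) (eq′ y)) (+-identityˡ 0#)

  *ᵛ-cong : ∀ B {u v} → u ≈ᵛ v → B *ᵛ u ≈ᵛ B *ᵛ v
  *ᵛ-cong B eq y = sum-cong (λ z → *-congˡ (eq z))

  *ᵛ-congˡ : ∀ {B C} v → B ≈ᴹ C → B *ᵛ v ≈ᵛ C *ᵛ v
  *ᵛ-congˡ v eq y = sum-cong (λ z → *-congʳ (eq y z))

  *ᵛ-zero : ∀ B {v} → v ≈ᵛ 0ᵛ → B *ᵛ v ≈ᵛ 0ᵛ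
  *ᵛ-zero B eq y = sum-zero (λ z → *-zeroʳ⇐ (B y z) (eq z))

  *ᵛ-+ : ∀ B u v → B *ᵛ (u +ᵛ v) ≈ᵛ B *ᵛ u +ᵛ B *ᵛ v
  *ᵛ-+ B u v y = trans (sum-cong (λ z → distribˡ (B y z) (u z) (v z))) (sum-+ _ _)

  *ᵛ-∙ : ∀ B c v → B *ᵛ (c ∙ᵛ v) ≈ᵛ c ∙ᵛ (B *ᵛ v)
  *ᵛ-∙ B c v y = trans
    (sum-cong (λ z → solve 3 (λ b c v → b :* (c :* v) := c :* (b :* v)) refl (B y z) c (v z)))
    (sym (*-sumˡ c _))

  *ᵛ-sum : ∀ B {m} (u : Fin m → V) → B *ᵛ sumᵛ u ≈ᵛ sumᵛ (λ k → B *ᵛ u k)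
  *ᵛ-sum B u y = trans (sum-cong (λ z → *-sumˡ (B y z) _)) (sum-comm _)

  *ᵛ-assoc : ∀ B C v → (B *ᴹ C) *ᵛ v ≈ᵛ B *ᵛ (C *ᵛ v)
  *ᵛ-assoc B C v y = sym (sum-sum-* (B y) C v)

  *ᵛ-distribʳ : ∀ B C v → (B +ᴹ C) *ᵛ v ≈ᵛ B *ᵛ v +ᵛ C *ᵛ v
  *ᵛ-distribʳ B C v y = trans (sum-cong (λ z → distribʳ (v z) (B y z) (C y z))) (sum-+ _ _)

  ∙ᴹ-*ᵛ : ∀ c B v → (c ∙ᴹ B) *ᵛ v ≈ᵛ c ∙ᵛ (B *ᵛ v)
  ∙ᴹ-*ᵛ c B v y = trans (sum-cong (λ z → *-assoc c (B y z) (v z))) (sym (*-sumˡ c _))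

  ⟨⟩-cong : ∀ {u u′ v v′} → u ≈ᵛ u′ → v ≈ᵛ v′ → ⟨ u , v ⟩ ≈ ⟨ u′ , v′ ⟩
  ⟨⟩-cong eq eq′ = sum-cong (λ y → *-cong (eq y) (conj-cong (eq′ y)))

  ⟨⟩-conj : ∀ u v → conj ⟨ u , v ⟩ ≈ ⟨ v , u ⟩
  ⟨⟩-conj u v = trans (conj-sum _)
    (sum-cong (λ y → trans (conj-* _ _) (trans (*-congˡ (conj-conj _)) (*-comm _ _))))

  ⟨⟩-swap-0 : ∀ {u v} → ⟨ u , v ⟩ ≈ 0# → ⟨ v , u ⟩ ≈ 0#
  ⟨⟩-swap-0 {u} {v} eq = trans (sym (⟨⟩-conj u v)) (conj-≈0 eq)

  ⟨⟩-zeroˡ : ∀ {u} v → u ≈ᵛ 0ᵛ → ⟨ u , v ⟩ ≈ 0#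
  ⟨⟩-zeroˡ v eq = sum-zero (λ y → *-zeroˡ⇐ _ (eq y))

  ⟨⟩-zeroʳ : ∀ u {v} → v ≈ᵛ 0ᵛ → ⟨ u , v ⟩ ≈ 0#
  ⟨⟩-zeroʳ u eq = ⟨⟩-swap-0 (⟨⟩-zeroˡ u eq)

  ⟨⟩-+ˡ : ∀ u v w → ⟨ u +ᵛ v , w ⟩ ≈ ⟨ u , w ⟩ + ⟨ v , w ⟩
  ⟨⟩-+ˡ u v w = trans (sum-cong (λ y → distribʳ _ _ _)) (sum-+ _ _)

  ⟨⟩-∙ˡ : ∀ c u w → ⟨ c ∙ᵛ u , w ⟩ ≈ c * ⟨ u , w ⟩
  ⟨⟩-∙ˡ c u w = trans (sum-cong (λ y → *-assoc _ _ _)) (sym (*-sumˡ c _))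

  ⟨⟩-sumˡ : ∀ {m} (u : Fin m → V) w → ⟨ sumᵛ u , w ⟩ ≈ sum (λ k → ⟨ u k , w ⟩)
  ⟨⟩-sumˡ u w = trans (sum-cong (λ y → *-sumʳ (conj (w y)) _)) (sum-comm _)

  ⟨⟩-definite : ∀ {u} → ⟨ u , u ⟩ ≈ 0# → u ≈ᵛ 0ᵛ
  ⟨⟩-definite {u} eq y = norm-definite (sum-cancel (λ y → nonNeg-norm (u y)) eq y)

  record Subspace (W : Pred V 0ℓ) : Set where
    field
      resp : ∀ {u v} → u ≈ᵛ v → u ∈ W → v ∈ W
      0-cl : 0ᵛ ∈ W
      +-cl : ∀ {u v} → u ∈ W → v ∈ W → u +ᵛ v ∈ W
      ∙-cl : ∀ c {v} → v ∈ W → c ∙ᵛ v ∈ W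

    zero-cl : ∀ {v} → v ≈ᵛ 0ᵛ → v ∈ W
    zero-cl eq = resp (≈ᵛ-sym eq) 0-cl

    sum-cl : ∀ {m} (u : Fin m → V) → (∀ k → u k ∈ W) → sumᵛ u ∈ W
    sum-cl {zero}  u u∈W = zero-cl (λ y → sum-empty _)
    sum-cl {suc m} u u∈W = resp (λ y → sym (sum-suc _)) (+-cl (u∈W zero) (sum-cl (u ∘ suc) (u∈W ∘ suc)))

    ∙-cancel-cl : ∀ {c v} → ¬ (c ≈ 0#) → c ∙ᵛ v ∈ W → v ∈ W
    ∙-cancel-cl {c} {v} c≉0 cv∈W with c⁻¹ , inv ← inverse c c≉0 =
      resp (λ y → trans (sym (*-assoc _ _ _)) (trans (*-congʳ (trans (*-comm _ _) inv)) (*-identityˡ _)))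
           (∙-cl c⁻¹ cv∈W)

    diff-cl : ∀ {u v} → u +ᵛ v ∈ W → v ∈ W → u ∈ W
    diff-cl {u} {v} u+v∈W v∈W = resp
      (λ y → trans (+-assoc _ _ _) (trans (+-congˡ (x+-1x≈0 (v y))) (+-identityʳ _)))
      (+-cl u+v∈W (∙-cl -1# v∈W))

    complement-cl : ∀ {u v} → u ∈ W → u +ᵛ -1# ∙ᵛ v ∈ W → v ∈ W
    complement-cl {u} {v} u∈W u-v∈W =
      ∙-cancel-cl -1≉0 (diff-cl (resp (λ y → +-comm _ _) u-v∈W) u∈W)

    split-cl : ∀ {u v} → v ∈ W → u +ᵛ -1# ∙ᵛ v ∈ W → u ∈ W
    split-cl v∈W u-v∈W = diff-cl u-v∈W (∙-cl -1# v∈W)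

    single-cl : ∀ {m} (u : Fin m → V) i → sumᵛ u ∈ W → (∀ j → j ≢ i → u j ∈ W) → u i ∈ W
    single-cl {suc m} u i Σu∈W u∈W =
      diff-cl (resp (λ y → sum-remove i (λ k → u k y)) Σu∈W)
              (sum-cl (u ∘ punchIn i) (λ k → u∈W (punchIn i k) (Finₚ.punchInᵢ≢i i k)))

  zeroSubspace : Subspace (_≈ᵛ 0ᵛ)
  zeroSubspace = record
    { resp = λ eq u≈0 → ≈ᵛ-trans (≈ᵛ-sym eq) u≈0
    ; 0-cl = ≈ᵛ-refl
    ; +-cl = +ᵛ-zero
    ; ∙-cl = ∙ᵛ-zeroʳ
    }

  kernelSubspace : ∀ B → Subspace (λ v → B *ᵛ v ≈ᵛ 0ᵛ)
  kernelSubspace B = record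
    { resp = λ eq u → ≈ᵛ-trans (*ᵛ-cong B (≈ᵛ-sym eq)) u
    ; 0-cl = *ᵛ-zero B ≈ᵛ-refl
    ; +-cl = λ u v → ≈ᵛ-trans (*ᵛ-+ B _ _) (+ᵛ-zero u v)
    ; ∙-cl = λ c v → ≈ᵛ-trans (*ᵛ-∙ B c _) (∙ᵛ-zeroʳ c v)
    }

  ⟂-subspace : ∀ w → Subspace (λ v → ⟨ v , w ⟩ ≈ 0#)
  ⟂-subspace w = record
    { resp = λ eq u → trans (⟨⟩-cong (≈ᵛ-sym eq) ≈ᵛ-refl) u
    ; 0-cl = ⟨⟩-zeroˡ w ≈ᵛ-refl
    ; +-cl = λ u v → trans (⟨⟩-+ˡ _ _ w) (trans (+-cong u v) (+-identityˡ 0#))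
    ; ∙-cl = λ c v → trans (⟨⟩-∙ˡ c _ w) (*-zeroʳ⇐ c v)
    }

  open Subspace

  preimageSubspace : ∀ {W} B → Subspace W → Subspace (λ v → B *ᵛ v ∈ W)
  preimageSubspace B W = record
    { resp = λ eq → resp W (*ᵛ-cong B eq)
    ; 0-cl = zero-cl W (*ᵛ-zero B ≈ᵛ-refl)
    ; +-cl = λ u v → resp W (≈ᵛ-sym (*ᵛ-+ B _ _)) (+-cl W u v)
    ; ∙-cl = λ c v → resp W (≈ᵛ-sym (*ᵛ-∙ B c _)) (∙-cl W c v)
    }

  ∩-subspace : ∀ {W W′} → Subspace W → Subspace W′ → Subspace (W ∩ W′)
  ∩-subspace W W′ = record
    { resp = λ eq (u , u′) → resp W eq u , resp W′ eq u′
    ; 0-cl = 0-cl W , 0-cl W′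
    ; +-cl = λ (u , u′) (v , v′) → +-cl W u v , +-cl W′ u′ v′
    ; ∙-cl = λ c (v , v′) → ∙-cl W c v , ∙-cl W′ c v′
    }

  ⋂-subspace : ∀ {I : Set} {W : I → Pred V 0ℓ} → (∀ i → Subspace (W i)) → Subspace (λ v → ∀ i → v ∈ W i)
  ⋂-subspace W = record
    { resp = λ eq u i → resp (W i) eq (u i)
    ; 0-cl = λ i → 0-cl (W i)
    ; +-cl = λ u v i → +-cl (W i) (u i) (v i)
    ; ∙-cl = λ c v i → ∙-cl (W i) c (v i)
    }

  -- As an inductive closure, the span is eliminated on generators by `span-⊆`, with no bookkeeping
  -- of coefficients.
  data Span (P : Pred V 0ℓ) : Pred V 0ℓ where
    gen   : ∀ {v} → v ∈ P → v ∈ Span P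
    null  : 0ᵛ ∈ Span P
    plus  : ∀ {u v} → u ∈ Span P → v ∈ Span P → u +ᵛ v ∈ Span P
    scale : ∀ c {v} → v ∈ Span P → c ∙ᵛ v ∈ Span P
    equal : ∀ {u v} → u ≈ᵛ v → u ∈ Span P → v ∈ Span P

  spanSubspace : ∀ P → Subspace (Span P)
  spanSubspace P = record { resp = equal ; 0-cl = null ; +-cl = plus ; ∙-cl = scale }

  span-⊆ : ∀ {P W} → Subspace W → P ⊆ W → Span P ⊆ W
  span-⊆ W P⊆W (gen v)      = P⊆W v
  span-⊆ W P⊆W null         = 0-cl W
  span-⊆ W P⊆W (plus u v)   = +-cl W (span-⊆ W P⊆W u) (span-⊆ W P⊆W v)
  span-⊆ W P⊆W (scale c v)  = ∙-cl W c (span-⊆ W P⊆W v)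
  span-⊆ W P⊆W (equal eq u) = resp W eq (span-⊆ W P⊆W u)

-- Vandermonde systems and linear dependence.

module Classical (K : StarField) (em : ExcludedMiddle 0ℓ) where
  open Sums K

  -- If wᵢ is not in the subspace, multiplying the w's by θⱼ − θᵢ shortens both the list of
  -- conditions and the set S by one.
  vandermonde : ∀ {n m} → let open Linear K n in {W : Pred V 0ℓ} → Subspace W →
    (θ : Fin m → Carrier) → (∀ i j → θ i ≈ θ j → i ≡ j) →
    ∀ N (w : Fin m → V) → (∀ k → k < N → sumᵛ (λ j → (θ j ^ k) ∙ᵛ w j) ∈ W) →
    (S : Subset m) → (∀ j → w j ∉ W → j Subset.∈ S) → ∣ S ∣ ≤ N → ∀ j → w j ∈ W
  vandermonde {n} {m} {W} sub θ θ-inj = go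
    where
    open Linear K n
    open Subspace sub
    go : ∀ N (w : Fin m → V) → (∀ k → k < N → sumᵛ (λ j → (θ j ^ k) ∙ᵛ w j) ∈ W) →
         (S : Subset m) → (∀ j → w j ∉ W → j Subset.∈ S) → ∣ S ∣ ≤ N → ∀ j → w j ∈ W
    go N w pow S supp ∣S∣≤N j = decidable-stable em λ wⱼ∉W → step N wⱼ∉W pow ∣S∣≤N
      where
      step : ∀ N → w j ∉ W → (∀ k → k < N → sumᵛ (λ j → (θ j ^ k) ∙ᵛ w j) ∈ W) → ∣ S ∣ ≤ N → ⊥
      step zero wⱼ∉W _ ∣S∣≤0 =
        ℕₚ.n≮0 (ℕₚ.<-≤-trans (Subsetₚ.x∈p⇒∣p-x∣<∣p∣ (supp j wⱼ∉W)) ∣S∣≤0)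
      step (suc N) wⱼ∉W pow ∣S∣≤N = wⱼ∉W
        (single-cl w j
          (resp (λ y → sum-cong (λ k → *-identityˡ _)) (pow 0 (s≤s z≤n)))
          (λ i i≢j → ∙-cancel-cl (λ d≈0 → i≢j (θ-inj i j (x+-1y≈0⇒x≈y d≈0)))
                       (go N w′ pow′ (S Subset.- j) supp′
                         (ℕₚ.≤-pred (ℕₚ.≤-trans (Subsetₚ.x∈p⇒∣p-x∣<∣p∣ (supp j wⱼ∉W)) ∣S∣≤N)) i)))
        where
        d : Fin m → Carrier
        d i = θ i + -1# * θ j
        w′ : Fin m → V
        w′ i = d i ∙ᵛ w i
        pow′ : ∀ k → k < N → sumᵛ (λ i → (θ i ^ k) ∙ᵛ w′ i) ∈ W
        pow′ k k<N = resp
          (λ y → trans (+-congˡ (*-sumˡ (-1# * θ j) _)) (trans (sym (sum-+ _ _)) (sum-cong (λ i →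
            solve 5 (λ t p e s w → (t :* p) :* w :+ (e :* s) :* (p :* w) := p :* ((t :+ e :* s) :* w)) refl
              (θ i) (θ i ^ k) -1# (θ j) (w i y)))))
          (+-cl (pow (suc k) (s≤s k<N)) (∙-cl (-1# * θ j) (pow k (ℕₚ.m<n⇒m<1+n k<N))))
        supp′ : ∀ i → w′ i ∉ W → i Subset.∈ S Subset.- j
        supp′ i w′ᵢ∉W = Subsetₚ.x∈p∧x≢y⇒x∈p-y
          (supp i (λ wᵢ∈W → w′ᵢ∉W (∙-cl (d i) wᵢ∈W)))
          (λ { ≡.refl → w′ᵢ∉W (zero-cl (λ y → *-zeroˡ⇐ _ (x+-1x≈0 (θ j)))) })

  -- Scalars are vectors of length one, and the zero subspace turns membership into vanishing.
  vandermonde-scalar : ∀ {m} (θ : Fin m → Carrier) → (∀ i j → θ i ≈ θ j → i ≡ j) →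
    ∀ N (c : Fin m → Carrier) → (∀ k → k < N → sum (λ j → (θ j ^ k) * c j) ≈ 0#) →
    (S : Subset m) → (∀ j → ¬ (c j ≈ 0#) → j Subset.∈ S) → ∣ S ∣ ≤ N → ∀ j → c j ≈ 0#
  vandermonde-scalar θ θ-inj N c pow S supp ∣S∣≤N j =
    vandermonde (Linear.zeroSubspace K 1) θ θ-inj N (λ j _ → c j) (λ k k<N _ → pow k k<N) S
      (λ j cⱼ≉0 → supp j (λ cⱼ≈0 → cⱼ≉0 (λ _ → cⱼ≈0))) ∣S∣≤N j zero

  -- Gaussian elimination on the first coordinate. If it vanishes for all vectors, it is dropped
  -- together with one vector; otherwise multiples of a pivot vector clear it in the others.
  dependent : ∀ m (v : Fin (suc m) → Fin m → Carrier) →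
    ∃ λ (c : Fin (suc m) → Carrier) → (∃ λ i → ¬ (c i ≈ 0#)) × (∀ y → sum (λ i → c i * v i y) ≈ 0#)
  dependent zero    v = (λ _ → 1#) , (zero , 1≉0) , λ ()
  dependent (suc m) v with em {∃ λ p → ¬ (v p zero ≈ 0#)}
  ... | no ¬pivot with c , (i , cᵢ≉0) , rel ← dependent m (λ i y → v (suc i) (suc y)) =
    (λ { zero → 0# ; (suc i) → c i }) , (suc i , cᵢ≉0) , λ
      { zero    → sum-zero (λ i → *-zeroʳ⇐ _ (decidable-stable em (λ vᵢ≉0 → ¬pivot (i , vᵢ≉0))))
      ; (suc y) → trans (sum-suc _) (trans (+-cong (zeroˡ _) (rel y)) (+-identityˡ 0#)) }
  ... | yes (p , vₚ≉0)
    with a⁻¹ , inv ← inverse (v p zero) vₚ≉0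
    with c , (i , cᵢ≉0) , rel ← dependent m
           (λ i y → v (punchIn p i) (suc y) + -1# * (v (punchIn p i) zero * a⁻¹) * v p (suc y)) =
    c′ , (punchIn p i , λ eq → cᵢ≉0 (trans (reflexive (≡.sym (Vectorₚ.insertAt-punchIn c p cₚ i))) eq)) , λ
      { zero → begin
          sum (λ i → c′ i * v i zero)
            ≈⟨ split zero ⟩
          cₚ * v p zero + sum (λ i → c i * v (punchIn p i) zero)
            ≈⟨ +-congʳ (trans (*-sumʳ (v p zero) _) (sum-cong λ i → trans
                 (solve 5 (λ c e x a b → (c :* (e :* (x :* b))) :* a := (a :* b) :* (e :* (c :* x))) refl
                   (c i) -1# (v (punchIn p i) zero) (v p zero) a⁻¹)
                 (trans (*-congʳ inv) (*-identityˡ _)))) ⟩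
          sum (λ i → -1# * (c i * v (punchIn p i) zero)) + sum (λ i → c i * v (punchIn p i) zero)
            ≈⟨ sum-+ _ _ ⟨
          sum (λ i → -1# * (c i * v (punchIn p i) zero) + c i * v (punchIn p i) zero)
            ≈⟨ sum-zero (λ i → trans (+-comm _ _) (x+-1x≈0 _)) ⟩
          0# ∎
      ; (suc y) → begin
          sum (λ i → c′ i * v i (suc y))
            ≈⟨ split (suc y) ⟩
          cₚ * v p (suc y) + sum (λ i → c i * v (punchIn p i) (suc y))
            ≈⟨ +-congʳ (*-sumʳ (v p (suc y)) _) ⟩
          sum (λ i → c i * (-1# * (v (punchIn p i) zero * a⁻¹)) * v p (suc y)) + sum
              (λ i → c i * v (punchIn p i) (suc y))
            ≈⟨ sum-+ _ _ ⟨
          sum (λ i → c i * (-1# * (v (punchIn p i) zero * a⁻¹)) * v p (suc y) + c i * v (punchIn p i) (suc y))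
            ≈⟨ sum-cong (λ i → solve 4 (λ c q s t → (c :* q) :* s :+ c :* t := c :* (t :+ q :* s)) refl
                 (c i) (-1# * (v (punchIn p i) zero * a⁻¹)) (v p (suc y)) (v (punchIn p i) (suc y))) ⟩
          sum (λ i → c i * (v (punchIn p i) (suc y) + -1# * (v (punchIn p i) zero * a⁻¹) * v p (suc y)))
            ≈⟨ rel y ⟩
          0# ∎ }
    where
    open ≈-Reasoning
    cₚ : Carrier
    -- The multiples of the pivot vector that were subtracted from the others add up to its own
    -- coefficient.
    cₚ = sum (λ i → c i * (-1# * (v (punchIn p i) zero * a⁻¹)))
    c′ : Fin (suc (suc m)) → Carrier
    c′ = insertAt c p cₚ
    split : ∀ y → sum (λ i → c′ i * v i y) ≈ cₚ * v p y + sum (λ i → c i * v (punchIn p i) y)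
    split y = trans (sum-remove p (λ i → c′ i * v i y))
      (+-cong (*-congʳ (reflexive (Vectorₚ.insertAt-lookup c p cₚ)))
              (sum-cong (λ i → *-congʳ (reflexive (Vectorₚ.insertAt-punchIn c p cₚ i)))))

-- Orthogonal families and orthogonal projection.

module Projection (K : StarField) (em : ExcludedMiddle 0ℓ) (n : ℕ) where
  open Sums K
  open Classical K em
  open Linear K n
  open Subspace

  -- The existence of such a family stands for k ≤ dim W, without bases or a notion of dimension.
  record OrthogonalFamily (W : Pred V 0ℓ) (k : ℕ) : Set where
    field
      vec     : Fin k → V
      within  : ∀ i → vec i ∈ W
      nonzero : ∀ i → ¬ (vec i ≈ᵛ 0ᵛ)
      ortho   : ∀ i j → i ≢ j → ⟨ vec i , vec j ⟩ ≈ 0#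

  open OrthogonalFamily

  extend : ∀ {W W′ k} → W ⊆ W′ → (b : OrthogonalFamily W k) → ∀ w → w ∈ W′ → ¬ (w ≈ᵛ 0ᵛ) →
           (∀ i → ⟨ w , vec b i ⟩ ≈ 0#) → OrthogonalFamily W′ (suc k)
  extend W⊆W′ b w w∈W w≉0 w⟂b = record
    { vec     = λ { zero → w ; (suc i) → vec b i }
    ; within  = λ { zero → w∈W ; (suc i) → W⊆W′ (within b i) }
    ; nonzero = λ { zero → w≉0 ; (suc i) → nonzero b i }
    ; ortho   = λ { zero zero i≢i → contradiction ≡.refl i≢i
                  ; zero (suc j) _ → w⟂b j
                  ; (suc i) zero _ → ⟨⟩-swap-0 (w⟂b i)
                  ; (suc i) (suc j) i≢j → ortho b i j (i≢j ∘ ≡.cong suc) }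
    }

  -- Among n + 1 vectors there is a linear relation; pairing it with a member whose coefficient is
  -- nonzero leaves a multiple of that member's norm.
  orthogonal-bound : ∀ {W} → ¬ OrthogonalFamily W (suc n)
  orthogonal-bound b with c , (i , cᵢ≉0) , rel ← dependent n (vec b) =
    nonzero b i (⟨⟩-definite (*-cancelˡ-0 cᵢ≉0 (begin
      c i * ⟨ vec b i , vec b i ⟩             ≈⟨ ⟨⟩-∙ˡ _ _ _ ⟨
      ⟨ c i ∙ᵛ vec b i , vec b i ⟩            ≈⟨ sum-single i
          (λ j j≢i → trans (⟨⟩-∙ˡ _ _ _) (*-zeroʳ⇐ _ (ortho b j i j≢i))) ⟨
      sum (λ j → ⟨ c j ∙ᵛ vec b j , vec b i ⟩) ≈⟨ ⟨⟩-sumˡ _ _ ⟨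
      ⟨ sumᵛ (λ j → c j ∙ᵛ vec b j) , vec b i ⟩ ≈⟨ ⟨⟩-zeroˡ _ rel ⟩
      0#                                      ∎)))
    where open ≈-Reasoning

  Complete : ∀ {W k} → OrthogonalFamily W k → Set
  Complete {W} b = ∀ w → w ∈ W → (∀ i → ⟨ w , vec b i ⟩ ≈ 0#) → w ≈ᵛ 0ᵛ

  -- Orthogonal vectors are adjoined as long as there are any. The fuel `f` falls as the family
  -- grows, so exhausting it would contradict `orthogonal-bound`.
  complete-family : ∀ W → ∃ λ k → Σ (OrthogonalFamily W k) Complete
  complete-family W = grow (suc n) 0 (ℕₚ.+-identityʳ _)
    record { vec = λ () ; within = λ () ; nonzero = λ () ; ortho = λ () }
    where
    grow : ∀ f k → f ℕ.+ k ≡ suc n → OrthogonalFamily W k → ∃ λ k → Σ (OrthogonalFamily W k) Complete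
    grow zero    k ≡.refl b = contradiction b orthogonal-bound
    grow (suc f) k eq     b with em {∃ λ w → w ∈ W × ¬ (w ≈ᵛ 0ᵛ) × (∀ i → ⟨ w , vec b i ⟩ ≈ 0#)}
    ... | yes (w , w∈W , w≉0 , w⟂b) = grow f (suc k) (≡.trans (ℕₚ.+-suc f k) eq) (extend id b w w∈W w≉0 w⟂b)
    ... | no ¬w = k , b , λ w w∈W w⟂b → decidable-stable em (λ w≉0 → ¬w (w , w∈W , w≉0 , w⟂b))

  module _ {W : Pred V 0ℓ} (sub : Subspace W) where

    -- Projection onto a maximal orthogonal family of W; maximality takes over the role of a basis.
    orthogonal-decomposition : ∀ v → ∃₂ λ p q → p ∈ W × (∀ w → w ∈ W → ⟨ q , w ⟩ ≈ 0#) × v ≈ᵛ p +ᵛ q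
    orthogonal-decomposition v with k , b , complete ← complete-family W =
      proj v , rest v , proj∈W v , rest⟂W , split v
      where
      inv : ∀ i → ∃ λ s → ⟨ vec b i , vec b i ⟩ * s ≈ 1#
      inv i = inverse _ (nonzero b i ∘ ⟨⟩-definite)
      coeff : V → Fin k → Carrier
      coeff v i = ⟨ v , vec b i ⟩ * proj₁ (inv i)
      proj rest : V → V
      proj v = sumᵛ (λ i → coeff v i ∙ᵛ vec b i)
      rest v = v +ᵛ -1# ∙ᵛ proj v
      proj∈W : ∀ v → proj v ∈ W
      proj∈W v = sum-cl sub _ (λ i → ∙-cl sub _ (within b i))
      split : ∀ v → v ≈ᵛ proj v +ᵛ rest v
      split v y = sym (begin
        proj v y + (v y + -1# * proj v y) ≈⟨ solve 3 (λ p v q → p :+ (v :+ q) := v :+ (p :+ q)) refl (proj v y)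
            (v y) (-1# * proj v y) ⟩
        v y + (proj v y + -1# * proj v y) ≈⟨ +-congˡ (x+-1x≈0 _) ⟩
        v y + 0#                          ≈⟨ +-identityʳ _ ⟩
        v y                               ∎)
        where open ≈-Reasoning
      proj-coeff : ∀ v j → ⟨ proj v , vec b j ⟩ ≈ ⟨ v , vec b j ⟩
      proj-coeff v j = begin
        ⟨ proj v , vec b j ⟩                          ≈⟨ ⟨⟩-sumˡ _ _ ⟩
        sum (λ i → ⟨ coeff v i ∙ᵛ vec b i , vec b j ⟩) ≈⟨ sum-single j
            (λ i i≢j → trans (⟨⟩-∙ˡ _ _ _) (*-zeroʳ⇐ _ (ortho b i j i≢j))) ⟩
        ⟨ coeff v j ∙ᵛ vec b j , vec b j ⟩            ≈⟨ ⟨⟩-∙ˡ _ _ _ ⟩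
        (⟨ v , vec b j ⟩ * proj₁ (inv j)) * ⟨ vec b j , vec b j ⟩
          ≈⟨ solve 3 (λ a s t → (a :* s) :* t := a :* (t :* s)) refl _ _ _ ⟩
        ⟨ v , vec b j ⟩ * (⟨ vec b j , vec b j ⟩ * proj₁ (inv j)) ≈⟨ *-congˡ (proj₂ (inv j)) ⟩
        ⟨ v , vec b j ⟩ * 1#                          ≈⟨ *-identityʳ _ ⟩
        ⟨ v , vec b j ⟩                               ∎
        where open ≈-Reasoning
      rest⟂b : ∀ v j → ⟨ rest v , vec b j ⟩ ≈ 0#
      rest⟂b v j = trans (⟨⟩-+ˡ _ _ _) (trans (+-congˡ (trans (⟨⟩-∙ˡ _ _ _) (*-congˡ (proj-coeff v j))))
          (x+-1x≈0 _))
      -- By completeness of the family, w has no remainder of its own, hence is a combination of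
      -- family members, to which `rest v` is orthogonal.
      rest⟂W : ∀ w → w ∈ W → ⟨ rest v , w ⟩ ≈ 0#
      rest⟂W w w∈W = ⟨⟩-swap-0 (trans (⟨⟩-cong (λ y → x+-1y≈0⇒x≈y (rest-zero y)) ≈ᵛ-refl)
        (trans (⟨⟩-sumˡ _ _) (sum-zero (λ i → trans (⟨⟩-∙ˡ _ _ _) (*-zeroʳ⇐ _ (⟨⟩-swap-0 (rest⟂b v i)))))))
        where
        rest-zero : rest w ≈ᵛ 0ᵛ
        rest-zero = complete (rest w) (+-cl sub w∈W (∙-cl sub -1# (proj∈W w))) (rest⟂b w)

-- Finite sets of indices.

module FiniteSets (em : ExcludedMiddle 0ℓ) where

  -- Excluded middle decides membership, so that a predicate acquires a cardinality.
  subset : ∀ {m} → Pred (Fin m) 0ℓ → Subset m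
  subset P = tabulate (λ i → does (em {P i}))

  ∈-subset⁺ : ∀ {m} (P : Pred (Fin m) 0ℓ) {i} → P i → i Subset.∈ subset P
  ∈-subset⁺ P {i} p = Vecₚ.lookup⇒[]= i (subset P) (≡.trans (Vecₚ.lookup∘tabulate _ i) (dec-true em p))

  ∈-subset⁻ : ∀ {m} (P : Pred (Fin m) 0ℓ) {i} → i Subset.∈ subset P → P i
  ∈-subset⁻ P {i} i∈ with em {P i} | ≡.trans (≡.sym (Vecₚ.lookup∘tabulate (λ i → does (em {P i})) i))
      (Vecₚ.[]=⇒lookup i∈)
  ... | yes p | _ = p
  ... | no _  | ()

  minimum : ∀ {m} (P : Pred (Fin m) 0ℓ) → ∃ P → ∃ (IsMin P)
  minimum {suc m} P (i , p) with em {P zero}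
  ... | yes p₀ = zero , p₀ , λ _ _ → z≤n
  ... | no ¬p₀ with minimum (P ∘ suc) (later i p)
    where
    later : ∀ i → P i → ∃ (P ∘ suc)
    later zero    p = contradiction p ¬p₀
    later (suc i) p = i , p
  ... | j , pⱼ , min = suc j , pⱼ , λ { zero p₀ → contradiction p₀ ¬p₀ ; (suc k) p → s≤s (min k p) }

-- The recursion shifts both ends down along the index set. The hypothesis `a ≤ b` is the claim
-- itself for the empty set.
∣∣-interval : ∀ {m} (S : Subset m) a b → a ≤ b → (∀ i → i Subset.∈ S → a ≤ toℕ i × toℕ i < b) → ∣ S ∣ ℕ.+ a ≤ b
∣∣-interval []          a       b       a≤b inS = a≤b
∣∣-interval (true ∷ S)  zero    zero    a≤b inS with () ← proj₂ (inS zero here)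
∣∣-interval (true ∷ S)  zero    (suc b) a≤b inS =
  s≤s (∣∣-interval S zero b z≤n (λ i i∈ → z≤n , ℕₚ.≤-pred (proj₂ (inS (suc i) (there i∈)))))
∣∣-interval (true ∷ S)  (suc a) b       a≤b inS with () ← proj₁ (inS zero here)
∣∣-interval (false ∷ S) zero    zero    a≤b inS = ∣∣-interval S zero zero z≤n
  (λ i i∈ → contradiction (proj₂ (inS (suc i) (there i∈))) λ ())
∣∣-interval (false ∷ S) zero    (suc b) a≤b inS = ℕₚ.m≤n⇒m≤1+n (∣∣-interval S zero b z≤n
  (λ i i∈ → z≤n , ℕₚ.≤-pred (proj₂ (inS (suc i) (there i∈)))))
∣∣-interval (false ∷ S) (suc a) (suc b) a≤b inS = ℕₚ.≤-trans (ℕₚ.≤-reflexive (ℕₚ.+-suc _ a))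
    (s≤s (∣∣-interval S a b (ℕₚ.≤-pred a≤b)
  (λ i i∈ → let l , u = inS (suc i) (there i∈) in ℕₚ.≤-pred l , ℕₚ.≤-pred u)))

-- Modules for a pair of resolutions of the identity.

module Modules (K : StarField) (em : ExcludedMiddle 0ℓ) (n D : ℕ) where
  open Sums K
  open Classical K em
  open Linear K n
  open Subspace

  Family : Set
  Family = Fin (suc D) → Mat

  record Resolution (E : Family) : Set where
    field
      idem     : ∀ j v → E j *ᵛ (E j *ᵛ v) ≈ᵛ E j *ᵛ v
      orth     : ∀ i j → i ≢ j → ∀ v → E i *ᵛ (E j *ᵛ v) ≈ᵛ 0ᵛ
      complete : ∀ v → v ≈ᵛ sumᵛ (λ j → E j *ᵛ v)
      selfAdj  : ∀ j u v → ⟨ E j *ᵛ u , v ⟩ ≈ ⟨ u , E j *ᵛ v ⟩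

    vanishing : ∀ {v} → (∀ j → E j *ᵛ v ≈ᵛ 0ᵛ) → v ≈ᵛ 0ᵛ
    vanishing {v} Ev≈0 = ≈ᵛ-trans (complete v) (λ y → sum-zero (λ j → Ev≈0 j y))

    adjoint-idem : ∀ j u v → ⟨ E j *ᵛ u , v ⟩ ≈ ⟨ E j *ᵛ u , E j *ᵛ v ⟩
    adjoint-idem j u v = trans (⟨⟩-cong (≈ᵛ-sym (idem j u)) ≈ᵛ-refl) (selfAdj j (E j *ᵛ u) v)

  -- The algebra generated by A is acted on by F as in a (dual) distance-regular graph; β lists the
  -- eigenvalues of the top distance matrix, and vanish expresses Aᵏ A_D = 0 on F r when k + 2r < D.
  record Companion (E F : Family) : Set where
    field
      A       : Mat
      θ       : Fin (suc D) → Carrier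
      θ-inj   : ∀ i j → θ i ≈ θ j → i ≡ j
      A-spec  : ∀ v → A *ᵛ v ≈ᵛ sumᵛ (λ j → θ j ∙ᵛ (E j *ᵛ v))
      tridiag : ∀ i k → suc (toℕ k) < toℕ i ⊎ suc (toℕ i) < toℕ k → ∀ v → F i *ᵛ (A *ᵛ (F k *ᵛ v)) ≈ᵛ 0ᵛ
      β       : Fin (suc D) → Carrier
      β≉0     : ∀ j → ¬ (β j ≈ 0#)
      vanish  : ∀ r u k → F r *ᵛ u ≈ᵛ u → k ℕ.+ (toℕ r ℕ.+ toℕ r) < D →
                sum (λ j → (θ j ^ k) * (β j * ⟨ E j *ᵛ u , E j *ᵛ u ⟩)) ≈ 0#

  -- The bound is strict, so that `h = 0` describes the zero space and lowering by one step can end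
  -- there. Hence the indices exceed those of V_{ij} by one.
  Below : Family → ℕ → Pred V 0ℓ
  Below E h v = ∀ k → h ≤ toℕ k → E k *ᵛ v ≈ᵛ 0ᵛ

  belowSubspace : ∀ E h → Subspace (Below E h)
  belowSubspace E h = ⋂-subspace (λ k → ⋂-subspace (λ _ → kernelSubspace (E k)))

  Meets : Family → Pred V 0ℓ → Pred (Fin (suc D)) 0ℓ
  Meets E W j = ∃ λ v → v ∈ W × ¬ (E j *ᵛ v ≈ᵛ 0ᵛ)

  ¬meets : ∀ E {W j} → ¬ Meets E W j → ∀ {v} → v ∈ W → E j *ᵛ v ≈ᵛ 0ᵛ
  ¬meets E ¬m v∈W = decidable-stable em (λ Ev≉0 → ¬m (_ , v∈W , Ev≉0))

  -- This is a T-module in disguise: T is generated by the two families of idempotents. The form is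
  -- symmetric in them, which makes `swap` free.
  record Invariant (E F : Family) (W : Pred V 0ℓ) : Set where
    field
      subspace : Subspace W
      E-cl     : ∀ j {v} → v ∈ W → E j *ᵛ v ∈ W
      F-cl     : ∀ j {v} → v ∈ W → F j *ᵛ v ∈ W

  open Invariant

  swap : ∀ {E F W} → Invariant E F W → Invariant F E W
  swap inv = record { subspace = subspace inv ; E-cl = F-cl inv ; F-cl = E-cl inv }

  record Irreducible (E F : Family) (W : Pred V 0ℓ) : Set₁ where
    field
      invariant : Invariant E F W
      nonzero   : ∃ λ v → v ∈ W × ¬ (v ≈ᵛ 0ᵛ)
      minimal   : ∀ W′ → Invariant E F W′ → W′ ⊆ W → (∃ λ v → v ∈ W′ × ¬ (v ≈ᵛ 0ᵛ)) → W ⊆ W′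

  open Irreducible

  swapⁱ : ∀ {E F W} → Irreducible E F W → Irreducible F E W
  swapⁱ irr = record
    { invariant = swap (invariant irr) ; nonzero = nonzero irr ; minimal = λ W′ inv → minimal irr W′ (swap inv) }

  -- Dimension at most one, in the form in which it is used: any nonzero component spans all
  -- components at i.
  Thin : Family → Pred V 0ℓ → Set
  Thin E W = ∀ i {u v} → u ∈ W → v ∈ W → ¬ (E i *ᵛ u ≈ᵛ 0ᵛ) → ∃ λ c → E i *ᵛ v ≈ᵛ c ∙ᵛ (E i *ᵛ u)

  -- The union of the V_{h-1,k-1} ∩ W over h + k ≤ D + 2, as Below F h is the sum of the F i V with i < h.
  Corner : Family → Family → Pred V 0ℓ → Pred V 0ℓ
  Corner E F W v = v ∈ W × ∃₂ λ h k → h ℕ.+ k ≤ suc (suc D) × v ∈ Below F h × v ∈ Below E k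

  cornerSwap : ∀ E F W → Corner E F W ⊆ Corner F E W
  cornerSwap E F W (v∈W , h , k , h+k≤ , lowF , lowE) = v∈W , k , h , ℕₚ.≤-trans (ℕₚ.≤-reflexive (ℕₚ.+-comm k h))
      h+k≤ , lowE , lowF

  Orbit : Family → V → Pred V 0ℓ
  Orbit E u = Span (λ v → ∃ λ j → v ≈ᵛ E j *ᵛ u)

  -- Here `A` is a polynomial generator of the algebra spanned by E, and F is the grading that `A`
  -- shifts by at most one. Exchanging the families gives the dual results.
  module OneSided {E F : Family} (resE : Resolution E) (resF : Resolution F) (comp : Companion E F) where
    open Companion comp
    private
      module RE = Resolution resE
      module RF = Resolution resF

    A-E : ∀ j v → A *ᵛ (E j *ᵛ v) ≈ᵛ θ j ∙ᵛ (E j *ᵛ v)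
    A-E j v y = begin
      (A *ᵛ (E j *ᵛ v)) y                          ≈⟨ A-spec _ y ⟩
      sum (λ i → θ i * (E i *ᵛ (E j *ᵛ v)) y)      ≈⟨ sum-single j (λ i i≢j → *-zeroʳ⇐ _ (RE.orth i j i≢j v y)) ⟩
      θ j * (E j *ᵛ (E j *ᵛ v)) y                  ≈⟨ *-congˡ (RE.idem j v y) ⟩
      θ j * (E j *ᵛ v) y                           ∎
      where open ≈-Reasoning

    E-A : ∀ j v → E j *ᵛ (A *ᵛ v) ≈ᵛ θ j ∙ᵛ (E j *ᵛ v)
    E-A j v y = begin
      (E j *ᵛ (A *ᵛ v)) y                          ≈⟨ *ᵛ-cong (E j) (A-spec v) y ⟩
      (E j *ᵛ sumᵛ (λ i → θ i ∙ᵛ (E i *ᵛ v))) y    ≈⟨ *ᵛ-sum (E j) _ y ⟩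
      sum (λ i → (E j *ᵛ (θ i ∙ᵛ (E i *ᵛ v))) y)   ≈⟨ sum-cong (λ i → *ᵛ-∙ (E j) (θ i) _ y) ⟩
      sum (λ i → θ i * (E j *ᵛ (E i *ᵛ v)) y)      ≈⟨ sum-single j
          (λ i i≢j → *-zeroʳ⇐ _ (RE.orth j i (i≢j ∘ ≡.sym) v y)) ⟩
      θ j * (E j *ᵛ (E j *ᵛ v)) y                  ≈⟨ *-congˡ (RE.idem j v y) ⟩
      θ j * (E j *ᵛ v) y                           ∎
      where open ≈-Reasoning

    A-cl : ∀ {W} → Invariant E F W → ∀ {v} → v ∈ W → A *ᵛ v ∈ W
    A-cl inv v∈W = resp (subspace inv) (≈ᵛ-sym (A-spec _))
      (sum-cl (subspace inv) _ (λ j → ∙-cl (subspace inv) (θ j) (E-cl inv j v∈W)))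

    powerSum : ℕ → V → V
    powerSum k v = sumᵛ (λ j → (θ j ^ k) ∙ᵛ (E j *ᵛ v))

    powerSum-zero : ∀ v → v ≈ᵛ powerSum 0 v
    powerSum-zero v y = trans (RE.complete v y) (sum-cong (λ j → sym (*-identityˡ _)))

    powerSum-suc : ∀ k v → A *ᵛ powerSum k v ≈ᵛ powerSum (suc k) v
    powerSum-suc k v y = begin
      (A *ᵛ powerSum k v) y                            ≈⟨ *ᵛ-sum A _ y ⟩
      sum (λ j → (A *ᵛ ((θ j ^ k) ∙ᵛ (E j *ᵛ v))) y)   ≈⟨ sum-cong (λ j → *ᵛ-∙ A (θ j ^ k) _ y) ⟩
      sum (λ j → (θ j ^ k) * (A *ᵛ (E j *ᵛ v)) y)      ≈⟨ sum-cong (λ j → *-congˡ (A-E j v y)) ⟩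
      sum (λ j → (θ j ^ k) * (θ j * (E j *ᵛ v) y))     ≈⟨ sum-cong
          (λ j → solve 3 (λ p t e → p :* (t :* e) := (t :* p) :* e) refl (θ j ^ k) (θ j) _) ⟩
      powerSum (suc k) v y                             ∎
      where open ≈-Reasoning

    -- W contains all powers of A applied to v. These are moments of the components E_j v with D + 1
    -- distinct nodes, so the components can be recovered.
    A-closed⇒E-closed : ∀ {W} → Subspace W → (∀ {v} → v ∈ W → A *ᵛ v ∈ W) → ∀ j {v} → v ∈ W → E j *ᵛ v ∈ W
    A-closed⇒E-closed {W} sub A-cl j {v} v∈W =
      vandermonde sub θ θ-inj (suc D) (λ j → E j *ᵛ v) (λ k _ → powers k) Subset.⊤ (λ _ _ → Subsetₚ.∈⊤)
        (ℕₚ.≤-reflexive (Subsetₚ.∣⊤∣≡n (suc D))) j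
      where
      powers : ∀ k → powerSum k v ∈ W
      powers zero    = resp sub (powerSum-zero v) v∈W
      powers (suc k) = resp sub (powerSum-suc k v) (A-cl (powers k))

    A-raise : ∀ {h v} → v ∈ Below F h → A *ᵛ v ∈ Below F (suc h)
    A-raise {h} {v} low i h<i y = begin
      (F i *ᵛ (A *ᵛ v)) y                               ≈⟨ *ᵛ-cong (F i) (*ᵛ-cong A (RF.complete v)) y ⟩
      (F i *ᵛ (A *ᵛ sumᵛ (λ k → F k *ᵛ v))) y           ≈⟨ *ᵛ-cong (F i) (*ᵛ-sum A _) y ⟩
      (F i *ᵛ sumᵛ (λ k → A *ᵛ (F k *ᵛ v))) y           ≈⟨ *ᵛ-sum (F i) _ y ⟩
      sum (λ k → (F i *ᵛ (A *ᵛ (F k *ᵛ v))) y)          ≈⟨ sum-zero (λ k → term k (ℕₚ.<-≤-connex (toℕ k) h)) ⟩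
      0#                                                ∎
      where
      open ≈-Reasoning
      term : ∀ k → toℕ k < h ⊎ h ≤ toℕ k → (F i *ᵛ (A *ᵛ (F k *ᵛ v))) y ≈ 0#
      term k (inj₁ k<h) = tridiag i k (inj₁ (ℕₚ.≤-<-trans k<h h<i)) v y
      term k (inj₂ h≤k) = *ᵛ-zero (F i) (*ᵛ-zero A (low k h≤k)) y

    -- With c = - θ_k, the operator A + c multiplies the component at j by θ_j - θ_k and so deletes
    -- the top one.
    A-lower : ∀ k {v} → v ∈ Below E (suc k) → ∃ λ c → A *ᵛ v +ᵛ c ∙ᵛ v ∈ Below E k
    A-lower k {v} low with k ℕₚ.<? suc D
    -- Beyond D there is no component to delete, and `Below E k` holds vacuously for every vector.
    ... | no k≮ = 0# , λ j k≤j → contradiction (ℕₚ.≤-<-trans k≤j (Finₚ.toℕ<n j)) k≮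
    ... | yes k< = -1# * θ κ , λ j k≤j y → begin
        (E j *ᵛ (A *ᵛ v +ᵛ (-1# * θ κ) ∙ᵛ v)) y             ≈⟨ *ᵛ-+ (E j) _ _ y ⟩
        (E j *ᵛ (A *ᵛ v)) y + (E j *ᵛ ((-1# * θ κ) ∙ᵛ v)) y ≈⟨ +-cong (E-A j v y) (*ᵛ-∙ (E j) _ v y) ⟩
        θ j * (E j *ᵛ v) y + (-1# * θ κ) * (E j *ᵛ v) y     ≈⟨ distribʳ _ _ _ ⟨
        (θ j + -1# * θ κ) * (E j *ᵛ v) y                    ≈⟨ term j y (ℕₚ.m≤n⇒m<n∨m≡n k≤j) ⟩
        0#                                                  ∎
      where
      open ≈-Reasoning
      κ : Fin (suc D)
      κ = fromℕ< k<
      term : ∀ j y → k < toℕ j ⊎ k ≡ toℕ j → (θ j + -1# * θ κ) * (E j *ᵛ v) y ≈ 0#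
      term j y (inj₁ k<j) = *-zeroʳ⇐ _ (low j k<j y)
      term j y (inj₂ k≡j) with ≡.refl ← Finₚ.toℕ-injective {i = j} {j = κ}
          (≡.trans (≡.sym k≡j) (≡.sym (Finₚ.toℕ-fromℕ< k<))) =
        *-zeroˡ⇐ _ (x+-1x≈0 (θ κ))

    below-0 : ∀ {v} → v ∈ Below E 0 → v ≈ᵛ 0ᵛ
    below-0 low = RE.vanishing (λ j → low j z≤n)

    Span-A-cl : ∀ {W} → Invariant E F W → ∀ {v} → v ∈ Span (Corner E F W) → A *ᵛ v ∈ Span (Corner E F W)
    Span-A-cl {W} inv = span-⊆ (preimageSubspace A (spanSubspace _)) step
      where
      step : ∀ {v} → v ∈ Corner E F W → A *ᵛ v ∈ Span (Corner E F W)
      step (v∈W , h , zero  , _    , lowF , lowE) = equal (≈ᵛ-sym (*ᵛ-zero A (below-0 lowE))) null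
      step {v} (v∈W , h , suc k , h+k≤ , lowF , lowE) with c , low ← A-lower k lowE =
        -- A v is the difference of (A + c) v, which lies in the corner (h + 1, k - 1), and of c v,
        -- which stays in the corner (h, k).
        diff-cl (spanSubspace _)
          (gen ( +-cl (subspace inv) (A-cl inv v∈W) (∙-cl (subspace inv) c v∈W)
               , suc h , k , ℕₚ.≤-trans (ℕₚ.≤-reflexive (≡.sym (ℕₚ.+-suc h k))) h+k≤
               , +-cl (belowSubspace F (suc h)) (A-raise lowF)
                   (∙-cl (belowSubspace F (suc h)) c (λ i h<i → lowF i (ℕₚ.<⇒≤ h<i)))
               , low ))
          (scale c (gen (v∈W , h , suc k , h+k≤ , lowF , lowE)))

    Span-E-cl : ∀ {W} → Invariant E F W → ∀ j {v} → v ∈ Span (Corner E F W) → E j *ᵛ v ∈ Span (Corner E F W)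
    Span-E-cl inv = A-closed⇒E-closed (spanSubspace _) (Span-A-cl inv)

    -- A vector of W with components only below k ≤ ρ is zero, as W has none below ρ. So ρ < k for a
    -- nonzero one, and h + k ≤ D + 2 then bounds h by D + 1 - ρ.
    corner-bound : ∀ {W ρ} → (∀ j → Meets E W j → ρ ≤ toℕ j) → Corner E F W ⊆ Below F (suc D ∸ ρ)
    corner-bound {W} {ρ} min {v} (v∈W , h , k , h+k≤ , lowF , lowE) i D-ρ≤i with ℕₚ.≤-<-connex k ρ
    ... | inj₁ k≤ρ = *ᵛ-zero (F i) (RE.vanishing vanishes)
      where
      vanishes : ∀ j → E j *ᵛ v ≈ᵛ 0ᵛ
      vanishes j with ℕₚ.≤-<-connex k (toℕ j)
      ... | inj₁ k≤j = lowE j k≤j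
      ... | inj₂ j<k = ¬meets E (λ m → ℕₚ.<⇒≱ (ℕₚ.<-≤-trans j<k k≤ρ) (min j m)) v∈W
    ... | inj₂ ρ<k = lowF i (ℕₚ.≤-trans (ℕₚ.m+n≤o⇒m≤o∸n h (ℕₚ.≤-pred (ℕₚ.≤-trans
          (ℕₚ.≤-reflexive (≡.sym (ℕₚ.+-suc h ρ))) (ℕₚ.≤-trans (ℕₚ.+-monoʳ-≤ h ρ<k) h+k≤)))) D-ρ≤i)

    -- If the bound failed, `vanish` would supply as many moment equations for the numbers β_j‖E_j
    -- u‖² as S has elements. As S supports them, all would vanish, and u with them.
    endpoint-bound : ∀ {W r u} → u ∈ W → F r *ᵛ u ≈ᵛ u → ¬ (u ≈ᵛ 0ᵛ) →
      (S : Subset (suc D)) → (∀ j → Meets E W j → j Subset.∈ S) → D < toℕ r ℕ.+ toℕ r ℕ.+ ∣ S ∣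
    endpoint-bound {W} {r} {u} u∈W Fu≈u u≉0 S supp = ℕₚ.≰⇒> λ 2r+S≤D → u≉0 (RE.vanishing λ j →
      ⟨⟩-definite (*-cancelˡ-0 (β≉0 j)
        (vandermonde-scalar θ θ-inj ∣ S ∣ (λ j → β j * ⟨ E j *ᵛ u , E j *ᵛ u ⟩)
          (λ k k<S → vanish r u k Fu≈u (ℕₚ.<-≤-trans (ℕₚ.+-monoˡ-< _ k<S)
            (ℕₚ.≤-trans (ℕₚ.≤-reflexive (ℕₚ.+-comm ∣ S ∣ _)) 2r+S≤D)))
          S (λ j c≉0 → supp j (u , u∈W , λ Eu≈0 → c≉0 (*-zeroʳ⇐ _ (⟨⟩-zeroˡ _ Eu≈0)))) ℕₚ.≤-refl j)))

    orbit-A-cl : ∀ {u v} → v ∈ Orbit E u → A *ᵛ v ∈ Orbit E u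
    orbit-A-cl {u} = span-⊆ (preimageSubspace A (spanSubspace _)) λ (j , v≈Eu) →
      equal (≈ᵛ-sym (≈ᵛ-trans (*ᵛ-cong A v≈Eu) (A-E j u))) (scale (θ j) (gen (j , ≈ᵛ-refl)))

    orbit-self : ∀ u → u ∈ Orbit E u
    orbit-self u = equal (≈ᵛ-sym (RE.complete u)) (sum-cl (spanSubspace _) _ (λ j → gen (j , ≈ᵛ-refl)))

    below-F-cl : ∀ {h} i {v} → v ∈ Below F h → F i *ᵛ v ∈ Below F h
    below-F-cl i {v} low k h≤k with k ≟ i
    ... | yes ≡.refl = ≈ᵛ-trans (RF.idem k v) (low k h≤k)
    ... | no k≢i     = RF.orth k i k≢i v

    below-step : ∀ {v} ι → v ∈ Below F (suc (toℕ ι)) → v +ᵛ -1# ∙ᵛ (F ι *ᵛ v) ∈ Below F (toℕ ι)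
    below-step {v} ι low k ι≤k y with k ≟ ι
    ... | yes ≡.refl = trans (*ᵛ-+ (F k) _ _ y) (trans (+-congˡ
        (trans (*ᵛ-∙ (F k) _ _ y) (*-congˡ (RF.idem k v y)))) (x+-1x≈0 _))
    ... | no k≢ι     = +-cl (kernelSubspace (F k))
      (low k (ℕₚ.≤∧≢⇒< ι≤k (λ eq → k≢ι (≡.sym (Finₚ.toℕ-injective eq)))))
      (∙-cl (kernelSubspace (F k)) -1# (RF.orth k ι k≢ι v)) y

    module Generated {W : Pred V 0ℓ} (irr : Irreducible E F W) (thin : Thin F W) {r} {u₀}
                     (u₀∈W : u₀ ∈ W) (Fu₀≉0 : ¬ (F r *ᵛ u₀ ≈ᵛ 0ᵛ)) (min : ∀ i → Meets F W i → toℕ r ≤ toℕ i) where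
      private
        inv : Invariant E F W
        inv = invariant irr
        u : V
        u = F r *ᵛ u₀
        u∈W : u ∈ W
        u∈W = F-cl inv r u₀∈W

      -- Suppose z in W lies below ι and F_ι A z ≠ 0. By thinness F_ι w is a multiple of F_ι A z,
      -- which is A z minus a vector of W below ι; both terms are in the orbit by induction.
      orbit-step : ∀ ι → (∀ {w} → w ∈ W → w ∈ Below F (toℕ ι) → w ∈ Orbit E u) →
                   ∀ {w} → w ∈ W → F ι *ᵛ w ∈ Orbit E u
      orbit-step ι lower {w} w∈W with ℕₚ.<-cmp (toℕ ι) (toℕ r)
      ... | tri< ι<r _ _ = equal (≈ᵛ-sym (¬meets F (λ m → ℕₚ.<⇒≱ ι<r (min ι m)) w∈W)) null
      ... | tri≈ _ ι≡r _ with ≡.refl ← Finₚ.toℕ-injective ι≡r with c , eq ← thin ι u₀∈W w∈W Fu₀≉0 =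
        equal (≈ᵛ-sym eq) (scale c (orbit-self u))
      ... | tri> _ _ r<ι with em {∃ λ z → z ∈ W × z ∈ Below F (toℕ ι) × ¬ (F ι *ᵛ (A *ᵛ z) ≈ᵛ 0ᵛ)}
      ...   | yes (z , z∈W , low , FAz≉0) with c , eq ← thin ι (A-cl inv z∈W) w∈W FAz≉0 =
        equal (≈ᵛ-sym eq) (scale c (complement-cl (spanSubspace _) (orbit-A-cl (lower z∈W low))
          (lower (+-cl (subspace inv) (A-cl inv z∈W) (∙-cl (subspace inv) -1# (F-cl inv ι (A-cl inv z∈W))))
                 (below-step ι (A-raise low)))))
      -- Otherwise A maps W ∩ `Below F ι` to itself. This subspace is then invariant and contains u
      -- ≠ 0, so by irreducibility it is W, and F_ι w = 0.
      ...   | no ¬z = equal (≈ᵛ-sym (proj₂ (minimal irr Z invZ proj₁ (u , (u∈W , u-low) , Fu₀≉0) w∈W) ι ℕₚ.≤-refl))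
          null
        where
        Z : Pred V 0ℓ
        Z = W ∩ Below F (toℕ ι)
        subZ : Subspace Z
        subZ = ∩-subspace (subspace inv) (belowSubspace F (toℕ ι))
        Z-A-cl : ∀ {v} → v ∈ Z → A *ᵛ v ∈ Z
        Z-A-cl {v} (v∈W , low) = A-cl inv v∈W , λ k ι≤k → case k (ℕₚ.m≤n⇒m<n∨m≡n ι≤k)
          where
          case : ∀ k → toℕ ι < toℕ k ⊎ toℕ ι ≡ toℕ k → F k *ᵛ (A *ᵛ v) ≈ᵛ 0ᵛ
          case k (inj₁ ι<k) = A-raise low k ι<k
          case k (inj₂ ι≡k) with ≡.refl ← Finₚ.toℕ-injective ι≡k =
            decidable-stable em (λ FAv≉0 → ¬z (v , v∈W , low , FAv≉0))
        invZ : Invariant E F Z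
        invZ = record
          { subspace = subZ
          ; E-cl = A-closed⇒E-closed subZ Z-A-cl
          ; F-cl = λ j (v∈W , low) → F-cl inv j v∈W , below-F-cl j low
          }
        u-low : u ∈ Below F (toℕ ι)
        u-low k ι≤k = RF.orth k r (λ { ≡.refl → ℕₚ.<⇒≱ r<ι ι≤k }) u₀

      below-orbit : ∀ i {w} → w ∈ W → w ∈ Below F i → w ∈ Orbit E u
      below-orbit zero    w∈W low = equal (≈ᵛ-sym (RF.vanishing (λ j → low j z≤n))) null
      below-orbit (suc i) {w} w∈W low with i ℕₚ.<? suc D
      ... | no i≮ = below-orbit i w∈W (λ k i≤k → contradiction (ℕₚ.≤-<-trans i≤k (Finₚ.toℕ<n k)) i≮)
      ... | yes i<
        with ι , ≡.refl ← ∃ (λ ι → toℕ ι ≡ i) ∋ (fromℕ< i< , Finₚ.toℕ-fromℕ< i<) =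
        split-cl (spanSubspace _) (orbit-step ι (below-orbit i) w∈W)
          (below-orbit i (+-cl (subspace inv) w∈W (∙-cl (subspace inv) -1# (F-cl inv ι w∈W))) (below-step ι low))

      generated : W ⊆ Orbit E u
      generated w∈W = below-orbit (suc D) w∈W (λ k D<k → contradiction (Finₚ.toℕ<n k) (ℕₚ.≤⇒≯ D<k))

    orbit-component : ∀ {u} i {w} → w ∈ Orbit E u → ∃ λ c → E i *ᵛ w ≈ᵛ c ∙ᵛ (E i *ᵛ u)
    orbit-component {u} i (gen (j , w≈Eu)) with i ≟ j
    ... | yes ≡.refl = 1# , λ y → trans (*ᵛ-cong (E i) w≈Eu y) (trans (RE.idem i u y) (sym (*-identityˡ _)))
    ... | no i≢j     = 0# , λ y → trans (*ᵛ-cong (E i) w≈Eu y) (trans (RE.orth i j i≢j u y) (sym (zeroˡ _)))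
    orbit-component i null = 0# , λ y → trans (*ᵛ-zero (E i) ≈ᵛ-refl y) (sym (zeroˡ _))
    orbit-component i (plus v w) with a , eq ← orbit-component i v | b , eq′ ← orbit-component i w =
      a + b , λ y → trans (*ᵛ-+ (E i) _ _ y) (trans (+-cong (eq y) (eq′ y)) (sym (distribʳ _ _ _)))
    orbit-component i (scale c v) with a , eq ← orbit-component i v =
      c * a , λ y → trans (*ᵛ-∙ (E i) c _ y) (trans (*-congˡ (eq y)) (sym (*-assoc _ _ _)))
    orbit-component i (equal v≈w v) with a , eq ← orbit-component i v =
      a , ≈ᵛ-trans (*ᵛ-cong (E i) (≈ᵛ-sym v≈w)) eq

    -- This is how thinness reaches the other family: every component at i of the orbit is a
    -- multiple of E_i u, so any nonzero one may replace E_i u as a generator.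
    orbit-thin : ∀ {u W} → W ⊆ Orbit E u → Thin E W
    orbit-thin {u} W⊆ i {z} {w} z∈W w∈W Ez≉0
      with a , eq ← orbit-component i (W⊆ z∈W) | b , eq′ ← orbit-component i (W⊆ w∈W)
      with a⁻¹ , inv ← inverse a (λ a≈0 → Ez≉0 (λ y → trans (eq y) (*-zeroˡ⇐ _ a≈0))) =
      b * a⁻¹ , λ y → begin
        (E i *ᵛ w) y                        ≈⟨ eq′ y ⟩
        b * (E i *ᵛ u) y                    ≈⟨ *-congˡ (trans (*-congʳ inv) (*-identityˡ _)) ⟨
        b * ((a * a⁻¹) * (E i *ᵛ u) y)      ≈⟨ solve 4 (λ b a i e → b :* ((a :* i) :* e) := (b :* i) :* (a :* e))
            refl b a a⁻¹ _ ⟩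
        (b * a⁻¹) * (a * (E i *ᵛ u) y)      ≈⟨ *-congˡ (eq y) ⟨
        (b * a⁻¹) * (E i *ᵛ z) y            ∎
      where open ≈-Reasoning

    module _ {W r u} (inv : Invariant E F W) (W⊆ : W ⊆ Orbit E u) (u∈W : u ∈ W) (Fu≈u : F r *ᵛ u ≈ᵛ u)
             (min : ∀ i → Meets F W i → toℕ r ≤ toℕ i) (1≤r : 1 ≤ toℕ r) {χ δ}
             (χ-low : ∀ i → 1 ≤ toℕ i → toℕ i < δ → F i *ᵛ χ ≈ᵛ 0ᵛ)
             (S : Subset (suc D)) (χ-few : ∀ j → Meets E W j → ¬ (E j *ᵛ χ ≈ᵛ 0ᵛ) → j Subset.∈ S)
             (S≤ : ∣ S ∣ ℕ.+ toℕ r ≤ δ) where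

      -- A^k u has F-components only between r and r + k. For r + k < δ none of them meets χ; a
      -- component of χ at 0 does no harm because r ≥ 1.
      orbit-perp : ∀ {w} → w ∈ W → ⟨ w , χ ⟩ ≈ 0#
      orbit-perp w∈W = span-⊆ (⟂-subspace χ) (λ (j , v≈Eu) → trans (⟨⟩-cong v≈Eu ≈ᵛ-refl) (E-perp j)) (W⊆ w∈W)
        where
        powers : ∀ k → powerSum k u ∈ W × powerSum k u ∈ Below F (suc (k ℕ.+ toℕ r))
        powers zero = resp (subspace inv) (powerSum-zero u) u∈W , resp (belowSubspace F _) (powerSum-zero u)
          (λ i r<i → ≈ᵛ-trans (*ᵛ-cong (F i) (≈ᵛ-sym Fu≈u)) (RF.orth i r (λ { ≡.refl → ℕₚ.<-irrefl ≡.refl r<i }) u))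
        powers (suc k) with p∈W , low ← powers k =
          resp (subspace inv) (powerSum-suc k u) (A-cl inv p∈W) ,
          resp (belowSubspace F _) (powerSum-suc k u) (A-raise low)

        low-perp : ∀ {w h} → w ∈ W → w ∈ Below F h → h ≤ δ → ⟨ w , χ ⟩ ≈ 0#
        low-perp {w} {h} w∈W low h≤δ = begin
          ⟨ w , χ ⟩                             ≈⟨ ⟨⟩-cong (RF.complete w) ≈ᵛ-refl ⟩
          ⟨ sumᵛ (λ i → F i *ᵛ w) , χ ⟩         ≈⟨ ⟨⟩-sumˡ _ χ ⟩
          sum (λ i → ⟨ F i *ᵛ w , χ ⟩)          ≈⟨ sum-zero (λ i → trans (RF.adjoint-idem i w χ)
              (term i (ℕₚ.≤-<-connex (toℕ r) (toℕ i)) (ℕₚ.≤-<-connex h (toℕ i)))) ⟩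
          0#                                    ∎
          where
          open ≈-Reasoning
          term : ∀ i → toℕ r ≤ toℕ i ⊎ toℕ i < toℕ r → h ≤ toℕ i ⊎ toℕ i < h → ⟨ F i *ᵛ w , F i *ᵛ χ ⟩ ≈ 0#
          term i (inj₂ i<r) _          = ⟨⟩-zeroˡ _ (¬meets F (λ m → ℕₚ.<⇒≱ i<r (min i m)) w∈W)
          term i (inj₁ _)   (inj₁ h≤i) = ⟨⟩-zeroˡ _ (low i h≤i)
          term i (inj₁ r≤i) (inj₂ i<h) = ⟨⟩-zeroʳ _ (χ-low i (ℕₚ.≤-trans 1≤r r≤i) (ℕₚ.<-≤-trans i<h h≤δ))

        E-perp : ∀ j → ⟨ E j *ᵛ u , χ ⟩ ≈ 0#
        E-perp = vandermonde-scalar θ θ-inj ∣ S ∣ (λ j → ⟨ E j *ᵛ u , χ ⟩)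
          (λ k k<S → trans
            (trans (sum-cong (λ j → sym (⟨⟩-∙ˡ (θ j ^ k) _ χ))) (sym (⟨⟩-sumˡ _ χ)))
            (low-perp (proj₁ (powers k)) (proj₂ (powers k)) (ℕₚ.≤-trans (ℕₚ.+-monoˡ-≤ (toℕ r) k<S) S≤)))
          S (λ j ≉0 → χ-few j
              (u , u∈W , λ Eu≈0 → ≉0 (⟨⟩-zeroˡ χ Eu≈0))
              (λ Eχ≈0 → ≉0 (trans (RE.adjoint-idem j u χ) (⟨⟩-zeroʳ _ Eχ≈0))))
          ℕₚ.≤-refl

-- Both families together: displacement zero and orthogonality to the code.

module Duality (K : StarField) (em : ExcludedMiddle 0ℓ) (em₁ : ExcludedMiddle (lsuc 0ℓ)) (n D : ℕ) where
  open Sums K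
  open Linear K n
  open Projection K em n
  open FiniteSets em
  open Modules K em n D
  open Subspace
  open Invariant
  open Irreducible

  module TwoSided {E F : Family} (resE : Resolution E) (resF : Resolution F)
                  (compE : Companion E F) (compF : Companion F E) where
    private
      module RE = Resolution resE
      module RF = Resolution resF
      module OE = OneSided resE resF compE
      module OF = OneSided resF resE compF

    -- Displacement zero with equal endpoint and dual endpoint: `size-F` says that the diameter is D
    -- - 2r.
    record Balanced (W : Pred V 0ℓ) (r : Fin (suc D)) : Set where
      field
        meets-E : Meets E W r
        meets-F : Meets F W r
        min-E   : ∀ j → Meets E W j → toℕ r ≤ toℕ j
        min-F   : ∀ i → Meets F W i → toℕ r ≤ toℕ i
        max-E   : ∀ j → Meets E W j → toℕ j ≤ D ∸ toℕ r
        max-F   : ∀ i → Meets F W i → toℕ i ≤ D ∸ toℕ r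
        size-F  : ∣ subset (Meets F W) ∣ ℕ.+ (toℕ r ℕ.+ toℕ r) ≡ suc D

    -- Corners are symmetric in the two families, so closure under F is closure under E for the
    -- exchanged pair.
    span-invariant : ∀ {W} → Invariant E F W → Invariant E F (Span (Corner E F W))
    span-invariant {W} inv = record
      { subspace = spanSubspace _
      ; E-cl = OE.Span-E-cl inv
      ; F-cl = λ i v∈ → span-⊆ (spanSubspace _) (λ c → gen (cornerSwap F E W c))
                 (OF.Span-E-cl (swap inv) i (span-⊆ (spanSubspace _) (λ c → gen (cornerSwap E F W c)) v∈))
      }

    -- Comparing a + s + r ≤ D + 1 with D + 1 ≤ 2r + a gives s ≤ r, and the dual comparison gives r
    -- ≤ s; then all the inequalities are equalities.
    balance : ∀ {r s a b} → a ℕ.+ s ≤ suc D ∸ r → b ℕ.+ r ≤ suc D ∸ s → r ≤ D → s ≤ D →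
              D < r ℕ.+ r ℕ.+ a → D < s ℕ.+ s ℕ.+ b → r ≡ s × b ℕ.+ (r ℕ.+ r) ≡ suc D
    balance {r} {s} {a} {b} a+s≤ b+r≤ r≤D s≤D D<r D<s = ≡r , ℕₚ.≤-antisym b+2r≤ (ℕₚ.≤-trans D<s b≥)
      where
      sum≤ : ∀ x y z → z ≤ D → x ℕ.+ y ≤ suc D ∸ z → x ℕ.+ y ℕ.+ z ≤ suc D
      sum≤ x y z z≤D ≤∸ = ℕₚ.≤-trans (ℕₚ.+-monoˡ-≤ z ≤∸) (ℕₚ.≤-reflexive (ℕₚ.m∸n+n≡m (ℕₚ.m≤n⇒m≤1+n z≤D)))
      rearrange : ∀ x y z → x ℕ.+ y ℕ.+ z ≡ z ℕ.+ x ℕ.+ y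
      rearrange x y z = ≡.trans (ℕₚ.+-comm (x ℕ.+ y) z) (≡.sym (ℕₚ.+-assoc z x y))
      s≤r : s ≤ r
      s≤r = ℕₚ.+-cancelˡ-≤ (r ℕ.+ a) s r (ℕₚ.≤-trans (ℕₚ.≤-trans (ℕₚ.≤-reflexive (≡.sym (rearrange a s r)))
        (ℕₚ.≤-trans (sum≤ a s r r≤D a+s≤) D<r)) (ℕₚ.≤-reflexive (≡.sym (rearrange r a r))))
      r≤s : r ≤ s
      r≤s = ℕₚ.+-cancelˡ-≤ (s ℕ.+ b) r s (ℕₚ.≤-trans (ℕₚ.≤-trans (ℕₚ.≤-reflexive (≡.sym (rearrange b r s)))
        (ℕₚ.≤-trans (sum≤ b r s s≤D b+r≤) D<s)) (ℕₚ.≤-reflexive (≡.sym (rearrange s b s))))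
      ≡r : r ≡ s
      ≡r = ℕₚ.≤-antisym r≤s s≤r
      b+2r≤ : b ℕ.+ (r ℕ.+ r) ≤ suc D
      b+2r≤ = ℕₚ.≤-trans (ℕₚ.≤-reflexive (≡.trans (≡.sym (ℕₚ.+-assoc b r r)) (≡.cong (b ℕ.+ r ℕ.+_) ≡r)))
          (sum≤ b r s s≤D b+r≤)
      b≥ : s ℕ.+ s ℕ.+ b ≤ b ℕ.+ (r ℕ.+ r)
      b≥ = ℕₚ.≤-reflexive (≡.trans (ℕₚ.+-comm (s ℕ.+ s) b) (≡.cong (λ x → b ℕ.+ (x ℕ.+ x)) (≡.sym ≡r)))

    someMeets : ∀ {G W v} → Resolution G → v ∈ W → ¬ (v ≈ᵛ 0ᵛ) → ∃ (Meets G W)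
    someMeets {G} res v∈W v≉0 = decidable-stable em λ none →
      v≉0 (Resolution.vanishing res (λ j → ¬meets G (λ m → none (j , m)) v∈W))

    balanced : ∀ {W} → Irreducible E F W → ∀ {v} → v ∈ Corner E F W → ¬ (v ≈ᵛ 0ᵛ) → ∃ (Balanced W)
    balanced {W} irr {v} v∈ v≉0
      with r , meetsF@(u , u∈W , Fu≉0) , minF ← minimum (Meets F W) (someMeets resF (proj₁ v∈) v≉0)
         | s , meetsE@(w , w∈W , Ew≉0) , minE ← minimum (Meets E W) (someMeets resE (proj₁ v∈) v≉0) =
      r , result (Finₚ.toℕ-injective (proj₁ eqs))
      where
      inv : Invariant E F W
      inv = invariant irr
      W⊆ : W ⊆ Span (Corner E F W)
      W⊆ = minimal irr _ (span-invariant inv) (span-⊆ (subspace inv) proj₁) (v , gen v∈ , v≉0)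
      rangeF : ∀ i → Meets F W i → toℕ i < suc D ∸ toℕ s
      rangeF i (z , z∈W , Fz≉0) = ℕₚ.≰⇒> λ D-s≤i → Fz≉0
        (span-⊆ (belowSubspace F _) (λ c → OE.corner-bound minE c) (W⊆ z∈W) i D-s≤i)
      rangeE : ∀ j → Meets E W j → toℕ j < suc D ∸ toℕ r
      rangeE j (z , z∈W , Ez≉0) = ℕₚ.≰⇒> λ D-r≤j → Ez≉0
        (span-⊆ (belowSubspace E _) (λ c → OF.corner-bound minF (cornerSwap E F W c)) (W⊆ z∈W) j D-r≤j)
      eqs : toℕ r ≡ toℕ s × ∣ subset (Meets F W) ∣ ℕ.+ (toℕ r ℕ.+ toℕ r) ≡ suc D
      eqs = balance
        (∣∣-interval (subset (Meets E W)) (toℕ s) _ (ℕₚ.<⇒≤ (rangeE s meetsE))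
          (λ j j∈ → let m = ∈-subset⁻ (Meets E W) j∈ in minE j m , rangeE j m))
        (∣∣-interval (subset (Meets F W)) (toℕ r) _ (ℕₚ.<⇒≤ (rangeF r meetsF))
          (λ i i∈ → let m = ∈-subset⁻ (Meets F W) i∈ in minF i m , rangeF i m))
        (ℕₚ.≤-pred (Finₚ.toℕ<n r)) (ℕₚ.≤-pred (Finₚ.toℕ<n s))
        (OE.endpoint-bound (F-cl inv r u∈W) (RF.idem r u) Fu≉0 (subset (Meets E W)) (λ j → ∈-subset⁺ (Meets E W)))
        (OF.endpoint-bound (E-cl inv s w∈W) (RE.idem s w) Ew≉0 (subset (Meets F W)) (λ i → ∈-subset⁺ (Meets F W)))
      result : r ≡ s → Balanced W r
      result ≡.refl = record
        { meets-E = meetsE ; meets-F = meetsF ; min-E = minE ; min-F = minF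
        ; max-E = λ j m → bound r (rangeE j m)
        ; max-F = λ i m → bound r (rangeF i m)
        ; size-F = proj₂ eqs }
        where
        bound : ∀ {x} r → x < suc D ∸ toℕ r → x ≤ D ∸ toℕ r
        bound r x< = ℕₚ.≤-pred (ℕₚ.≤-trans x< (ℕₚ.≤-reflexive (ℕₚ.+-∸-assoc 1 (ℕₚ.≤-pred (Finₚ.toℕ<n r)))))

    -- This stands in for membership in T, whose elements are felt here only through their action on
    -- modules.
    Preserving : Pred Mat (lsuc 0ℓ)
    Preserving B = ∀ W → Invariant E F W → ∀ {v} → v ∈ W → B *ᵛ v ∈ W

    Few : Family → V → ℕ → ℕ → Set
    Few G χ r δ = ∃ λ S → (∀ j → r ≤ toℕ j → toℕ j ≤ D ∸ r → ¬ (G j *ᵛ χ ≈ᵛ 0ᵛ) → j Subset.∈ S) × ∣ S ∣ ℕ.+ r ≤ δ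

    Low : Family → V → ℕ → Set
    Low G χ δ = ∀ i → 1 ≤ toℕ i → toℕ i < δ → G i *ᵛ χ ≈ᵛ 0ᵛ

    module _ {χ : V} {δ δ* t : ℕ} (lowF : Low F χ δ) (lowE : Low E χ δ*)
             (few : ∀ r → 1 ≤ r → r ≤ t → Few E χ r δ ⊎ Few F χ r δ*)
             (thin : ∀ W → Irreducible E F W → ∀ r → Balanced W r → toℕ r ≤ t → Thin F W)
             {N₀ : Pred V 0ℓ} (N₀-F : ∀ {v} → v ∈ N₀ → F zero *ᵛ v ≈ᵛ 0ᵛ) where

      endpoint-below : ∀ G {W} (r : Fin (suc D)) {h v} → Resolution G → (∀ i → Meets G W i → toℕ r ≤ toℕ i) →
                       v ∈ W → ¬ (v ≈ᵛ 0ᵛ) → v ∈ Below G h → toℕ r < h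
      endpoint-below G r {v = v} res min v∈W v≉0 low = ℕₚ.≰⇒> λ h≤r → v≉0 (Resolution.vanishing res {v} λ i →
        decidable-stable em λ Gv≉0 → Gv≉0 (low i (ℕₚ.≤-trans h≤r (min i (v , v∈W , Gv≉0)))))

      balanced-perp : ∀ {W r} → Irreducible E F W → W ⊆ N₀ → Balanced W r → toℕ r ≤ t → ∀ {w} → w ∈ W →
          ⟨ w , χ ⟩ ≈ 0#
      balanced-perp {W} {r} irr W⊆N₀ bal r≤t = conclude meets-F meets-E
        where
        open Balanced bal
        inv : Invariant E F W
        inv = invariant irr
        thinF : Thin F W
        thinF = thin W irr r bal r≤t
        conclude : Meets F W r → Meets E W r → ∀ {w} → w ∈ W → ⟨ w , χ ⟩ ≈ 0#
        conclude (u₀ , u₀∈W , Fu₀≉0) (w₀ , w₀∈W , Ew₀≉0) = choose (few (toℕ r) 1≤r r≤t)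
          where
          1≤r : 1 ≤ toℕ r
          -- W lies in `N₀`, which has no component at index 0, while r is the index of a nonzero
          -- component.
          1≤r = ℕₚ.n≢0⇒n>0 λ r≡0 → Fu₀≉0 (≡.subst (λ i → F i *ᵛ u₀ ≈ᵛ 0ᵛ)
            (≡.sym (Finₚ.toℕ-injective {j = zero} r≡0)) (N₀-F (W⊆N₀ u₀∈W)))
          W⊆E : W ⊆ Orbit E (F r *ᵛ u₀)
          W⊆E = OE.Generated.generated irr thinF u₀∈W Fu₀≉0 min-F
          W⊆F : W ⊆ Orbit F (E r *ᵛ w₀)
          -- Thinness for E is not a hypothesis; it is read off from the generation by a single
          -- F-component just obtained.
          W⊆F = OF.Generated.generated (swapⁱ irr) (OE.orbit-thin W⊆E) w₀∈W Ew₀≉0 min-E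
          choose : Few E χ (toℕ r) δ ⊎ Few F χ (toℕ r) δ* → ∀ {w} → w ∈ W → ⟨ w , χ ⟩ ≈ 0#
          choose (inj₁ (S , supp , S≤)) w∈W = OE.orbit-perp {u = F r *ᵛ u₀} inv W⊆E (F-cl inv r u₀∈W) (RF.idem r u₀)
              min-F 1≤r
            lowF S (λ j m → supp j (min-E j m) (max-E j m)) S≤ w∈W
          choose (inj₂ (S , supp , S≤)) w∈W = OF.orbit-perp {u = E r *ᵛ w₀} (swap inv) W⊆F (E-cl inv r w₀∈W)
              (RE.idem r w₀) min-E 1≤r
            lowE S (λ i m → supp i (min-F i m) (max-F i m)) S≤ w∈W

      -- Since v is nonzero, r < h and r < k. The two endpoints agree, so a bound by t + 1 on either
      -- h or k yields r ≤ t; this is why the two conclusions of the theorem are proved together.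
      irreducible-perp : ∀ {W} → Irreducible E F W → W ⊆ N₀ → ∀ {v h k} → v ∈ W → ¬ (v ≈ᵛ 0ᵛ) →
        h ℕ.+ k ≤ suc (suc D) → h ≤ suc t ⊎ k ≤ suc t → v ∈ Below F h → v ∈ Below E k →
        ∀ {w} → w ∈ W → ⟨ w , χ ⟩ ≈ 0#
      irreducible-perp {W} irr W⊆N₀ {v} {h} {k} v∈W v≉0 h+k≤ h⊎k≤ belowF belowE =
        finish (balanced irr (v∈W , h , k , h+k≤ , belowF , belowE) v≉0)
        where
        finish : ∃ (Balanced W) → ∀ {w} → w ∈ W → ⟨ w , χ ⟩ ≈ 0#
        finish (r , bal) = balanced-perp irr W⊆N₀ bal
          ([ (λ h≤ → ℕₚ.≤-pred (ℕₚ.≤-trans (endpoint-below F r resF (Balanced.min-F bal) v∈W v≉0 belowF) h≤))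
           , (λ k≤ → ℕₚ.≤-pred (ℕₚ.≤-trans (endpoint-below E r resE (Balanced.min-E bal) v∈W v≉0 belowE) k≤)) ]′
               h⊎k≤)

      complement : Pred V 0ℓ → Pred V 0ℓ → Pred V 0ℓ
      complement N W v = v ∈ N × ∀ w → w ∈ W → ⟨ v , w ⟩ ≈ 0#

      complement-invariant : ∀ {N W} → Invariant E F N → Invariant E F W → Invariant E F (complement N W)
      complement-invariant invN invW = record
        { subspace = ∩-subspace (subspace invN) (⋂-subspace (λ w → ⋂-subspace (λ _ → ⟂-subspace w)))
        ; E-cl = λ j (v∈N , v⟂) → E-cl invN j v∈N , λ w w∈W → trans (RE.selfAdj j _ w) (v⟂ _ (E-cl invW j w∈W))
        ; F-cl = λ j (v∈N , v⟂) → F-cl invN j v∈N , λ w w∈W → trans (RF.selfAdj j _ w) (v⟂ _ (F-cl invW j w∈W))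
        }

      ⟂-cancel : ∀ {p q} → ⟨ q , p ⟩ ≈ 0# → p +ᵛ q ≈ᵛ 0ᵛ → p ≈ᵛ 0ᵛ
      ⟂-cancel {p} {q} q⟂p p+q≈0 = ⟨⟩-definite (begin
        ⟨ p , p ⟩               ≈⟨ +-identityʳ _ ⟨
        ⟨ p , p ⟩ + 0#          ≈⟨ +-congˡ q⟂p ⟨
        ⟨ p , p ⟩ + ⟨ q , p ⟩   ≈⟨ ⟨⟩-+ˡ p q p ⟨
        ⟨ p +ᵛ q , p ⟩          ≈⟨ ⟨⟩-zeroˡ p p+q≈0 ⟩
        0#                      ∎)
        where open ≈-Reasoning

      -- Where G_i annihilates p + q, the vectors G_i p and G_i q are orthogonal with sum zero, so
      -- each of them vanishes.
      below-split : ∀ (G : Family) {W : Pred V 0ℓ} {p q h} → (∀ i {v} → v ∈ W → G i *ᵛ v ∈ W) →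
        (∀ i w → w ∈ W → ⟨ G i *ᵛ q , w ⟩ ≈ 0#) → p ∈ W → p +ᵛ q ∈ Below G h → p ∈ Below G h × q ∈ Below G h
      below-split G {W} {p} {q} {h} cl q⟂ p∈W low = p-low , λ i h≤i y → begin
        (G i *ᵛ q) y                    ≈⟨ +-identityˡ _ ⟨
        0# + (G i *ᵛ q) y               ≈⟨ +-congʳ (p-low i h≤i y) ⟨
        (G i *ᵛ p) y + (G i *ᵛ q) y     ≈⟨ *ᵛ-+ (G i) p q y ⟨
        (G i *ᵛ (p +ᵛ q)) y             ≈⟨ low i h≤i y ⟩
        0#                              ∎
        where
        open ≈-Reasoning
        p-low : p ∈ Below G h
        p-low i h≤i = ⟂-cancel (q⟂ i _ (cl i p∈W)) (≈ᵛ-trans (≈ᵛ-sym (*ᵛ-+ (G i) p q)) (low i h≤i))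

      -- Quantifying over v, h, k and B makes this a property of the module, one that two orthogonal
      -- summands hand on to their sum.
      CornerPerp : Pred V 0ℓ → Set₁
      CornerPerp N = ∀ v h k → v ∈ N → h ℕ.+ k ≤ suc (suc D) → h ≤ suc t ⊎ k ≤ suc t →
        v ∈ Below F h → v ∈ Below E k → ∀ B → B ∈ Preserving → ⟨ B *ᵛ v , χ ⟩ ≈ 0#

      complement-∈ : ∀ {N W v p q} → Invariant E F N → W ⊆ N → v ∈ N → p ∈ W → (∀ w → w ∈ W → ⟨ q , w ⟩ ≈ 0#) →
                     v ≈ᵛ p +ᵛ q → q ∈ complement N W
      complement-∈ inv W⊆N v∈N p∈W q⟂W eq =
        diff-cl (subspace inv) (resp (subspace inv) (λ y → trans (eq y) (+-comm _ _)) v∈N) (W⊆N p∈W) , q⟂W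

      cornerPerp-split : ∀ N W → Invariant E F N → Invariant E F W → W ⊆ N →
                         CornerPerp W → CornerPerp (complement N W) → CornerPerp N
      cornerPerp-split N W inv invW W⊆N perp perp⊥ v h k v∈N h+k≤ h⊎k≤ belowF belowE B presB =
        conclude (orthogonal-decomposition (subspace invW) v)
        where
        inv⊥ : Invariant E F (complement N W)
        inv⊥ = complement-invariant inv invW
        conclude : (∃₂ λ p q → p ∈ W × (∀ w → w ∈ W → ⟨ q , w ⟩ ≈ 0#) × v ≈ᵛ p +ᵛ q) → ⟨ B *ᵛ v , χ ⟩ ≈ 0#
        conclude (p , q , p∈W , q⟂W , v≈p+q) = begin
          ⟨ B *ᵛ v , χ ⟩                    ≈⟨ ⟨⟩-cong (≈ᵛ-trans (*ᵛ-cong B v≈p+q) (*ᵛ-+ B p q)) ≈ᵛ-refl ⟩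
          ⟨ B *ᵛ p +ᵛ B *ᵛ q , χ ⟩          ≈⟨ ⟨⟩-+ˡ _ _ χ ⟩
          ⟨ B *ᵛ p , χ ⟩ + ⟨ B *ᵛ q , χ ⟩   ≈⟨ +-cong
            (perp p h k p∈W h+k≤ h⊎k≤ (proj₁ partsF) (proj₁ partsE) B presB)
            (perp⊥ q h k q∈ h+k≤ h⊎k≤ (proj₂ partsF) (proj₂ partsE) B presB) ⟩
          0# + 0#                           ≈⟨ +-identityˡ 0# ⟩
          0#                                ∎
          where
          open ≈-Reasoning
          q∈ : q ∈ complement N W
          q∈ = complement-∈ inv W⊆N v∈N p∈W q⟂W v≈p+q
          partsF : p ∈ Below F h × q ∈ Below F h
          partsF = below-split F {p = p} {q} (F-cl invW) (λ i → proj₂ (F-cl inv⊥ i q∈)) p∈W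
                     (resp (belowSubspace F h) v≈p+q belowF)
          partsE : p ∈ Below E k × q ∈ Below E k
          partsE = below-split E {p = p} {q} (E-cl invW) (λ i → proj₂ (E-cl inv⊥ i q∈)) p∈W
                     (resp (belowSubspace E k) v≈p+q belowE)

      cornerPerp-irreducible : ∀ N → Irreducible E F N → N ⊆ N₀ → CornerPerp N
      cornerPerp-irreducible N irr N⊆N₀ v h k v∈N h+k≤ h⊎k≤ belowF belowE B presB = conclude em
        where
        conclude : Dec (v ≈ᵛ 0ᵛ) → ⟨ B *ᵛ v , χ ⟩ ≈ 0#
        conclude (yes v≈0) = ⟨⟩-zeroˡ χ (*ᵛ-zero B v≈0)
        conclude (no v≉0)  = irreducible-perp irr N⊆N₀ {v} {h} {k} v∈N v≉0 h+k≤ h⊎k≤ belowF belowE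
          (presB N (invariant irr) v∈N)

      cornerPerp-null : ∀ N → ¬ (∃ λ w → w ∈ N × ¬ (w ≈ᵛ 0ᵛ)) → CornerPerp N
      cornerPerp-null N zeroN v h k v∈N _ _ _ _ B _ =
        ⟨⟩-zeroˡ χ (*ᵛ-zero B (decidable-stable em λ v≉0 → zeroN (v , v∈N , v≉0)))

      Reducible : Pred V 0ℓ → Set₁
      Reducible N = ∃ λ W → Invariant E F W × W ⊆ N × (∃ λ w → w ∈ W × ¬ (w ≈ᵛ 0ᵛ)) × (∃ λ z → z ∈ N × z ∉ W)

      complement-nonzero : ∀ {N W z} → Invariant E F N → Invariant E F W → W ⊆ N → z ∈ N → z ∉ W →
                           ∃ λ q → q ∈ complement N W × ¬ (q ≈ᵛ 0ᵛ)
      complement-nonzero {N} {W} {z} inv invW W⊆N z∈N z∉W = conclude (orthogonal-decomposition (subspace invW) z)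
        where
        conclude : (∃₂ λ p q → p ∈ W × (∀ w → w ∈ W → ⟨ q , w ⟩ ≈ 0#) × z ≈ᵛ p +ᵛ q) →
                   ∃ λ q → q ∈ complement N W × ¬ (q ≈ᵛ 0ᵛ)
        conclude (p , q , p∈W , q⟂W , z≈p+q) = q , complement-∈ inv W⊆N z∈N p∈W q⟂W z≈p+q , λ q≈0 →
          z∉W (resp (subspace invW) (λ y → sym (trans (z≈p+q y) (trans (+-congˡ (q≈0 y)) (+-identityʳ _)))) p∈W)

      -- Both parts of a reducible module have smaller orthogonal families than the whole.
      cornerPerp : ∀ f N → ¬ OrthogonalFamily N f → Invariant E F N → N ⊆ N₀ → CornerPerp N
      cornerPerp zero N ¬family _ _ = contradiction
        record { vec = λ () ; within = λ () ; nonzero = λ () ; ortho = λ () } ¬family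
      cornerPerp (suc f) N ¬family inv N⊆N₀ = conclude em₁ em
        where
        conclude : Dec (Reducible N) → Dec (∃ λ w → w ∈ N × ¬ (w ≈ᵛ 0ᵛ)) → CornerPerp N
        conclude (no _)   (no zeroN) = cornerPerp-null N zeroN
        conclude (no ¬red) (yes nz) = cornerPerp-irreducible N irr N⊆N₀
          where
          irr : Irreducible E F N
          irr = record
            { invariant = inv
            ; nonzero = nz
            ; minimal = λ W invW W⊆N nzW {w} w∈N → decidable-stable em λ w∉W →
                ¬red (W , invW , W⊆N , nzW , w , w∈N , w∉W)
            }
        conclude (yes (W , invW , W⊆N , (w , w∈W , w≉0) , (z , z∈N , z∉W))) _ =
          split (complement-nonzero inv invW W⊆N z∈N z∉W)
          where
          split : (∃ λ q → q ∈ complement N W × ¬ (q ≈ᵛ 0ᵛ)) → CornerPerp N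
          split (q , (q∈N , q⟂W) , q≉0) = cornerPerp-split N W inv invW W⊆N
            (cornerPerp f W
              (λ b → ¬family (extend W⊆N b q q∈N q≉0 (λ i → q⟂W _ (OrthogonalFamily.within b i))))
              invW (λ w∈W → N⊆N₀ (W⊆N w∈W)))
            (cornerPerp f (complement N W)
              (λ b → ¬family (extend proj₁ b w (W⊆N w∈W) w≉0
                (λ i → ⟨⟩-swap-0 (proj₂ (OrthogonalFamily.within b i) w w∈W))))
              (complement-invariant inv invW) (λ w∈ → N⊆N₀ (proj₁ w∈)))

-- The Bose-Mesner algebra and its primitive idempotents.

module Scheme (K : StarField) (em : ExcludedMiddle 0ℓ) {n D : ℕ} (𝓢 : SymmetricAssociationScheme n D) where
  open Sums K
  open Classical K em
  open Linear K n
  open Modules K em n D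
  open SymmetricAssociationScheme 𝓢

  *ᴹ-congˡ : ∀ {B B′} C → B ≈ᴹ B′ → B *ᴹ C ≈ᴹ B′ *ᴹ C
  *ᴹ-congˡ C eq y z = sum-cong (λ w → *-congʳ (eq y w))

  *ᴹ-congʳ : ∀ B {C C′} → C ≈ᴹ C′ → B *ᴹ C ≈ᴹ B *ᴹ C′
  *ᴹ-congʳ B eq y z = sum-cong (λ w → *-congˡ (eq w z))

  *ᴹ-assoc : ∀ B C F → (B *ᴹ C) *ᴹ F ≈ᴹ B *ᴹ (C *ᴹ F)
  *ᴹ-assoc B C F y z = sym (sum-sum-* (B y) C (λ w → F w z))

  combination : (Fin (suc D) → Carrier) → Family → Mat
  combination c E y z = sum (λ j → c j * E j y z)

  A : Family
  A i y z = if does (rel y z ≟ i) then 1# else 0#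

  -- The Bose–Mesner algebra, as the matrices constant on each relation.
  M : Pred Mat 0ℓ
  M B = ∃ λ (c : Fin (suc D) → Carrier) → ∀ y z → B y z ≈ c (rel y z)

  A-≡ : ∀ {i y z} → rel y z ≡ i → A i y z ≈ 1#
  A-≡ = if-yes (_ ≟ _)

  A-≢ : ∀ {i y z} → rel y z ≢ i → A i y z ≈ 0#
  A-≢ = if-no (_ ≟ _)

  A-conj : ∀ i y z → conj (A i y z) ≈ A i y z
  A-conj i y z with rel y z ≟ i
  ... | yes _ = conj-1
  ... | no _  = conj-0

  A-idem : ∀ i y z → A i y z * A i y z ≈ A i y z
  A-idem i y z with rel y z ≟ i
  ... | yes _ = *-identityˡ 1#
  ... | no _  = zeroˡ 0#

  A-nonNeg : ∀ i y z → NonNegative (A i y z)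
  A-nonNeg i y z = nonNeg-resp (trans (*-congˡ (A-conj i y z)) (A-idem i y z)) (nonNeg-norm _)

  M-resp : ∀ {B C} → B ≈ᴹ C → B ∈ M → C ∈ M
  M-resp eq (c , B≈c) = c , λ y z → trans (sym (eq y z)) (B≈c y z)

  A-coeff : (c : Fin (suc D) → Carrier) → ∀ y z → combination c A y z ≈ c (rel y z)
  A-coeff c y z = trans
    (sum-single (rel y z) (λ i i≢ → *-zeroʳ⇐ (c i) (A-≢ (i≢ ∘ ≡.sym))))
    (trans (*-congˡ (A-≡ ≡.refl)) (*-identityʳ _))

  A∈M : ∀ i → A i ∈ M
  A∈M i = (λ k → if does (k ≟ i) then 1# else 0#) , λ _ _ → refl

  M-symmetric : ∀ {B} → B ∈ M → ∀ y z → B y z ≈ B z y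
  M-symmetric (c , B≈c) y z =
    trans (B≈c y z) (trans (reflexive (≡.cong c (symmetric y z))) (sym (B≈c z y)))

  M-+ : ∀ {B C} → B ∈ M → C ∈ M → B +ᴹ C ∈ M
  M-+ (b , B≈b) (c , C≈c) = (λ k → b k + c k) , λ y z → +-cong (B≈b y z) (C≈c y z)

  M-∙ : ∀ c {B} → B ∈ M → c ∙ᴹ B ∈ M
  M-∙ c (b , B≈b) = (λ k → c * b k) , λ y z → *-congˡ (B≈b y z)

  M-∘ : ∀ {B C} → B ∈ M → C ∈ M → (λ y z → B y z * C y z) ∈ M
  M-∘ (b , B≈b) (c , C≈c) = (λ k → b k * c k) , λ y z → *-cong (B≈b y z) (C≈c y z)

  conjᴹ : Mat → Mat
  conjᴹ B y z = conj (B y z)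

  M-conj : ∀ {B} → B ∈ M → conjᴹ B ∈ M
  M-conj (b , B≈b) = (λ k → conj (b k)) , λ y z → conj-cong (B≈b y z)

  indicator-sum : ∀ {m} (S : Subset m) → sum (λ w → if lookup S w then 1# else 0#) ≈ ∣ S ∣ · 1#
  indicator-sum []          = sum-empty _
  indicator-sum (true ∷ S)  = trans (sum-suc _) (+-congˡ (indicator-sum S))
  indicator-sum (false ∷ S) = trans (sum-suc _) (trans (+-identityˡ _) (indicator-sum S))

  card-sum : ∀ {m k} {P : Pred (Fin m) 0ℓ} → HasCard P k → {f : Fin m → Carrier} →
             (∀ w → P w → f w ≈ 1#) → (∀ w → ¬ P w → f w ≈ 0#) → sum f ≈ k · 1#
  card-sum {P = P} (S , S⇔P , ≡.refl) {f} f-yes f-no = trans (sum-cong (λ w → term w _ ≡.refl)) (indicator-sum S)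
    where
    term : ∀ w b → lookup S w ≡ b → f w ≈ (if b then 1# else 0#)
    term w true  eq = f-yes w (Equivalence.to (S⇔P w) (Vecₚ.lookup⇒[]= w S eq))
    term w false eq = f-no w λ p → contradiction
      (≡.trans (≡.sym eq) (Vecₚ.[]=⇒lookup (Equivalence.from (S⇔P w) p))) λ ()

  M-* : ∀ {B C} → B ∈ M → C ∈ M → B *ᴹ C ∈ M
  M-* {B} {C} (b , B≈b) (c , C≈c) =
    (λ k → sum (λ i → sum (λ j → b i * c j * (p i j k · 1#)))) , λ y z → begin
      sum (λ w → B y w * C w z)
        ≈⟨ sum-cong (λ w → *-cong (trans (B≈b y w) (sym (A-coeff b y w))) (trans (C≈c w z) (sym (A-coeff c w z)))) ⟩
      sum (λ w → sum (λ i → b i * A i y w) * sum (λ j → c j * A j w z))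
        ≈⟨ sum-cong (λ w → trans (*-sumʳ _ _) (sum-cong (λ i → *-sumˡ _ _))) ⟩
      sum (λ w → sum (λ i → sum (λ j → (b i * A i y w) * (c j * A j w z))))
        ≈⟨ sum-comm _ ⟩
      sum (λ i → sum (λ w → sum (λ j → (b i * A i y w) * (c j * A j w z))))
        ≈⟨ sum-cong (λ i → sum-comm _) ⟩
      sum (λ i → sum (λ j → sum (λ w → (b i * A i y w) * (c j * A j w z))))
        ≈⟨ sum-cong (λ i → sum-cong (λ j → trans
             (sum-cong (λ w → solve 4 (λ b a c d → (b :* a) :* (c :* d) := (b :* c) :* (a :* d)) refl (b i)
                 (A i y w) (c j) (A j w z)))
             (sym (*-sumˡ _ _)))) ⟩
      sum (λ i → sum (λ j → b i * c j * sum (λ w → A i y w * A j w z)))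
        ≈⟨ sum-cong (λ i → sum-cong (λ j → *-congˡ (card-sum (p-count i j (rel y z) y z ≡.refl) (both i j y z)
            (neither i j y z)))) ⟩
      sum (λ i → sum (λ j → b i * c j * (p i j (rel y z) · 1#)))
        ∎
    where
    open ≈-Reasoning
    both : ∀ i j y z w → rel y w ≡ i × rel w z ≡ j → A i y w * A j w z ≈ 1#
    both i j y z w (eq , eq′) = trans (*-cong (A-≡ eq) (A-≡ eq′)) (*-identityˡ 1#)
    neither : ∀ i j y z w → ¬ (rel y w ≡ i × rel w z ≡ j) → A i y w * A j w z ≈ 0#
    neither i j y z w ¬eq with rel y w ≟ i
    ... | no ¬eq₁ = zeroˡ _
    ... | yes eq₁ = *-zeroʳ⇐ _ (A-≢ (λ eq₂ → ¬eq (eq₁ , eq₂)))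

  -- B, C and B C are all symmetric, so B C equals its own transpose C B.
  M-comm : ∀ {B C} → B ∈ M → C ∈ M → B *ᴹ C ≈ᴹ C *ᴹ B
  M-comm B∈M C∈M y z = trans (M-symmetric (M-* B∈M C∈M) y z)
    (sum-cong (λ w → trans (*-comm _ _) (*-cong (M-symmetric C∈M w y) (M-symmetric B∈M z w))))

  A₀-* : ∀ B → A zero *ᴹ B ≈ᴹ B
  A₀-* B y z = trans
    (sum-single y (λ w w≢y → *-zeroˡ⇐ _ (A-≢ (λ eq → w≢y (≡.sym (Equivalence.to (diagonal y w) eq))))))
    (trans (*-congʳ (A-≡ (Equivalence.from (diagonal y y) ≡.refl))) (*-identityˡ _))

  A₀-*ᵛ : ∀ v → A zero *ᵛ v ≈ᵛ v
  A₀-*ᵛ v y = trans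
    (sum-single y (λ w w≢y → *-zeroˡ⇐ _ (A-≢ (λ eq → w≢y (≡.sym (Equivalence.to (diagonal y w) eq))))))
    (trans (*-congʳ (A-≡ (Equivalence.from (diagonal y y) ≡.refl))) (*-identityˡ _))

  IsIdempotent : Pred Mat 0ℓ
  IsIdempotent B = B *ᴹ B ≈ᴹ B

  IsPrimitive : Pred Mat 0ℓ
  IsPrimitive B = B ∈ M × IsIdempotent B × ¬ (B ≈ᴹ 0ᴹ) ×
    (∀ F G → F ∈ M → G ∈ M → IsIdempotent F → IsIdempotent G →
      F *ᴹ G ≈ᴹ 0ᴹ → B ≈ᴹ F +ᴹ G → F ≈ᴹ 0ᴹ ⊎ G ≈ᴹ 0ᴹ)

  *ᴹ-subʳ : ∀ B C F y z → (B *ᴹ (C +ᴹ -1# ∙ᴹ F)) y z ≈ (B *ᴹ C) y z + -1# * (B *ᴹ F) y z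
  *ᴹ-subʳ B C F y z = trans
    (sum-cong (λ w → solve 4 (λ b c e f → b :* (c :+ e :* f) := b :* c :+ e :* (b :* f)) refl (B y w) (C w z) -1#
        (F w z)))
    (trans (sum-+ _ _) (+-congˡ (sym (*-sumˡ -1# _))))

  *ᴹ-subˡ : ∀ B C F y z → ((B +ᴹ -1# ∙ᴹ C) *ᴹ F) y z ≈ (B *ᴹ F) y z + -1# * (C *ᴹ F) y z
  *ᴹ-subˡ B C F y z = trans
    (sum-cong (λ w → solve 4 (λ b c e f → (b :+ e :* c) :* f := b :* f :+ e :* (c :* f)) refl (B y w) (C y w) -1#
        (F w z)))
    (trans (sum-+ _ _) (+-congˡ (sym (*-sumˡ -1# _))))

  -- B is the sum of the orthogonal idempotents B C and B - B C, one of which must vanish by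
  -- primitivity.
  primitive-dichotomy : ∀ {B C} → IsPrimitive B → C ∈ M → IsIdempotent C → B *ᴹ C ≈ᴹ 0ᴹ ⊎ B ≈ᴹ B *ᴹ C
  primitive-dichotomy {B} {C} (B∈M , B² , _ , prim) C∈M C² =
    [ inj₁ , (λ G≈0 → inj₂ (λ y z → x+-1y≈0⇒x≈y (G≈0 y z))) ]′
      (prim F G (M-* B∈M C∈M) (M-+ B∈M (M-∙ -1# (M-* B∈M C∈M))) F² G² FG≈0 B≈F+G)
    where
    open ≈-Reasoning
    F G : Mat
    F = B *ᴹ C
    G = B +ᴹ -1# ∙ᴹ F
    BF≈F : B *ᴹ F ≈ᴹ F
    BF≈F y z = trans (sym (*ᴹ-assoc B B C y z)) (*ᴹ-congˡ C B² y z)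
    FB≈F : F *ᴹ B ≈ᴹ F
    FB≈F y z = trans (M-comm (M-* B∈M C∈M) B∈M y z) (BF≈F y z)
    F² : F *ᴹ F ≈ᴹ F
    F² y z = begin
      (F *ᴹ (B *ᴹ C)) y z     ≈⟨ *ᴹ-assoc F B C y z ⟨
      ((F *ᴹ B) *ᴹ C) y z     ≈⟨ *ᴹ-congˡ C FB≈F y z ⟩
      ((B *ᴹ C) *ᴹ C) y z     ≈⟨ *ᴹ-assoc B C C y z ⟩
      (B *ᴹ (C *ᴹ C)) y z     ≈⟨ *ᴹ-congʳ B C² y z ⟩
      F y z                   ∎
    FG≈0 : F *ᴹ G ≈ᴹ 0ᴹ
    FG≈0 y z = trans (*ᴹ-subʳ F B F y z) (trans (+-cong (FB≈F y z) (*-congˡ (F² y z))) (x+-1x≈0 _))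
    G² : G *ᴹ G ≈ᴹ G
    G² y z = begin
      (G *ᴹ G) y z                          ≈⟨ *ᴹ-subˡ B F G y z ⟩
      (B *ᴹ G) y z + -1# * (F *ᴹ G) y z     ≈⟨ +-cong (*ᴹ-subʳ B B F y z) (*-zeroʳ⇐ _ (FG≈0 y z)) ⟩
      (B *ᴹ B) y z + -1# * (B *ᴹ F) y z + 0# ≈⟨ +-identityʳ _ ⟩
      (B *ᴹ B) y z + -1# * (B *ᴹ F) y z     ≈⟨ +-cong (B² y z) (*-congˡ (BF≈F y z)) ⟩
      G y z                                 ∎
    B≈F+G : B ≈ᴹ F +ᴹ G
    B≈F+G y z = begin
      B y z                         ≈⟨ +-identityʳ _ ⟨
      B y z + 0#                    ≈⟨ +-congˡ (x+-1x≈0 (F y z)) ⟨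
      B y z + (F y z + -1# * F y z) ≈⟨ solve 3 (λ b f g → b :+ (f :+ g) := f :+ (b :+ g)) refl (B y z) (F y z) _ ⟩
      F y z + (B y z + -1# * F y z) ∎

  module Idempotents (E : Family) (prim : ∀ j → IsPrimitive (E j)) (distinct : ∀ i j → E i ≈ᴹ E j → i ≡ j)
                     (complete : ∀ B → IsPrimitive B → ∃ λ j → B ≈ᴹ E j) where

    E∈M : ∀ j → E j ∈ M
    E∈M j = proj₁ (prim j)

    E-idem : ∀ j → E j *ᴹ E j ≈ᴹ E j
    E-idem j = proj₁ (proj₂ (prim j))

    E≉0 : ∀ j → ¬ (E j ≈ᴹ 0ᴹ)
    E≉0 j = proj₁ (proj₂ (proj₂ (prim j)))

    E-sym : ∀ j y z → E j y z ≈ E j z y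
    E-sym j = M-symmetric (E∈M j)

    -- If neither case of the dichotomy gives zero, then E_i = E_i E_j = E_j E_i = E_j, against
    -- distinctness.
    E-orth : ∀ i j → i ≢ j → E i *ᴹ E j ≈ᴹ 0ᴹ
    E-orth i j i≢j = compare (primitive-dichotomy (prim i) (E∈M j) (E-idem j))
                             (primitive-dichotomy (prim j) (E∈M i) (E-idem i))
      where
      commute : E i *ᴹ E j ≈ᴹ E j *ᴹ E i
      commute = M-comm (E∈M i) (E∈M j)
      compare : E i *ᴹ E j ≈ᴹ 0ᴹ ⊎ E i ≈ᴹ E i *ᴹ E j → E j *ᴹ E i ≈ᴹ 0ᴹ ⊎ E j ≈ᴹ E j *ᴹ E i → E i *ᴹ E j ≈ᴹ 0ᴹ
      compare (inj₁ ≈0) _          = ≈0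
      compare (inj₂ _)  (inj₁ ≈0)  = λ y z → trans (commute y z) (≈0 y z)
      compare (inj₂ eq) (inj₂ eq′) = contradiction
        (distinct i j (λ y z → trans (eq y z) (trans (commute y z) (sym (eq′ y z))))) i≢j

    -- By symmetry of B, the diagonal entries of this product are the squared norms of the rows of
    -- B.
    conj-product-zero : ∀ B → B ∈ M → B *ᴹ conjᴹ B ≈ᴹ 0ᴹ → B ≈ᴹ 0ᴹ
    conj-product-zero B B∈M eq y z = norm-definite (sum-cancel (λ w → nonNeg-norm (B y w))
      (trans (sum-cong (λ w → *-congˡ (conj-cong (M-symmetric B∈M y w)))) (eq y y)) z)

    conjᴹ-* : ∀ B C → conjᴹ (B *ᴹ C) ≈ᴹ conjᴹ B *ᴹ conjᴹ C
    conjᴹ-* B C y z = trans (conj-sum _) (sum-cong (λ w → conj-* _ _))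

    conj-idem : ∀ {B} → IsIdempotent B → IsIdempotent (conjᴹ B)
    conj-idem {B} B² y z = trans (sym (conjᴹ-* B B y z)) (conj-cong (B² y z))

    conj-zero⁻ : ∀ {B} → conjᴹ B ≈ᴹ 0ᴹ → B ≈ᴹ 0ᴹ
    conj-zero⁻ eq y z = trans (sym (conj-conj _)) (conj-≈0 (eq y z))

    conj-primitive : ∀ {B} → IsPrimitive B → IsPrimitive (conjᴹ B)
    conj-primitive {B} (B∈M , B² , B≉0 , prim) =
      M-conj B∈M , conj-idem B² , (λ eq → B≉0 (conj-zero⁻ eq)) , λ F G F∈M G∈M F² G² FG≈0 B≈F+G →
        [ (λ eq → inj₁ (conj-zero⁻ eq)) , (λ eq → inj₂ (conj-zero⁻ eq)) ]′
          (prim (conjᴹ F) (conjᴹ G) (M-conj F∈M) (M-conj G∈M) (conj-idem F²) (conj-idem G²)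
            (λ y z → trans (sym (conjᴹ-* F G y z)) (conj-≈0 (FG≈0 y z)))
            (λ y z → trans (sym (conj-conj _)) (trans (conj-cong (B≈F+G y z)) (conj-+ _ _))))

    -- The conjugate of E_j is again primitive, hence some E_l. For l ≠ j, orthogonality would make
    -- the product of E_j with its conjugate zero, and so E_j zero.
    E-real : ∀ j y z → conj (E j y z) ≈ E j y z
    E-real j = compare (complete (conjᴹ (E j)) (conj-primitive (prim j)))
      where
      compare : (∃ λ l → conjᴹ (E j) ≈ᴹ E l) → conjᴹ (E j) ≈ᴹ E j
      compare (l , eq) with j ≟ l
      ... | yes ≡.refl = eq
      ... | no j≢l     = contradiction
        (conj-product-zero (E j) (E∈M j) (λ y z → trans (*ᴹ-congʳ (E j) eq y z) (E-orth j l j≢l y z)))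
        (E≉0 j)

    combination-E : ∀ c k → combination c E *ᴹ E k ≈ᴹ c k ∙ᴹ E k
    combination-E c k y z = begin
      sum (λ w → sum (λ j → c j * E j y w) * E k w z)  ≈⟨ sum-sum-* c (λ j w → E j y w) (λ w → E k w z) ⟨
      sum (λ j → c j * (E j *ᴹ E k) y z)               ≈⟨ sum-single k (λ j j≢k → *-zeroʳ⇐ _ (E-orth j k j≢k y z)) ⟩
      c k * (E k *ᴹ E k) y z                           ≈⟨ *-congˡ (E-idem k y z) ⟩
      c k * E k y z                                    ∎
      where open ≈-Reasoning

    independent : ∀ c → combination c E ≈ᴹ 0ᴹ → ∀ k → c k ≈ 0#
    independent c eq k = decidable-stable em λ cₖ≉0 → E≉0 k λ y z → *-cancelˡ-0 cₖ≉0
      (trans (sym (combination-E c k y z)) (sum-zero (λ w → *-zeroˡ⇐ _ (eq y w))))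

    insertFirst : (Fin (suc D) → Carrier) → Fin (suc (suc D)) → Fin (suc D) → Carrier
    insertFirst b zero    = b
    insertFirst b (suc j) = proj₁ (E∈M j)

    -- D + 1 independent elements of the (D + 1)-dimensional algebra M span it.
    expand : ∀ {B} → B ∈ M → ∃ λ c → B ≈ᴹ combination c E
    expand {B} (b , B≈b) = solveFor (dependent (suc D) (insertFirst b))
      where
      open ≈-Reasoning
      solveFor : (∃ λ c → (∃ λ i → ¬ (c i ≈ 0#)) × (∀ k → sum (λ i → c i * insertFirst b i k) ≈ 0#)) →
                 ∃ λ c → B ≈ᴹ combination c E
      solveFor (c , (i , cᵢ≉0) , rel₀) = normalise (inverse (c zero) c₀≉0)
        where
        relation : ∀ y z → c zero * B y z + combination (c ∘ suc) E y z ≈ 0#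
        relation y z = trans (sym (trans (sum-suc _) (+-cong (*-congˡ (sym (B≈b y z)))
          (sum-cong (λ j → *-congˡ (sym (proj₂ (E∈M j) y z))))))) (rel₀ (rel y z))
        all-zero : c zero ≈ 0# → ∀ i → c i ≈ 0#
        all-zero c₀≈0 zero    = c₀≈0
        all-zero c₀≈0 (suc j) = independent (c ∘ suc) (λ y z →
          trans (sym (trans (+-congʳ (*-zeroˡ⇐ _ c₀≈0)) (+-identityˡ _))) (relation y z)) j
        -- Without B the relation would be one among the independent E_j; hence it can be solved for
        -- B.
        c₀≉0 : ¬ (c zero ≈ 0#)
        c₀≉0 c₀≈0 = cᵢ≉0 (all-zero c₀≈0 i)
        normalise : (∃ λ c₀⁻¹ → c zero * c₀⁻¹ ≈ 1#) → ∃ λ c → B ≈ᴹ combination c E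
        normalise (c₀⁻¹ , inv) = (λ j → -1# * c₀⁻¹ * c (suc j)) , λ y z → begin
          B y z                                           ≈⟨ *-identityˡ _ ⟨
          1# * B y z                                      ≈⟨ *-congʳ inv ⟨
          (c zero * c₀⁻¹) * B y z                         ≈⟨ solve 3 (λ a i b → (a :* i) :* b := i :* (a :* b)) refl
              (c zero) c₀⁻¹ (B y z) ⟩
          c₀⁻¹ * (c zero * B y z)
              ≈⟨ *-congˡ (x+-1y≈0⇒x≈y (trans (+-congˡ (-1*-1x≈x _)) (relation y z))) ⟩
          c₀⁻¹ * (-1# * combination (c ∘ suc) E y z)      ≈⟨ trans (sym (*-assoc _ _ _)) (*-sumˡ _ _) ⟩
          sum (λ j → c₀⁻¹ * -1# * (c (suc j) * E j y z))
              ≈⟨ sum-cong (λ j → solve 4 (λ i e c x → (i :* e) :* (c :* x) := ((e :* i) :* c) :* x) refl c₀⁻¹ -1#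
              (c (suc j)) (E j y z)) ⟩
          sum (λ j → -1# * c₀⁻¹ * c (suc j) * E j y z)    ∎

    -- Multiplying an expansion of the identity by E_j gives c_j E_j = E_j, so all coefficients can
    -- be replaced by 1.
    A₀≈ΣE : ∀ y z → A zero y z ≈ sum (λ j → E j y z)
    A₀≈ΣE = simplify (expand (A∈M zero))
      where
      simplify : (∃ λ c → A zero ≈ᴹ combination c E) → ∀ y z → A zero y z ≈ sum (λ j → E j y z)
      simplify (c , eq) y z = trans (eq y z) (sum-cong (λ j →
        trans (sym (combination-E c j y z)) (trans (*ᴹ-congˡ (E j) (λ y z → sym (eq y z)) y z) (A₀-* (E j) y z))))

    resolution : Resolution E
    resolution = record
      { idem     = λ j v → ≈ᵛ-trans (≈ᵛ-sym (*ᵛ-assoc (E j) (E j) v)) (*ᵛ-congˡ v (E-idem j))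
      ; orth     = λ i j i≢j v → ≈ᵛ-trans (≈ᵛ-sym (*ᵛ-assoc (E i) (E j) v))
                     (λ y → sum-zero (λ z → *-zeroˡ⇐ _ (E-orth i j i≢j y z)))
      ; complete = λ v y → trans (sym (A₀-*ᵛ v y)) (trans (sum-cong (λ z → *-congʳ (A₀≈ΣE y z)))
                     (trans (sum-cong (λ z → *-sumʳ _ _)) (sum-comm _)))
      ; selfAdj  = λ j u v → trans (sum-cong (λ y → *-sumʳ _ _)) (trans (sum-comm _) (sum-cong (λ z →
                     trans (sum-cong (λ y → trans
                       (solve 3 (λ e u v → (e :* u) :* v := u :* (e :* v)) refl (E j y z) (u z) (conj (v y)))
                       (*-congˡ (trans (*-congʳ (trans (E-sym j y z) (sym (E-real j z y)))) (sym (conj-* _ _))))))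
                     (trans (sym (*-sumˡ _ _)) (*-congˡ (sym (conj-sum _)))))))
      }

-- The trace form, dual idempotents and multiplicities.

module Pairing (K : StarField) (em : ExcludedMiddle 0ℓ) {n D : ℕ} (𝓢 : SymmetricAssociationScheme n D) where
  open Sums K
  open Linear K n
  open Modules K em n D
  open SymmetricAssociationScheme 𝓢
  open Scheme K em 𝓢

  -- The trace of B times the transpose of C, and equally the sum of the entries of the entrywise
  -- product. It thus links the two multiplications of M.
  ⟪_,_⟫ : Mat → Mat → Carrier
  ⟪ B , C ⟫ = sum (λ y → sum (λ z → B y z * C y z))

  pair-cong : ∀ {B B′ C C′} → B ≈ᴹ B′ → C ≈ᴹ C′ → ⟪ B , C ⟫ ≈ ⟪ B′ , C′ ⟫
  pair-cong eq eq′ = sum-cong (λ y → sum-cong (λ z → *-cong (eq y z) (eq′ y z)))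

  pair-zero : ∀ B C → (∀ y z → B y z * C y z ≈ 0#) → ⟪ B , C ⟫ ≈ 0#
  pair-zero B C eq = sum-zero (λ y → sum-zero (λ z → eq y z))

  pair-sum : ∀ {m} (c : Fin m → Carrier) (F : Fin m → Mat) C →
             ⟪ (λ y z → sum (λ j → c j * F j y z)) , C ⟫ ≈ sum (λ j → c j * ⟪ F j , C ⟫)
  pair-sum c F C = begin
    sum (λ y → sum (λ z → sum (λ j → c j * F j y z) * C y z))
      ≈⟨ sum-cong (λ y → trans (sum-cong (λ z → trans (*-sumʳ _ _) (sum-cong (λ j → *-assoc _ _ _)))) (sum-comm _))
          ⟩
    sum (λ y → sum (λ j → sum (λ z → c j * (F j y z * C y z))))
      ≈⟨ sum-comm _ ⟩
    sum (λ j → sum (λ y → sum (λ z → c j * (F j y z * C y z))))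
      ≈⟨ sum-cong (λ j → trans (sum-cong (λ y → sym (*-sumˡ _ _))) (sym (*-sumˡ _ _))) ⟩
    sum (λ j → c j * ⟪ F j , C ⟫)
      ∎
    where open ≈-Reasoning

  pair-comm : ∀ B C → ⟪ B , C ⟫ ≈ ⟪ C , B ⟫
  pair-comm B C = sum-cong (λ y → sum-cong (λ z → *-comm _ _))

  size : Fin (suc D) → Carrier
  size i = sum (λ y → sum (λ z → A i y z))

  size≉0 : ∀ i → ¬ (size i ≈ 0#)
  size≉0 i size≈0 = 1≉0 (trans (sym (A-≡ yz≡i))
    (sum-cancel (A-nonNeg i y) (sum-cancel (λ y → nonNeg-sum (A-nonNeg i y)) size≈0 y) z))
    where
    y = proj₁ (nonempty i)
    z = proj₁ (proj₂ (nonempty i))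
    yz≡i : rel y z ≡ i
    yz≡i = proj₂ (proj₂ (nonempty i))

  sum-rel : ∀ (c : Fin (suc D) → Carrier) → sum (λ y → sum (λ z → c (rel y z))) ≈ sum (λ i → c i * size i)
  sum-rel c = begin
    sum (λ y → sum (λ z → c (rel y z)))
      ≈⟨ sum-cong (λ y → sum-cong (λ z → sym (A-coeff c y z))) ⟩
    sum (λ y → sum (λ z → sum (λ i → c i * A i y z)))
      ≈⟨ sum-cong (λ y → sum-comm _) ⟩
    sum (λ y → sum (λ i → sum (λ z → c i * A i y z)))
      ≈⟨ sum-comm _ ⟩
    sum (λ i → sum (λ y → sum (λ z → c i * A i y z)))
      ≈⟨ sum-cong (λ i → trans (sum-cong (λ y → sym (*-sumˡ _ _))) (sym (*-sumˡ _ _))) ⟩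
    sum (λ i → c i * size i)
      ∎
    where open ≈-Reasoning

  diag : V → Mat
  diag v y z = if does (y ≟ z) then v y else 0#

  diag-*ᵛ : ∀ u v y → (diag u *ᵛ v) y ≈ u y * v y
  diag-*ᵛ u v y = trans
    (sum-single y (λ z z≢y → *-zeroˡ⇐ _ (if-no (y ≟ z) (z≢y ∘ ≡.sym))))
    (*-congʳ (if-yes (y ≟ y) ≡.refl))

  E* : Fin n → Family
  E* x i = diag (A i x)

  E*-inside : ∀ {x i y} v → rel x y ≡ i → (E* x i *ᵛ v) y ≈ v y
  E*-inside {x} {i} {y} v eq = trans (diag-*ᵛ (A i x) v y) (trans (*-congʳ (A-≡ eq)) (*-identityˡ _))

  E*-outside : ∀ {x i y} v → rel x y ≢ i → (E* x i *ᵛ v) y ≈ 0#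
  E*-outside {x} {i} {y} v ≢i = trans (diag-*ᵛ (A i x) v y) (*-zeroˡ⇐ _ (A-≢ ≢i))

  E*-combination : ∀ x (c : Fin (suc D) → Carrier) v y → sum (λ i → c i * (E* x i *ᵛ v) y) ≈ c (rel x y) * v y
  E*-combination x c v y = trans
    (sum-single (rel x y) (λ i i≢ → *-zeroʳ⇐ _ (E*-outside v (i≢ ∘ ≡.sym))))
    (*-congˡ (E*-inside v ≡.refl))

  E*-resolution : ∀ x → Resolution (E* x)
  E*-resolution x = record
    { idem     = λ i v y → idem i v y (rel x y ≟ i)
    ; orth     = λ i j i≢j v y → orth i j i≢j v y (rel x y ≟ i)
    ; complete = λ v y → trans (sym (*-identityˡ _)) (trans (sym (E*-combination x (λ _ → 1#) v y))
        (sum-cong (λ i → *-identityˡ _)))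
    ; selfAdj  = λ i u v → sum-cong (λ y → trans (*-congʳ (diag-*ᵛ (A i x) u y)) (trans
        (solve 3 (λ a u v → (a :* u) :* v := u :* (a :* v)) refl (A i x y) (u y) (conj (v y)))
        (*-congˡ (trans (*-congʳ (sym (A-conj i x y))) (trans (sym (conj-* _ _))
            (conj-cong (sym (diag-*ᵛ (A i x) v y))))))))
    }
    where
    idem : ∀ i v y → Dec (rel x y ≡ i) → (E* x i *ᵛ (E* x i *ᵛ v)) y ≈ (E* x i *ᵛ v) y
    idem i v y (yes eq) = E*-inside _ eq
    idem i v y (no ≢i)  = trans (E*-outside _ ≢i) (sym (E*-outside v ≢i))
    orth : ∀ i j → i ≢ j → ∀ v y → Dec (rel x y ≡ i) → (E* x i *ᵛ (E* x j *ᵛ v)) y ≈ 0#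
    orth i j i≢j v y (yes eq) = trans (E*-inside _ eq) (E*-outside v (λ eq′ → i≢j (≡.trans (≡.sym eq) eq′)))
    orth i j i≢j v y (no ≢i)  = E*-outside _ ≢i

  module Multiplicities (E : Family) (prim : ∀ j → IsPrimitive (E j)) (distinct : ∀ i j → E i ≈ᴹ E j → i ≡ j)
                        (complete : ∀ B → IsPrimitive B → ∃ λ j → B ≈ᴹ E j) where
    open Idempotents E prim distinct complete

    -- As E_j is a symmetric idempotent, this is its trace, the multiplicity of the j-th eigenspace.
    mult : Fin (suc D) → Carrier
    mult j = ⟪ E j , E j ⟫

    pair-orth : ∀ i j → i ≢ j → ⟪ E i , E j ⟫ ≈ 0#
    pair-orth i j i≢j = sum-zero (λ y → trans (sum-cong (λ z → *-congˡ (E-sym j y z))) (E-orth i j i≢j y y))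

    mult≉0 : ∀ j → ¬ (mult j ≈ 0#)
    mult≉0 j m≈0 = E≉0 j (λ y z → norm-definite (trans (*-congˡ (E-real j y z))
      (sum-cancel (square≥0 y) (sum-cancel (λ y → nonNeg-sum (square≥0 y)) m≈0 y) z)))
      where
      square≥0 : ∀ y z → NonNegative (E j y z * E j y z)
      square≥0 y z = nonNeg-resp (*-congˡ (E-real j y z)) (nonNeg-norm _)

    pair-combination : ∀ c l → ⟪ combination c E , E l ⟫ ≈ c l * mult l
    pair-combination c l = trans (pair-sum c E (E l))
      (sum-single l (λ j j≢l → *-zeroʳ⇐ _ (pair-orth j l j≢l)))

    coefficient-zero : ∀ {B c} → B ≈ᴹ combination c E → ∀ l → ⟪ B , E l ⟫ ≈ 0# → c l ≈ 0#
    coefficient-zero {B} {c} eq l pair≈0 = *-cancelˡ-0 (mult≉0 l)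
      (trans (*-comm _ _) (trans (sym (pair-combination c l))
          (trans (pair-cong (λ y z → sym (eq y z)) (λ _ _ → refl)) pair≈0)))

-- The companion supplied by the metric property.

module Metricity (K : StarField) (em : ExcludedMiddle 0ℓ) {n D : ℕ} (𝓢 : SymmetricAssociationScheme n D) where
  open Sums K
  open Classical K em
  open Linear K n
  open Modules K em n D
  open SymmetricAssociationScheme 𝓢
  open Graph (λ y z → toℕ (rel y z) ≡ 1)
  open Scheme K em 𝓢
  open Pairing K em 𝓢

  module _ (rel-dist : ∀ i y z → rel y z ≡ i ⇔ Dist (toℕ i) y z) where

    d : Fin n → Fin n → ℕ
    d y z = toℕ (rel y z)

    d-sym : ∀ y z → d y z ≡ d z y
    d-sym y z = ≡.cong toℕ (symmetric y z)

    d-walk : ∀ y z → Walk (d y z) y z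
    d-walk y z = proj₁ (Equivalence.to (rel-dist (rel y z) y z) ≡.refl)

    walk-≤ : ∀ {k y z} → Walk k y z → d y z ≤ k
    walk-≤ {k} {y} {z} w = ℕₚ.≮⇒≥ λ k<d → proj₂ (Equivalence.to (rel-dist (rel y z) y z) ≡.refl) k k<d w

    walk-++ : ∀ {k l y z w} → Walk k y z → Walk l z w → Walk (k ℕ.+ l) y w
    walk-++ {zero}  ≡.refl      w′ = w′
    walk-++ {suc k} (v , a , w) w′ = v , a , walk-++ {k} w w′

    triangle : ∀ y z w → d y w ≤ d y z ℕ.+ d z w
    triangle y z w = walk-≤ (walk-++ {d y z} (d-walk y z) (d-walk z w))

    module Adjacency (one : Fin (suc D)) (one≡1 : toℕ one ≡ 1) where

      neighbour-≤ : ∀ y z w → rel y w ≡ one → d w z ≤ suc (d y z)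
      neighbour-≤ y z w eq = ℕₚ.≤-trans (triangle w y z)
        (ℕₚ.≤-reflexive (≡.cong (ℕ._+ d y z) (≡.trans (d-sym w y) (≡.trans (≡.cong toℕ eq) one≡1))))

      powers : ℕ → Mat → Mat
      powers zero    B = B
      powers (suc k) B = A one *ᴹ powers k B

      far : ℕ → Mat
      far k = powers k (A (fromℕ D))

      -- Each factor A₁ changes the distance to z by at most one, and k + d(y,z) < D leaves distance
      -- D out of reach.
      far-zero : ∀ k y z → k ℕ.+ d y z < D → far k y z ≈ 0#
      far-zero zero y z d<D = A-≢ λ eq → ℕₚ.<-irrefl (≡.trans (≡.cong toℕ eq) (Finₚ.toℕ-fromℕ D)) d<D
      far-zero (suc k) y z k+d<D = sum-zero term
        where
        term : ∀ w → A one y w * far k w z ≈ 0#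
        term w with rel y w ≟ one
        ... | no _   = zeroˡ _
        ... | yes eq = *-zeroʳ⇐ _ (far-zero k w z (ℕₚ.≤-<-trans (ℕₚ.+-monoʳ-≤ k (neighbour-≤ y z w eq))
                         (ℕₚ.≤-<-trans (ℕₚ.≤-reflexive (ℕₚ.+-suc k (d y z))) k+d<D)))

      walks : ℕ → Mat
      walks k = powers k (A zero)

      walks-nonNeg : ∀ k y z → NonNegative (walks k y z)
      term-nonNeg : ∀ k y z w → NonNegative (A one y w * walks k w z)
      walks-nonNeg zero    y z = A-nonNeg zero y z
      walks-nonNeg (suc k) y z = nonNeg-sum (term-nonNeg k y z)
      term-nonNeg k y z w with rel y w ≟ one
      ... | no _  = nonNeg-resp (sym (zeroˡ _)) nonNeg-0
      ... | yes _ = nonNeg-resp (sym (*-identityˡ _)) (walks-nonNeg k w z)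

      walks-zero : ∀ k y z → k < d y z → walks k y z ≈ 0#
      walks-zero zero y z 0<d = A-≢ λ eq → ℕₚ.<-irrefl (≡.sym (≡.cong toℕ eq)) 0<d
      walks-zero (suc k) y z k<d = sum-zero term
        where
        term : ∀ w → A one y w * walks k w z ≈ 0#
        term w with rel y w ≟ one
        ... | no _   = zeroˡ _
        ... | yes eq = *-zeroʳ⇐ _ (walks-zero k w z (ℕₚ.≤-pred
            (ℕₚ.≤-trans k<d (neighbour-≤ w z y (≡.trans (symmetric w y) eq)))))

      walks-≉0 : ∀ k y z → Walk k y z → ¬ (walks k y z ≈ 0#)
      walks-≉0 zero y z y≡z eq = 1≉0 (trans (sym (A-≡ (Equivalence.from (diagonal y z) y≡z))) eq)
      walks-≉0 (suc k) y z (w , adj , walk) eq = walks-≉0 k w z walk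
        (*-cancelˡ-0 (λ A≈0 → 1≉0 (trans (sym (A-≡ (Finₚ.toℕ-injective (≡.trans adj (≡.sym one≡1))))) A≈0))
          (sum-cancel (term-nonNeg k y z) eq w))

      -- The counts of walks of length k are triangular with respect to the distance.
      walks-separate : ∀ (q : Fin (suc D) → Carrier) →
        (∀ k → sum (λ y → sum (λ z → walks k y z * q (rel y z))) ≈ 0#) → ∀ i → q i ≈ 0#
      walks-separate q eq i = below (suc (toℕ i)) i ℕₚ.≤-refl
        where
        below : ∀ k i → toℕ i < k → q i ≈ 0#
        below (suc k) i i<k = *-cancelˡ-0 total≉0
          (trans (trans (*-sumʳ _ _) (sum-cong (λ y → *-sumʳ _ _)))
            (trans (sum-cong (λ y → sum-cong (λ z → sym (term y z)))) (eq (toℕ i))))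
          where
          -- In the pairing with walks of length i only relation i survives: q is zero at smaller
          -- distances by induction, and at larger ones there are no such walks.
          W : Mat
          W y z = if does (rel y z ≟ i) then walks (toℕ i) y z else 0#
          W-nonNeg : ∀ y z → NonNegative (W y z)
          W-nonNeg y z with rel y z ≟ i
          ... | yes _ = walks-nonNeg (toℕ i) y z
          ... | no _  = nonNeg-0
          total≉0 : ¬ (sum (λ y → sum (λ z → W y z)) ≈ 0#)
          total≉0 ≈0 = walks-≉0 (toℕ i) y z (≡.subst (λ l → Walk (toℕ l) y z) yz≡i (d-walk y z))
            (trans (sym (if-yes (rel y z ≟ i) yz≡i))
              (sum-cancel (W-nonNeg y) (sum-cancel (λ y → nonNeg-sum (W-nonNeg y)) ≈0 y) z))
            where
            y = proj₁ (nonempty i)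
            z = proj₁ (proj₂ (nonempty i))
            yz≡i : rel y z ≡ i
            yz≡i = proj₂ (proj₂ (nonempty i))
          term : ∀ y z → walks (toℕ i) y z * q (rel y z) ≈ W y z * q i
          term y z with rel y z ≟ i
          ... | yes yz≡i = *-congˡ (reflexive (≡.cong q yz≡i))
          ... | no yz≢i with ℕₚ.≤-<-connex (d y z) (toℕ i)
          ...   | inj₂ i<d = trans (*-zeroˡ⇐ _ (walks-zero (toℕ i) y z i<d)) (sym (zeroˡ _))
          ...   | inj₁ d≤i = trans (*-zeroʳ⇐ _ (below k (rel y z)
                   (ℕₚ.<-≤-trans (ℕₚ.≤∧≢⇒< d≤i (λ d≡i → yz≢i (Finₚ.toℕ-injective d≡i))) (ℕₚ.≤-pred i<k))))
                       (sym (zeroˡ _))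

      module _ (E : Family) (prim : ∀ j → IsPrimitive (E j)) (distinct : ∀ i j → E i ≈ᴹ E j → i ≡ j)
               (complete : ∀ B → IsPrimitive B → ∃ λ j → B ≈ᴹ E j) where
        open Idempotents E prim distinct complete
        open Multiplicities E prim distinct complete
        open Resolution resolution using (adjoint-idem)

        θ β : Fin (suc D) → Carrier
        θ = proj₁ (expand (A∈M one))
        β = proj₁ (expand (A∈M (fromℕ D)))

        A₁-expand : A one ≈ᴹ combination θ E
        A₁-expand = proj₂ (expand (A∈M one))

        A_D-expand : A (fromℕ D) ≈ᴹ combination β E
        A_D-expand = proj₂ (expand (A∈M (fromℕ D)))

        combination-*ᵛ : ∀ c v → combination c E *ᵛ v ≈ᵛ sumᵛ (λ j → c j ∙ᵛ (E j *ᵛ v))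
        combination-*ᵛ c v y = sym (sum-sum-* c (λ j z → E j y z) v)

        powers-expand : ∀ k {B c} → B ≈ᴹ combination c E → powers k B ≈ᴹ combination (λ j → (θ j ^ k) * c j) E
        powers-expand zero    eq y z = trans (eq y z) (sum-cong (λ j → *-congʳ (sym (*-identityˡ _))))
        powers-expand (suc k) {B} {c} eq y z = begin
          (A one *ᴹ powers k B) y z
            ≈⟨ sum-cong (λ w → *-congˡ (trans (powers-expand k eq w z) (sum-cong (λ j → *-comm _ _)))) ⟩
          sum (λ w → A one y w * sum (λ j → E j w z * ((θ j ^ k) * c j)))
            ≈⟨ sum-sum-* (A one y) (λ w j → E j w z) (λ j → (θ j ^ k) * c j) ⟩
          sum (λ j → (A one *ᴹ E j) y z * ((θ j ^ k) * c j))
            ≈⟨ sum-cong (λ j → *-congʳ (trans (*ᴹ-congˡ (E j) A₁-expand y z) (combination-E θ j y z))) ⟩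
          sum (λ j → (θ j * E j y z) * ((θ j ^ k) * c j))
            ≈⟨ sum-cong (λ j → solve 4 (λ t e p c → (t :* e) :* (p :* c) := ((t :* p) :* c) :* e) refl (θ j)
                (E j y z) (θ j ^ k) (c j)) ⟩
          combination (λ j → (θ j ^ suc k) * c j) E y z
            ∎
          where open ≈-Reasoning

        A₀-expand : A zero ≈ᴹ combination (λ _ → 1#) E
        A₀-expand y z = trans (A₀≈ΣE y z) (sum-cong (λ j → sym (*-identityˡ _)))

        walks-pair : ∀ k j → ⟪ walks k , E j ⟫ ≈ (θ j ^ k) * mult j
        walks-pair k j = trans (pair-cong (powers-expand k A₀-expand) (λ _ _ → refl))
          (trans (pair-combination _ j) (*-congʳ (*-identityʳ _)))

        -- If θ_i = θ_j, then m_j E_i - m_i E_j pairs to zero with every power of A₁, hence is zero.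
        -- Pairing it with E_i would then give m_i m_j = 0.
        θ-injective : ∀ i j → θ i ≈ θ j → i ≡ j
        θ-injective i j θᵢ≈θⱼ = decidable-stable (i ≟ j) λ i≢j → mult≉0 j (*-cancelˡ-0 (mult≉0 i) (mult-zero i≢j))
          where
          open ≈-Reasoning
          Q : Mat
          Q = mult j ∙ᴹ E i +ᴹ (-1# * mult i) ∙ᴹ E j
          Q∈M : Q ∈ M
          Q∈M = M-+ (M-∙ _ (E∈M i)) (M-∙ _ (E∈M j))
          pair-Q : ∀ B → ⟪ B , Q ⟫ ≈ mult j * ⟪ B , E i ⟫ + (-1# * mult i) * ⟪ B , E j ⟫
          pair-Q B = begin
            sum (λ y → sum (λ z → B y z * (mult j * E i y z + (-1# * mult i) * E j y z)))
              ≈⟨ sum-cong (λ y → trans (sum-cong (λ z → solve 5 (λ b m e k f → b :* (m :* e :+ k :* f) :=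
                  m :* (b :* e) :+ k :* (b :* f)) refl
                   (B y z) (mult j) (E i y z) (-1# * mult i) (E j y z))) (sum-+ _ _)) ⟩
            sum (λ y → sum (λ z → mult j * (B y z * E i y z)) + sum (λ z → (-1# * mult i) * (B y z * E j y z)))
              ≈⟨ sum-+ _ _ ⟩
            sum (λ y → sum (λ z → mult j * (B y z * E i y z))) + sum
                (λ y → sum (λ z → (-1# * mult i) * (B y z * E j y z)))
              ≈⟨ +-cong (trans (sum-cong (λ y → sym (*-sumˡ _ _))) (sym (*-sumˡ _ _)))
                        (trans (sum-cong (λ y → sym (*-sumˡ _ _))) (sym (*-sumˡ _ _))) ⟩
            mult j * ⟪ B , E i ⟫ + (-1# * mult i) * ⟪ B , E j ⟫
              ∎
          walks-Q : ∀ k → ⟪ walks k , Q ⟫ ≈ 0#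
          walks-Q k = begin
            ⟪ walks k , Q ⟫
              ≈⟨ pair-Q (walks k) ⟩
            mult j * ⟪ walks k , E i ⟫ + (-1# * mult i) * ⟪ walks k , E j ⟫
              ≈⟨ +-cong (*-congˡ (walks-pair k i)) (*-congˡ
                  (trans (walks-pair k j) (*-congʳ (^-congˡ k (sym θᵢ≈θⱼ))))) ⟩
            mult j * ((θ i ^ k) * mult i) + (-1# * mult i) * ((θ i ^ k) * mult j)
              ≈⟨ solve 4 (λ m t l e → m :* (t :* l) :+ (e :* l) :* (t :* m) := m :* (t :* l) :+ e :*
                  (m :* (t :* l))) refl
                   (mult j) (θ i ^ k) (mult i) -1# ⟩
            mult j * ((θ i ^ k) * mult i) + -1# * (mult j * ((θ i ^ k) * mult i))
              ≈⟨ x+-1x≈0 _ ⟩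
            0#
              ∎
          Q≈0 : Q ≈ᴹ 0ᴹ
          Q≈0 y z = trans (proj₂ Q∈M y z) (walks-separate (proj₁ Q∈M)
            (λ k → trans (sum-cong (λ y → sum-cong (λ z → *-congˡ (sym (proj₂ Q∈M y z))))) (walks-Q k)) (rel y z))
          mult-zero : i ≢ j → mult i * mult j ≈ 0#
          mult-zero i≢j = begin
            mult i * mult j
              ≈⟨ *-comm _ _ ⟩
            mult j * mult i
              ≈⟨ +-identityʳ _ ⟨
            mult j * mult i + 0#
              ≈⟨ +-congˡ (*-zeroʳ⇐ _ (pair-orth i j i≢j)) ⟨
            mult j * ⟪ E i , E i ⟫ + (-1# * mult i) * ⟪ E i , E j ⟫
              ≈⟨ pair-Q (E i) ⟨
            ⟪ E i , Q ⟫
              ≈⟨ pair-zero (E i) Q (λ y z → *-zeroʳ⇐ _ (Q≈0 y z)) ⟩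
            0#
              ∎

        far-expand : ∀ k → far k ≈ᴹ combination (λ j → (θ j ^ k) * β j) E
        far-expand k = powers-expand k A_D-expand

        -- The left side is the trace of A₁^k A_D, a matrix whose diagonal vanishes as long as k <
        -- D.
        far-trace : ∀ k → k < D → sum (λ j → (θ j ^ k) * (β j * mult j)) ≈ 0#
        far-trace k k<D = begin
          sum (λ j → (θ j ^ k) * (β j * mult j))
            ≈⟨ sum-cong (λ j → trans (sym (*-assoc _ _ _)) (trans (sym (pair-combination (λ j → (θ j ^ k) * β j) j))
                 (trans (pair-cong (λ y z → sym (far-expand k y z)) (λ _ _ → refl)) (pair-comm (far k) (E j))))) ⟩
          sum (λ j → ⟪ E j , far k ⟫)
            ≈⟨ sum-cong (λ j → sym (*-identityˡ _)) ⟩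
          sum (λ j → 1# * ⟪ E j , far k ⟫)
            ≈⟨ pair-sum (λ _ → 1#) E (far k) ⟨
          ⟪ combination (λ _ → 1#) E , far k ⟫
            ≈⟨ pair-cong (λ y z → sym (A₀-expand y z)) (λ _ _ → refl) ⟩
          ⟪ A zero , far k ⟫
            ≈⟨ pair-zero (A zero) (far k) term ⟩
          0#
            ∎
          where
          open ≈-Reasoning
          term : ∀ y z → A zero y z * far k y z ≈ 0#
          term y z with rel y z ≟ zero
          ... | no _   = zeroˡ _
          ... | yes eq = *-zeroʳ⇐ _ (far-zero k y z (ℕₚ.≤-<-trans
                (ℕₚ.≤-reflexive (≡.trans (≡.cong (k ℕ.+_) (≡.cong toℕ eq)) (ℕₚ.+-identityʳ k))) k<D))

        -- If one eigenvalue of A_D vanished, the D remaining unknowns β_l m_l would satisfy the D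
        -- equations of `far-trace`. All would vanish, so A_D = 0, yet the relation D is nonempty.
        β≉0 : ∀ j → ¬ (β j ≈ 0#)
        β≉0 j βⱼ≈0 = 1≉0 (trans (sym (A-≡ yz≡D)) (trans (A_D-expand y z) (sum-zero (λ l → *-zeroˡ⇐ _ (β≈0 l)))))
          where
          y = proj₁ (nonempty (fromℕ D))
          z = proj₁ (proj₂ (nonempty (fromℕ D)))
          yz≡D : rel y z ≡ fromℕ D
          yz≡D = proj₂ (proj₂ (nonempty (fromℕ D)))
          β≈0 : ∀ l → β l ≈ 0#
          β≈0 l = *-cancelˡ-0 (mult≉0 l) (trans (*-comm _ _)
            (vandermonde-scalar θ θ-injective D (λ l → β l * mult l) far-trace (Subset.⊤ Subset.- j)
              (λ i ≉0 → Subsetₚ.x∈p∧x≢y⇒x∈p-y Subsetₚ.∈⊤ (λ { ≡.refl → ≉0 (*-zeroˡ⇐ _ βⱼ≈0) }))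
              (ℕₚ.≤-pred (ℕₚ.<-≤-trans (Subsetₚ.x∈p⇒∣p-x∣<∣p∣ {x = j} Subsetₚ.∈⊤)
                  (ℕₚ.≤-reflexive (Subsetₚ.∣⊤∣≡n (suc D))))) l))

        metric-companion : ∀ x → Companion E (E* x)
        metric-companion x = record
          { A       = A one
          ; θ       = θ
          ; θ-inj   = θ-injective
          ; A-spec  = λ v → ≈ᵛ-trans (*ᵛ-congˡ v A₁-expand) (combination-*ᵛ θ v)
          ; tridiag = tridiag
          ; β       = β
          ; β≉0     = β≉0
          ; vanish  = vanish
          }
          where
          tridiag : ∀ i k → suc (toℕ k) < toℕ i ⊎ suc (toℕ i) < toℕ k → ∀ v → E* x i *ᵛ (A one *ᵛ (E* x k *ᵛ v)) ≈ᵛ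
              0ᵛ
          tridiag i k apart v y = outer (rel x y ≟ i)
            where
            inner : rel x y ≡ i → ∀ z → Dec (rel x z ≡ k) → Dec (rel y z ≡ one) → A one y z * (E* x k *ᵛ v) z ≈ 0#
            inner xy≡i z (no ≢k)   _         = *-zeroʳ⇐ _ (E*-outside v ≢k)
            inner xy≡i z (yes _)   (no ≢1)   = *-zeroˡ⇐ _ (A-≢ ≢1)
            inner xy≡i z (yes xz≡k) (yes yz≡1) = contradiction apart
              [ ℕₚ.≤⇒≯ (≡.subst₂ (λ a b → toℕ a ≤ suc (toℕ b)) (≡.trans (symmetric y x) xy≡i)
                  (≡.trans (symmetric z x) xz≡k)
                  (neighbour-≤ z x y (≡.trans (symmetric z y) yz≡1)))
              , ℕₚ.≤⇒≯ (≡.subst₂ (λ a b → toℕ a ≤ suc (toℕ b)) (≡.trans (symmetric z x) xz≡k)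
                  (≡.trans (symmetric y x) xy≡i)
                  (neighbour-≤ y x z yz≡1)) ]′
            outer : Dec (rel x y ≡ i) → (E* x i *ᵛ (A one *ᵛ (E* x k *ᵛ v))) y ≈ 0#
            outer (no ≢i)   = E*-outside _ ≢i
            outer (yes xy≡i) = trans (E*-inside _ xy≡i) (sum-zero
                (λ z → inner xy≡i z (rel x z ≟ k) (rel y z ≟ one)))

          -- The sum is ⟨A₁^k A_D u , u⟩, and u lives on the sphere of radius r around x, where any
          -- two points are at distance at most 2r.
          vanish : ∀ r u k → E* x r *ᵛ u ≈ᵛ u → k ℕ.+ (toℕ r ℕ.+ toℕ r) < D →
                   sum (λ j → (θ j ^ k) * (β j * ⟨ E j *ᵛ u , E j *ᵛ u ⟩)) ≈ 0#
          vanish r u k Eu≈u k+2r<D = begin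
            sum (λ j → (θ j ^ k) * (β j * ⟨ E j *ᵛ u , E j *ᵛ u ⟩))
              ≈⟨ sum-cong (λ j → trans (sym (*-assoc _ _ _)) (trans (*-congˡ (sym (adjoint-idem j u u)))
                  (sym (⟨⟩-∙ˡ _ _ u)))) ⟩
            sum (λ j → ⟨ ((θ j ^ k) * β j) ∙ᵛ (E j *ᵛ u) , u ⟩)
              ≈⟨ ⟨⟩-sumˡ _ u ⟨
            ⟨ sumᵛ (λ j → ((θ j ^ k) * β j) ∙ᵛ (E j *ᵛ u)) , u ⟩
              ≈⟨ ⟨⟩-cong (λ y → sym (trans (*ᵛ-congˡ u (far-expand k) y) (combination-*ᵛ _ u y))) ≈ᵛ-refl ⟩
            ⟨ far k *ᵛ u , u ⟩
              ≈⟨ sum-zero (λ y → outer y (rel x y ≟ r)) ⟩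
            0#
              ∎
            where
            open ≈-Reasoning
            u-outside : ∀ {y} → rel x y ≢ r → u y ≈ 0#
            u-outside {y} ≢r = trans (sym (Eu≈u y)) (E*-outside u ≢r)
            close : ∀ y z → rel x y ≡ r → rel x z ≡ r → far k y z ≈ 0#
            close y z xy≡r xz≡r = far-zero k y z (ℕₚ.≤-<-trans (ℕₚ.+-monoʳ-≤ k (ℕₚ.≤-trans (triangle y x z)
              (ℕₚ.≤-reflexive (≡.cong₂ ℕ._+_ (≡.trans (d-sym y x) (≡.cong toℕ xy≡r)) (≡.cong toℕ xz≡r))))) k+2r<D)
            inner : ∀ y z → rel x y ≡ r → Dec (rel x z ≡ r) → far k y z * u z ≈ 0#
            inner y z xy≡r (no ≢r)   = *-zeroʳ⇐ _ (u-outside ≢r)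
            inner y z xy≡r (yes xz≡r) = *-zeroˡ⇐ _ (close y z xy≡r xz≡r)
            outer : ∀ y → Dec (rel x y ≡ r) → (far k *ᵛ u) y * conj (u y) ≈ 0#
            outer y (no ≢r)    = *-zeroʳ⇐ _ (conj-≈0 (u-outside ≢r))
            outer y (yes xy≡r) = *-zeroˡ⇐ _ (sum-zero (λ z → inner y z xy≡r (rel x z ≟ r)))

-- The companion supplied by the cometric property.

module Cometricity (K : StarField) (em : ExcludedMiddle 0ℓ) {n D : ℕ} (𝓢 : SymmetricAssociationScheme n D) where
  open Sums K
  open Classical K em
  open Linear K n
  open Modules K em n D
  open SymmetricAssociationScheme 𝓢
  open Scheme K em 𝓢
  open Pairing K em 𝓢

  module _ (E : Family) (prim : ∀ j → IsPrimitive (E j)) (distinct : ∀ i j → E i ≈ᴹ E j → i ≡ j)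
           (complete : ∀ B → IsPrimitive B → ∃ λ j → B ≈ᴹ E j)
           (one : Fin (suc D)) (one≡1 : toℕ one ≡ 1)
           (cometric : ∀ j → ∃ λ (c : Fin (suc (toℕ j)) → Carrier) → ¬ (c (fromℕ (toℕ j)) ≈ 0#) ×
             (∀ y z → E j y z ≈ sum (λ k → c k * (E one y z ^ toℕ k)))) where
    open Idempotents E prim distinct complete
    open Multiplicities E prim distinct complete
    open Resolution resolution using (adjoint-idem)

    power : ℕ → Mat
    power k y z = E one y z ^ k

    infixr 7 _∘ᴹ_
    _∘ᴹ_ : Mat → Mat → Mat
    (B ∘ᴹ C) y z = B y z * C y z

    power∈M : ∀ k → power k ∈ M
    power∈M zero    = (λ _ → 1#) , λ _ _ → refl
    power∈M (suc k) = M-∘ (E∈M one) (power∈M k)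

    polynomial : ∀ j B C → ⟪ B ∘ᴹ E j , C ⟫ ≈ sum (λ k → proj₁ (cometric j) k * ⟪ B ∘ᴹ power (toℕ k) , C ⟫)
    polynomial j B C = trans
      (pair-cong (λ y z → trans (*-congˡ (proj₂ (proj₂ (cometric j)) y z)) (trans (*-sumˡ _ _)
        (sum-cong (λ k → solve 3 (λ b c p → b :* (c :* p) := c :* (b :* p)) refl (B y z) (proj₁ (cometric j) k)
            (power (toℕ k) y z)))))
        (λ _ _ → refl))
      (pair-sum (proj₁ (cometric j)) (λ k → B ∘ᴹ power (toℕ k)) C)

    unit : Mat
    unit _ _ = 1#

    -- E_k has degree exactly k in E₁ and is orthogonal to E_l. Its lower terms pair to zero by
    -- induction, so its leading term does too.
    power-orth : ∀ k l → k < toℕ l → ⟪ power k , E l ⟫ ≈ 0#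
    power-orth k l k<l = below (suc k) k ℕₚ.≤-refl k<l
      where
      below : ∀ b k → k < b → k < toℕ l → ⟪ power k , E l ⟫ ≈ 0#
      below (suc b) k k<b k<l = leading (fromℕ< (ℕₚ.<-trans k<l (Finₚ.toℕ<n l))) (Finₚ.toℕ-fromℕ< _)
        where
        leading : (κ : Fin (suc D)) → toℕ κ ≡ k → ⟪ power k , E l ⟫ ≈ 0#
        leading κ ≡.refl = trans (pair-cong (λ y z → reflexive
            (≡.cong (λ i → power i y z) (≡.sym (Finₚ.toℕ-fromℕ (toℕ κ))))) (λ _ _ → refl))
          (*-cancelˡ-0 (proj₁ (proj₂ (cometric κ))) (begin
            c top * ⟪ power (toℕ top) , E l ⟫
              ≈⟨ *-congˡ (pair-cong (λ y z → sym (*-identityˡ _)) (λ _ _ → refl)) ⟩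
            c top * ⟪ unit ∘ᴹ power (toℕ top) , E l ⟫
              ≈⟨ sum-single top (λ i i≢top → *-zeroʳ⇐ _ (trans (pair-cong (λ y z → *-identityˡ _) (λ _ _ → refl))
                  (lower i i≢top))) ⟨
            sum (λ i → c i * ⟪ unit ∘ᴹ power (toℕ i) , E l ⟫)
              ≈⟨ polynomial κ unit (E l) ⟨
            ⟪ unit ∘ᴹ E κ , E l ⟫
              ≈⟨ pair-cong (λ y z → *-identityˡ _) (λ _ _ → refl) ⟩
            ⟪ E κ , E l ⟫
              ≈⟨ pair-orth κ l (λ κ≡l → ℕₚ.<-irrefl (≡.cong toℕ κ≡l) k<l) ⟩
            0#
              ∎))
          where
          open ≈-Reasoning
          c : Fin (suc (toℕ κ)) → Carrier
          c = proj₁ (cometric κ)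
          top : Fin (suc (toℕ κ))
          top = fromℕ (toℕ κ)
          lower : ∀ i → i ≢ top → ⟪ power (toℕ i) , E l ⟫ ≈ 0#
          lower i i≢top = below b (toℕ i) (ℕₚ.<-≤-trans i<κ (ℕₚ.≤-pred k<b)) (ℕₚ.<-trans i<κ k<l)
            where
            i<κ : toℕ i < toℕ κ
            i<κ = ℕₚ.≤∧≢⇒< (ℕₚ.≤-pred (Finₚ.toℕ<n i)) (λ eq →
                i≢top (Finₚ.toℕ-injective (≡.trans eq (≡.sym (Finₚ.toℕ-fromℕ _)))))

    -- Entrywise, the left factor is a polynomial of degree k + a in E₁.
    power-E-orth : ∀ k a l → k ℕ.+ toℕ a < toℕ l → ⟪ power k ∘ᴹ E a , E l ⟫ ≈ 0#
    power-E-orth k a l k+a<l = trans (polynomial a (power k) (E l)) (sum-zero (λ i → *-zeroʳ⇐ _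
      (trans (pair-cong (λ y z → sym (^-homo-* (E one y z) k (toℕ i))) (λ _ _ → refl))
        (power-orth (k ℕ.+ toℕ i) l (ℕₚ.≤-<-trans (ℕₚ.+-monoʳ-≤ k (ℕₚ.≤-pred (Finₚ.toℕ<n i))) k+a<l)))))

    -- The vanishing of the Krein parameter q^l_{ab} for a + b < l.
    krein-zero : ∀ a b l → toℕ a ℕ.+ toℕ b < toℕ l → ⟪ E a ∘ᴹ E b , E l ⟫ ≈ 0#
    krein-zero a b l a+b<l = trans (pair-cong (λ y z → *-comm _ _) (λ _ _ → refl))
      (trans (polynomial a (E b) (E l)) (sum-zero (λ i → *-zeroʳ⇐ _
        (trans (pair-cong (λ y z → *-comm _ _) (λ _ _ → refl))
          (power-E-orth (toℕ i) b l (ℕₚ.≤-<-trans (ℕₚ.+-monoˡ-≤ (toℕ b) (ℕₚ.≤-pred (Finₚ.toℕ<n i))) a+b<l))))))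

    column : ∀ b y y′ → sum (λ z → E b z y′ * E b z y) ≈ E b y y′
    column b y y′ = trans (sum-cong (λ z → trans (*-comm _ _) (*-congʳ (E-sym b z y)))) (E-idem b y y′)

    -- Cameron–Goethals–Seidel: the squared norm of the triple products is the sum of E a ∘ E b ∘ E l.
    triple-zero : ∀ a b l → ⟪ E a ∘ᴹ E b , E l ⟫ ≈ 0# →
                  ∀ x z w → sum (λ y → E a x y * (E b z y * E l w y)) ≈ 0#
    triple-zero a b l total x z w = ⟨⟩-definite
      (sum-cancel (λ w → norm-nonNeg (E a *ᵛ product z w))
        (sum-cancel (λ z → nonNeg-sum (λ w → norm-nonNeg (E a *ᵛ product z w))) norms z) w) x
      where
      open ≈-Reasoning
      norm-nonNeg : ∀ u → NonNegative ⟨ u , u ⟩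
      norm-nonNeg u = nonNeg-sum (λ y → nonNeg-norm (u y))
      product : Fin n → Fin n → V
      product z w y = E b z y * E l w y
      expansion : ∀ z w → ⟨ E a *ᵛ product z w , E a *ᵛ product z w ⟩
                ≈ sum (λ y → sum (λ y′ → E a y y′ * ((E b z y′ * E b z y) * (E l w y′ * E l w y))))
      expansion z w = trans (sym (adjoint-idem a _ _)) (sum-cong (λ y → trans (*-sumʳ _ _) (sum-cong (λ y′ → trans
        (*-congˡ (trans (conj-* _ _) (*-cong (E-real b z y) (E-real l w y))))
        (solve 5 (λ a b c d e → (a :* (b :* c)) :* (d :* e) := a :* ((b :* d) :* (c :* e))) refl
          (E a y y′) (E b z y′) (E l w y′) (E b z y) (E l w y))))))
      norms : sum (λ z → sum (λ w → ⟨ E a *ᵛ product z w , E a *ᵛ product z w ⟩)) ≈ 0#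
      norms = begin
        sum (λ z → sum (λ w → ⟨ E a *ᵛ product z w , E a *ᵛ product z w ⟩))
          ≈⟨ sum-cong (λ z → trans (sum-cong (λ w → expansion z w))
              (trans (sum-comm _) (sum-cong (λ y → sum-comm _)))) ⟩
        sum (λ z → sum (λ y → sum (λ y′ → sum (λ w → E a y y′ * ((E b z y′ * E b z y) * (E l w y′ * E l w y))))))
          ≈⟨ trans (sum-comm _) (sum-cong (λ y → sum-comm _)) ⟩
        sum (λ y → sum (λ y′ → sum (λ z → sum (λ w → E a y y′ * ((E b z y′ * E b z y) * (E l w y′ * E l w y))))))
          ≈⟨ sum-cong (λ y → sum-cong (λ y′ → collect y y′)) ⟩
        ⟪ E a ∘ᴹ E b , E l ⟫
          ≈⟨ total ⟩
        0#
          ∎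
        where
        collect : ∀ y y′ → sum (λ z → sum (λ w → E a y y′ * ((E b z y′ * E b z y) * (E l w y′ * E l w y))))
                         ≈ (E a y y′ * E b y y′) * E l y y′
        collect y y′ = begin
          sum (λ z → sum (λ w → E a y y′ * ((E b z y′ * E b z y) * (E l w y′ * E l w y))))
            ≈⟨ sum-cong (λ z → trans (sum-cong (λ w → sym (*-assoc _ _ _)))
                (trans (sym (*-sumˡ _ _)) (*-congˡ (column l y y′)))) ⟩
          sum (λ z → (E a y y′ * (E b z y′ * E b z y)) * E l y y′)
            ≈⟨ *-sumʳ _ _ ⟨
          sum (λ z → E a y y′ * (E b z y′ * E b z y)) * E l y y′
            ≈⟨ *-congʳ (trans (sym (*-sumˡ _ _)) (*-congˡ (column b y y′))) ⟩
          (E a y y′ * E b y y′) * E l y y′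
            ∎

    -- The entry of E_j on relation i, that is the dual eigenvalue divided by |X|.
    value : Fin (suc D) → Fin (suc D) → Carrier
    value j i = proj₁ (E∈M j) i

    E-value : ∀ j y z → E j y z ≈ value j (rel y z)
    E-value j = proj₂ (E∈M j)

    -- Every E_l is an entrywise polynomial in E₁. If E₁ took the same value on two relations, so
    -- would all of M, but A_i tells them apart.
    value-injective : ∀ i j → value one i ≈ value one j → i ≡ j
    value-injective i j eq = decidable-stable (i ≟ j) λ i≢j →
      1≉0 (trans (sym (A-≡ yz≡i)) (trans (agree (A∈M i)) (A-≢ (λ eq′ → i≢j (≡.trans (≡.sym eq′) y′z′≡j)))))
      where
      y = proj₁ (nonempty i)
      z = proj₁ (proj₂ (nonempty i))
      yz≡i : rel y z ≡ i
      yz≡i = proj₂ (proj₂ (nonempty i))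
      y′ = proj₁ (nonempty j)
      z′ = proj₁ (proj₂ (nonempty j))
      y′z′≡j : rel y′ z′ ≡ j
      y′z′≡j = proj₂ (proj₂ (nonempty j))
      one-agree : E one y z ≈ E one y′ z′
      one-agree = trans (E-value one y z) (trans (reflexive (≡.cong (value one) yz≡i))
        (trans eq (trans (reflexive (≡.cong (value one) (≡.sym y′z′≡j))) (sym (E-value one y′ z′)))))
      E-agree : ∀ l → E l y z ≈ E l y′ z′
      E-agree l = trans (proj₂ (proj₂ (cometric l)) y z) (trans
        (sum-cong (λ k → *-congˡ (^-congˡ (toℕ k) one-agree))) (sym (proj₂ (proj₂ (cometric l)) y′ z′)))
      agree : ∀ {B} → B ∈ M → B y z ≈ B y′ z′
      agree {B} B∈M = trans (proj₂ (expand B∈M) y z)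
        (trans (sum-cong (λ l → *-congˡ (E-agree l))) (sym (proj₂ (expand B∈M) y′ z′)))

    power-value : ∀ k y z → power k y z ≈ value one (rel y z) ^ k
    power-value k y z = ^-congˡ k (E-value one y z)

    -- The dual of the invertibility of A_D: E_D is orthogonal to the D powers of E₁ below degree D,
    -- so one zero value would leave D unknowns, weighted by the sizes of the relations, and force
    -- E_D = 0.
    top-value≉0 : ∀ i → ¬ (value (fromℕ D) i ≈ 0#)
    top-value≉0 i ≈0 = E≉0 (fromℕ D) (λ y z → trans (E-value (fromℕ D) y z) (all-zero (rel y z)))
      where
      moments : ∀ k → k < D → sum (λ j → (value one j ^ k) * (value (fromℕ D) j * size j)) ≈ 0#
      moments k k<D = trans (sum-cong (λ j → sym (*-assoc _ _ _)))
        (trans (sym (sum-rel (λ j → (value one j ^ k) * value (fromℕ D) j)))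
          (trans (pair-cong (λ y z → sym (power-value k y z)) (λ y z → sym (E-value (fromℕ D) y z)))
            (power-orth k (fromℕ D) (ℕₚ.<-≤-trans k<D (ℕₚ.≤-reflexive (≡.sym (Finₚ.toℕ-fromℕ D)))))))
      all-zero : ∀ j → value (fromℕ D) j ≈ 0#
      all-zero j = *-cancelˡ-0 (size≉0 j) (trans (*-comm _ _)
        (vandermonde-scalar (value one) value-injective D (λ j → value (fromℕ D) j * size j) moments
            (Subset.⊤ Subset.- i)
          (λ l ≉0 → Subsetₚ.x∈p∧x≢y⇒x∈p-y Subsetₚ.∈⊤ (λ { ≡.refl → ≉0 (*-zeroˡ⇐ _ ≈0) }))
          (ℕₚ.≤-pred (ℕₚ.<-≤-trans (Subsetₚ.x∈p⇒∣p-x∣<∣p∣ {x = i} Subsetₚ.∈⊤)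
              (ℕₚ.≤-reflexive (Subsetₚ.∣⊤∣≡n (suc D))))) j))

    cometric-companion : ∀ x → Companion (E* x) E
    cometric-companion x = record
      -- This is A*₁ without the factor |X|, which makes the eigenvalues the plain entries of E₁.
      { A       = diag (E one x)
      ; θ       = value one
      ; θ-inj   = value-injective
      ; A-spec  = λ v y → trans (diag-*ᵛ (E one x) v y)
                    (trans (*-congʳ (E-value one x y)) (sym (E*-combination x (value one) v y)))
      ; tridiag = tridiag
      ; β       = value (fromℕ D)
      ; β≉0     = top-value≉0
      ; vanish  = vanish
      }
      where
      -- The entries of E_i A*₁ E_k are triple products, which vanish with the Krein parameter of 1
      -- and the smaller index at the larger one.
      tridiag : ∀ i k → suc (toℕ k) < toℕ i ⊎ suc (toℕ i) < toℕ k → ∀ v → E i *ᵛ (diag (E one x) *ᵛ (E k *ᵛ v)) ≈ᵛ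
          0ᵛ
      tridiag i k apart v z = begin
        sum (λ y → E i z y * (diag (E one x) *ᵛ (E k *ᵛ v)) y)
          ≈⟨ sum-cong (λ y → trans (*-congˡ (diag-*ᵛ (E one x) _ y)) (sym (*-assoc _ _ _))) ⟩
        sum (λ y → (E i z y * E one x y) * sum (λ w → E k y w * v w))
          ≈⟨ sum-sum-* (λ y → E i z y * E one x y) (E k) v ⟩
        sum (λ w → sum (λ y → (E i z y * E one x y) * E k y w) * v w)
          ≈⟨ sum-zero (λ w → *-zeroˡ⇐ _ (triple w apart)) ⟩
        0#
          ∎
        where
        open ≈-Reasoning
        triple : ∀ w → suc (toℕ k) < toℕ i ⊎ suc (toℕ i) < toℕ k → sum (λ y → (E i z y * E one x y) * E k y w) ≈ 0#
        triple w (inj₁ k+1<i) = trans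
          (sum-cong (λ y → trans (*-congˡ (E-sym k y w))
            (solve 3 (λ a b c → (a :* b) :* c := b :* (c :* a)) refl (E i z y) (E one x y) (E k w y))))
          (triple-zero one k i (krein-zero one k i (≡.subst (λ o → o ℕ.+ toℕ k < toℕ i) (≡.sym one≡1) k+1<i)) x w z)
        triple w (inj₂ i+1<k) = trans
          (sum-cong (λ y → trans (*-congˡ (E-sym k y w))
            (solve 3 (λ a b c → (a :* b) :* c := b :* (a :* c)) refl (E i z y) (E one x y) (E k w y))))
          (triple-zero one i k (krein-zero one i k (≡.subst (λ o → o ℕ.+ toℕ i < toℕ k) (≡.sym one≡1) i+1<k)) x z w)

      -- The sum pairs row x of E₁^k ∘ E_D with the function |v|². The former involves only E_l with
      -- k + l ≥ D; the latter, for v in E_r V, is orthogonal to row x of E_l once l > 2r.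
      vanish : ∀ r v k → E r *ᵛ v ≈ᵛ v → k ℕ.+ (toℕ r ℕ.+ toℕ r) < D →
               sum (λ i → (value one i ^ k) * (value (fromℕ D) i * ⟨ E* x i *ᵛ v , E* x i *ᵛ v ⟩)) ≈ 0#
      vanish r v k Ev≈v k+2r<D = begin
        sum (λ i → (value one i ^ k) * (value (fromℕ D) i * ⟨ E* x i *ᵛ v , E* x i *ᵛ v ⟩))
          ≈⟨ sum-cong (λ i → trans (sym (*-assoc _ _ _))
              (trans (*-congˡ (sym (Resolution.adjoint-idem (E*-resolution x) i v v))) (sym (⟨⟩-∙ˡ _ _ v)))) ⟩
        sum (λ i → ⟨ ((value one i ^ k) * value (fromℕ D) i) ∙ᵛ (E* x i *ᵛ v) , v ⟩)
          ≈⟨ ⟨⟩-sumˡ _ v ⟨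
        ⟨ sumᵛ (λ i → ((value one i ^ k) * value (fromℕ D) i) ∙ᵛ (E* x i *ᵛ v)) , v ⟩
          ≈⟨ ⟨⟩-cong (E*-combination x (λ i → (value one i ^ k) * value (fromℕ D) i) v) ≈ᵛ-refl ⟩
        sum (λ y → (((value one (rel x y) ^ k) * value (fromℕ D) (rel x y)) * v y) * conj (v y))
          ≈⟨ sum-cong (λ y → trans (*-assoc _ _ _) (*-congʳ
              (trans (*-cong (sym (power-value k x y)) (sym (E-value (fromℕ D) x y))) (G-expand x y)))) ⟩
        sum (λ y → combination g E x y * (v y * conj (v y)))
          ≈⟨ sum-sum-* g (λ l → E l x) (λ y → v y * conj (v y)) ⟨
        sum (λ l → g l * sum (λ y → E l x y * (v y * conj (v y))))
          ≈⟨ sum-zero (λ l → term l (ℕₚ.<-≤-connex (k ℕ.+ toℕ l) D)) ⟩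
        0#
          ∎
        where
        open ≈-Reasoning
        G∈M : power k ∘ᴹ E (fromℕ D) ∈ M
        G∈M = M-∘ (power∈M k) (E∈M (fromℕ D))
        g : Fin (suc D) → Carrier
        g = proj₁ (expand G∈M)
        G-expand : power k ∘ᴹ E (fromℕ D) ≈ᴹ combination g E
        G-expand = proj₂ (expand G∈M)
        g-zero : ∀ l → k ℕ.+ toℕ l < D → g l ≈ 0#
        g-zero l k+l<D = coefficient-zero G-expand l (trans
          (sum-cong (λ y → sum-cong (λ z → solve 3 (λ p d e → (p :* d) :* e := (p :* e) :* d) refl (power k y z)
              (E (fromℕ D) y z) (E l y z))))
          (power-E-orth k l (fromℕ D) (ℕₚ.<-≤-trans k+l<D (ℕₚ.≤-reflexive (≡.sym (Finₚ.toℕ-fromℕ D))))))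
        -- E_r is real, so v and its conjugate both lie in E_r V, and the Krein parameter of r and r
        -- at l controls their product.
        quadratic : ∀ l → toℕ r ℕ.+ toℕ r < toℕ l → sum (λ y → E l x y * (v y * conj (v y))) ≈ 0#
        quadratic l 2r<l = begin
          sum (λ y → E l x y * (v y * conj (v y)))
            ≈⟨ sum-cong (λ y → trans (solve 3 (λ e a b → e :* (a :* b) := (e :* b) :* a) refl (E l x y) (v y)
                (conj (v y))) (*-congˡ (sym (Ev≈v y)))) ⟩
          sum (λ y → (E l x y * conj (v y)) * sum (λ z → E r y z * v z))
            ≈⟨ sum-sum-* (λ y → E l x y * conj (v y)) (E r) v ⟩
          sum (λ z → sum (λ y → (E l x y * conj (v y)) * E r y z) * v z)
            ≈⟨ sum-zero (λ z → *-zeroˡ⇐ _ (inner z)) ⟩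
          0#
            ∎
          where
          conj-v : ∀ y → conj (v y) ≈ sum (λ w → E r y w * conj (v w))
          conj-v y = trans (conj-cong (sym (Ev≈v y))) (trans (conj-sum _)
              (sum-cong (λ w → trans (conj-* _ _) (*-congʳ (E-real r y w)))))
          inner : ∀ z → sum (λ y → (E l x y * conj (v y)) * E r y z) ≈ 0#
          inner z = begin
            sum (λ y → (E l x y * conj (v y)) * E r y z)
              ≈⟨ sum-cong (λ y → trans (solve 3 (λ e a b → (e :* a) :* b := (e :* b) :* a) refl (E l x y)
                  (conj (v y)) (E r y z)) (*-congˡ (conj-v y))) ⟩
            sum (λ y → (E l x y * E r y z) * sum (λ w → E r y w * conj (v w)))
              ≈⟨ sum-sum-* (λ y → E l x y * E r y z) (E r) (λ w → conj (v w)) ⟩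
            sum (λ w → sum (λ y → (E l x y * E r y z) * E r y w) * conj (v w))
              ≈⟨ sum-zero (λ w → *-zeroˡ⇐ _ (trans
                   (sum-cong (λ y → trans (*-cong (*-congˡ (E-sym r y z)) (E-sym r y w))
                     (solve 3 (λ e a b → (e :* a) :* b := a :* (b :* e)) refl (E l x y) (E r z y) (E r w y))))
                   (triple-zero r r l (krein-zero r r l 2r<l) z w x))) ⟩
            0#
              ∎
        term : ∀ l → k ℕ.+ toℕ l < D ⊎ D ≤ k ℕ.+ toℕ l → g l * sum (λ y → E l x y * (v y * conj (v y))) ≈ 0#
        term l (inj₁ k+l<D) = *-zeroˡ⇐ _ (g-zero l k+l<D)
        term l (inj₂ D≤k+l) = *-zeroʳ⇐ _ (quadratic l (ℕₚ.+-cancelˡ-< k _ _ (ℕₚ.<-≤-trans k+2r<D D≤k+l)))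

-- The complex numbers as a field with conjugation.

module ComplexField (ℝ : CompleteOrderedField) (em : ExcludedMiddle 0ℓ) where
  private module R = CompleteOrderedField ℝ

  realRing : CommutativeRing 0ℓ 0ℓ
  realRing = record { isCommutativeRing = R.isCommutativeRing }

  open CommutativeRing realRing
    using ( Carrier; _≈_; _+_; _*_; -_; 0#; 1#; refl; sym; trans; commutativeSemiring; +-abelianGroup
          ; +-cong; +-congˡ; +-congʳ; +-identityʳ; +-comm; *-cong; *-congˡ; *-congʳ; *-identityˡ; *-identityʳ
          ; zeroˡ; -‿cong; -‿inverseˡ )
  open Algebra.Properties.Ring (CommutativeRing.ring realRing) using (-1*x≈-x; -‿involutive; -0#≈0#; -‿distribʳ-*;
      -‿distribˡ-*)
  open Algebra.Solver.Ring.NaturalCoefficients.Default commutativeSemiring using (solve; _:=_; _:+_; _:*_)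
  open R using () renaming (_≤_ to _≤ᴿ_)
  private
    module ≤ = IsTotalOrder R.isTotalOrder
    module C = Complex ℝ

  ≤-resp : ∀ {a b} → a ≈ b → 0# ≤ᴿ a → 0# ≤ᴿ b
  ≤-resp a≈b 0≤a = ≤.trans 0≤a (≤.reflexive a≈b)

  +-nonneg : ∀ {a b} → 0# ≤ᴿ a → 0# ≤ᴿ b → 0# ≤ᴿ a + b
  +-nonneg {a} 0≤a 0≤b = ≤.trans (≤-resp (sym (+-identityʳ a)) 0≤a) (R.+-monoʳ-≤ a 0≤b)

  +-cancel : ∀ {a b} → 0# ≤ᴿ a → 0# ≤ᴿ b → a + b ≈ 0# → a ≈ 0#
  +-cancel {a} 0≤a 0≤b a+b≈0 = ≤.antisym
    (≤.trans (≤.reflexive (sym (+-identityʳ a))) (≤.trans (R.+-monoʳ-≤ a 0≤b) (≤.reflexive a+b≈0))) 0≤a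

  -- It stands for -1 in the polynomial identities below, all of which hold with an arbitrary
  -- element in its place.
  e : Carrier
  e = - 1#

  -≈e* : ∀ x → - x ≈ e * x
  -≈e* x = sym (-1*x≈-x x)

  -*-≈ : ∀ x y → - (x * - y) ≈ x * y
  -*-≈ x y = trans (-‿cong (sym (-‿distribʳ-* x y))) (-‿involutive _)

  square-nonneg : ∀ x → 0# ≤ᴿ x * x
  square-nonneg x = sign (≤.total 0# x)
    where
    sign : 0# ≤ᴿ x ⊎ x ≤ᴿ 0# → 0# ≤ᴿ x * x
    sign (inj₁ 0≤x) = R.*-nonneg 0≤x 0≤x
    sign (inj₂ x≤0) = ≤-resp (trans (sym (-‿distribˡ-* x (- x))) (-*-≈ x x)) (R.*-nonneg 0≤-x 0≤-x)
      where
      0≤-x : 0# ≤ᴿ - x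
      0≤-x = ≤.trans (≤.reflexive (sym (-‿inverseˡ x))) (≤.trans (R.+-monoʳ-≤ (- x) x≤0)
          (≤.reflexive (+-identityʳ _)))

  square-zero : ∀ {x} → x * x ≈ 0# → x ≈ 0#
  square-zero {x} x²≈0 = decidable-stable em λ x≉0 → cancel x≉0 (R.inverse x x≉0)
    where
    cancel : ¬ (x ≈ 0#) → (∃ λ y → x * y ≈ 1#) → ⊥
    cancel x≉0 (y , xy≈1) = x≉0 (trans (sym (*-identityʳ x)) (trans (*-congˡ (sym xy≈1))
      (trans (solve 2 (λ x y → x :* (x :* y) := (x :* x) :* y) refl x y) (trans (*-congʳ x²≈0) (zeroˡ y)))))

  squares-zero : ∀ {a b} → a * a + b * b ≈ 0# → a ≈ 0# × b ≈ 0#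
  squares-zero {a} {b} eq =
    square-zero (+-cancel (square-nonneg a) (square-nonneg b) eq) ,
    square-zero (+-cancel (square-nonneg b) (square-nonneg a) (trans (+-comm _ _) eq))

  private
    *-congᶜ : ∀ {x y u v} → x C.≈ y → u C.≈ v → x C.* u C.≈ y C.* v
    *-congᶜ (a , b) (c , d) = +-cong (*-cong a c) (-‿cong (*-cong b d)) , +-cong (*-cong a d) (*-cong b c)

    *-commᶜ : ∀ x y → x C.* y C.≈ y C.* x
    *-commᶜ (a , b) (c , d) =
      +-cong (CommutativeRing.*-comm realRing a c) (-‿cong (CommutativeRing.*-comm realRing b d)) ,
      solve 4 (λ a b c d → a :* d :+ b :* c := c :* b :+ d :* a) refl a b c d

    *-assocᶜ : ∀ x y z → (x C.* y) C.* z C.≈ x C.* (y C.* z)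
    *-assocᶜ (a , b) (c , d) (f , g) =
      trans (+-cong (*-congʳ (+-congˡ (-≈e* _))) (-≈e* _))
        (trans (solve 7 (λ a b c d f g e → (a :* c :+ e :* (b :* d)) :* f :+ e :* ((a :* d :+ b :* c) :* g)
            := a :* (c :* f :+ e :* (d :* g)) :+ e :* (b :* (c :* g :+ d :* f))) refl a b c d f g e)
          (sym (+-cong (*-congˡ (+-congˡ (-≈e* _))) (-≈e* _)))) ,
      trans (+-congʳ (*-congʳ (+-congˡ (-≈e* _))))
        (trans (solve 7 (λ a b c d f g e → (a :* c :+ e :* (b :* d)) :* g :+ (a :* d :+ b :* c) :* f
            := a :* (c :* g :+ d :* f) :+ b :* (c :* f :+ e :* (d :* g))) refl a b c d f g e)
          (sym (+-congˡ (*-congˡ (+-congˡ (-≈e* _))))))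

    *-identityˡᶜ : ∀ x → C.1# C.* x C.≈ x
    *-identityˡᶜ (a , b) =
      trans (+-cong (*-identityˡ a) (trans (-‿cong (zeroˡ b)) -0#≈0#)) (+-identityʳ a) ,
      trans (+-cong (*-identityˡ b) (zeroˡ a)) (+-identityʳ b)

    distribˡᶜ : ∀ x y z → x C.* (y C.+ z) C.≈ x C.* y C.+ x C.* z
    distribˡᶜ (a , b) (c , d) (f , g) =
      trans (+-congˡ (-≈e* _))
        (trans (solve 7 (λ a b c d f g e → a :* (c :+ f) :+ e :* (b :* (d :+ g))
            := (a :* c :+ e :* (b :* d)) :+ (a :* f :+ e :* (b :* g))) refl a b c d f g e)
          (sym (+-cong (+-congˡ (-≈e* _)) (+-congˡ (-≈e* _))))) ,
      solve 6 (λ a b c d f g → a :* (d :+ g) :+ b :* (c :+ f) := (a :* d :+ b :* c) :+ (a :* g :+ b :* f)) refl a b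
          c d f g

    +-isAbelianGroupᶜ : IsAbelianGroup C._≈_ C._+_ C.0# C.-_
    +-isAbelianGroupᶜ = AbelianGroup.isAbelianGroup (DirectProduct.abelianGroup +-abelianGroup +-abelianGroup)

    module +ᶜ = IsAbelianGroup +-isAbelianGroupᶜ

  complexRing : CommutativeRing 0ℓ 0ℓ
  complexRing = record
    { Carrier = C.ℂ ; _≈_ = C._≈_ ; _+_ = C._+_ ; _*_ = C._*_ ; -_ = C.-_ ; 0# = C.0# ; 1# = C.1#
    ; isCommutativeRing = record
      { isRing = record
        { +-isAbelianGroup = +-isAbelianGroupᶜ
        ; *-cong     = λ {x} {y} {u} {v} → *-congᶜ {x} {y} {u} {v}
        ; *-assoc    = *-assocᶜ
        ; *-identity = *-identityˡᶜ , λ x → +ᶜ.trans {x C.* C.1#} (*-commᶜ x C.1#) (*-identityˡᶜ x)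
        ; distrib    = distribˡᶜ , λ x y z → +ᶜ.trans {(y C.+ z) C.* x} (*-commᶜ (y C.+ z) x)
            (+ᶜ.trans {x C.* (y C.+ z)} (distribˡᶜ x y z)
              (+ᶜ.∙-cong {x C.* y} {y C.* x} {x C.* z} {z C.* x} (*-commᶜ x y) (*-commᶜ x z)))
        }
      ; *-comm = *-commᶜ
      }
    }

  norm-re : ∀ a b → a * a + - (b * - b) ≈ a * a + b * b
  norm-re a b = +-congˡ (-*-≈ b b)

  norm-im : ∀ a b → a * - b + b * a ≈ 0#
  norm-im a b = trans (+-cong (sym (-‿distribʳ-* a b)) (CommutativeRing.*-comm realRing b a)) (-‿inverseˡ (a * b))

  inverseᶜ : ∀ x → ¬ (x C.≈ C.0#) → ∃ λ y → x C.* y C.≈ C.1#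
  inverseᶜ (a , b) x≉0 = invert (R.inverse (a * a + b * b) (λ N≈0 → x≉0 (squares-zero N≈0)))
    where
    invert : (∃ λ s → (a * a + b * b) * s ≈ 1#) → ∃ λ y → (a , b) C.* y C.≈ C.1#
    invert (s , Ns≈1) = (a * s , - (b * s)) ,
      trans (+-congˡ (-*-≈ b (b * s)))
        (trans (solve 3 (λ a b s → a :* (a :* s) :+ b :* (b :* s) := (a :* a :+ b :* b) :* s) refl a b s) Ns≈1) ,
      trans (+-cong (sym (-‿distribʳ-* a (b * s))) (solve 3 (λ a b s → b :* (a :* s) := a :* (b :* s)) refl a b s))
        (-‿inverseˡ _)

  complexField : StarField
  complexField = record
    { commutativeRing = complexRing
    ; 0≉1           = λ (0≈1 , _) → R.0≉1 0≈1
    ; inverse       = inverseᶜ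
    ; conj          = C.conj
    ; conj-cong     = λ (a , b) → a , -‿cong b
    ; conj-+        = λ (a , b) (c , d) → refl ,
        trans (-≈e* _) (trans (solve 3 (λ e b d → e :* (b :+ d) := e :* b :+ e :* d) refl e b d)
          (sym (+-cong (-≈e* b) (-≈e* d))))
    ; conj-*        = λ (a , b) (c , d) →
        +-congˡ (-‿cong (sym (trans (sym (-‿distribˡ-* b (- d))) (-*-≈ b d)))) ,
        trans (-≈e* _) (trans (solve 5 (λ e a b c d → e :* (a :* d :+ b :* c) := a :* (e :* d) :+ (e :* b) :* c)
            refl e a b c d)
          (sym (+-cong (*-congˡ (-≈e* d)) (*-congʳ (-≈e* b)))))
    ; conj-conj     = λ (a , b) → refl , -‿involutive b
    ; NonNegative   = λ (a , b) → 0# ≤ᴿ a × b ≈ 0#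
    ; nonNeg-resp   = λ (a , b) (0≤ , ≈0) → ≤-resp a 0≤ , trans (sym b) ≈0
    ; nonNeg-0      = ≤.refl , refl
    ; nonNeg-+      = λ (0≤a , b≈0) (0≤c , d≈0) → +-nonneg 0≤a 0≤c , trans (+-cong b≈0 d≈0) (+-identityʳ 0#)
    ; nonNeg-norm   = λ (a , b) → ≤-resp (sym (norm-re a b)) (+-nonneg (square-nonneg a) (square-nonneg b)) ,
        norm-im a b
    ; nonNeg-cancel = λ (0≤a , b≈0) (0≤c , _) (re , _) → +-cancel 0≤a 0≤c re , b≈0
    ; norm-definite = λ {(a , b)} (re , _) → squares-zero (trans (sym (norm-re a b)) re)
    }

-- The Terwilliger algebra: adjoints, generators and the primary module.

module TerwilligerModules (K : StarField) (em : ExcludedMiddle 0ℓ) {n D : ℕ} (𝓢 : SymmetricAssociationScheme n D)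
    where
  open Sums K
  open Linear K n
  open Modules K em n D
  open SymmetricAssociationScheme 𝓢
  open Scheme K em 𝓢
  open Pairing K em 𝓢
  open Subspace
  open Invariant

  multiple-nonNeg : ∀ m → NonNegative (m · 1#)
  multiple-nonNeg zero    = nonNeg-0
  multiple-nonNeg (suc m) = nonNeg-+ nonNeg-1 (multiple-nonNeg m)

  -- Characteristic zero follows from positivity. The element of `Fin m` witnesses that m is
  -- positive; in use it is the base vertex x.
  multiple≉0 : ∀ {m} → Fin m → ¬ (m · 1# ≈ 0#)
  multiple≉0 {suc m} _ eq = 1≉0 (nonNeg-cancel nonNeg-1 (multiple-nonNeg m) eq)

  conj-multiple : ∀ m → conj (m · 1#) ≈ m · 1#
  conj-multiple zero    = conj-0
  conj-multiple (suc m) = trans (conj-+ _ _) (+-cong conj-1 (conj-multiple m))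

  _† : Mat → Mat
  (B †) z y = conj (B y z)

  adjoint : ∀ B u v → ⟨ B *ᵛ u , v ⟩ ≈ ⟨ u , (B †) *ᵛ v ⟩
  adjoint B u v = begin
    sum (λ y → sum (λ z → B y z * u z) * conj (v y))
      ≈⟨ trans (sum-cong (λ y → *-sumʳ _ _)) (sum-comm _) ⟩
    sum (λ z → sum (λ y → (B y z * u z) * conj (v y)))
      ≈⟨ sum-cong (λ z → trans
           (sum-cong (λ y → trans (solve 3 (λ b u v → (b :* u) :* v := u :* (b :* v)) refl (B y z) (u z)
               (conj (v y)))
             (*-congˡ (trans (*-congʳ (sym (conj-conj _))) (sym (conj-* _ _))))))
           (trans (sym (*-sumˡ _ _)) (*-congˡ (sym (conj-sum _))))) ⟩
    sum (λ z → u z * conj (sum (λ y → conj (B y z) * v y)))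
      ∎
    where open ≈-Reasoning

  †-cong : ∀ {B C} → B ≈ᴹ C → B † ≈ᴹ C †
  †-cong eq z y = conj-cong (eq y z)

  †-+ : ∀ B C → (B +ᴹ C) † ≈ᴹ (B †) +ᴹ (C †)
  †-+ B C z y = conj-+ _ _

  †-∙ : ∀ c B → (c ∙ᴹ B) † ≈ᴹ conj c ∙ᴹ (B †)
  †-∙ c B z y = conj-* _ _

  †-* : ∀ B C → (B *ᴹ C) † ≈ᴹ (C †) *ᴹ (B †)
  †-* B C z y = trans (conj-sum _) (sum-cong (λ w → trans (conj-* _ _) (*-comm _ _)))

  †-M : ∀ {B} → B ∈ M → B † ∈ M
  †-M B∈M = M-resp (λ y z → conj-cong (M-symmetric B∈M y z)) (M-conj B∈M)

  †-diag : ∀ w → (∀ y → conj (w y) ≈ w y) → diag w † ≈ᴹ diag w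
  †-diag w real z y = entry (y ≟ z)
    where
    entry : Dec (y ≡ z) → conj (diag w y z) ≈ diag w z y
    entry (yes ≡.refl) = trans (conj-cong (if-yes (y ≟ y) ≡.refl)) (trans (real y) (sym (if-yes (y ≟ y) ≡.refl)))
    entry (no y≢z)     = trans (conj-≈0 (if-no (y ≟ z) y≢z)) (sym (if-no (z ≟ y) (y≢z ∘ ≡.sym)))

  below-upto : ∀ {G : Family} → Resolution G → ∀ i (u : Fin (suc D) → V) →
    (∀ k → toℕ k ≤ i → ∃ λ w → u k ≈ᵛ G k *ᵛ w) → (∀ k → i < toℕ k → u k ≈ᵛ 0ᵛ) → sumᵛ u ∈ Below G (suc i)
  below-upto {G} res i u low high k i<k y = trans (*ᵛ-sum (G k) u y)
      (sum-zero (λ l → term l (ℕₚ.≤-<-connex (toℕ l) i) y))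
    where
    term : ∀ l → toℕ l ≤ i ⊎ i < toℕ l → G k *ᵛ u l ≈ᵛ 0ᵛ
    term l (inj₂ i<l) = *ᵛ-zero (G k) (high l i<l)
    term l (inj₁ l≤i) = ≈ᵛ-trans (*ᵛ-cong (G k) (proj₂ (low l l≤i)))
      (Resolution.orth res k l (λ k≡l → ℕₚ.<⇒≱ i<k (ℕₚ.≤-trans (ℕₚ.≤-reflexive (≡.cong toℕ k≡l)) l≤i)) _)

  thin-line : ∀ {d} → d ≤ 1 → (b : Fin d → V) → ∀ {u v} →
    (∃ λ (c : Fin d → Carrier) → u ≈ᵛ sumᵛ (λ i → c i ∙ᵛ b i)) →
    (∃ λ (c : Fin d → Carrier) → v ≈ᵛ sumᵛ (λ i → c i ∙ᵛ b i)) →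
    ¬ (u ≈ᵛ 0ᵛ) → ∃ λ a → v ≈ᵛ a ∙ᵛ u
  thin-line {zero}  _ b (c , u≈) _ u≉0 = contradiction (λ y → trans (u≈ y) (sum-empty _)) u≉0
  thin-line {suc zero} _ b {u} {v} (c , u≈) (c′ , v≈) u≉0 = ratio (inverse (c zero) c≉0)
    where
    open ≈-Reasoning
    single : ∀ (c : Fin 1 → Carrier) {w} → w ≈ᵛ sumᵛ (λ i → c i ∙ᵛ b i) → ∀ y → w y ≈ c zero * b zero y
    single c eq y = trans (eq y) (sum-single zero λ { zero 0≢0 → contradiction ≡.refl 0≢0 ; (suc ()) })
    c≉0 : ¬ (c zero ≈ 0#)
    c≉0 c≈0 = u≉0 (λ y → trans (single c u≈ y) (*-zeroˡ⇐ _ c≈0))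
    ratio : (∃ λ s → c zero * s ≈ 1#) → ∃ λ a → v ≈ᵛ a ∙ᵛ u
    ratio (s , inv) = c′ zero * s , λ y → begin
      v y                                   ≈⟨ single c′ v≈ y ⟩
      c′ zero * b zero y                    ≈⟨ *-congʳ (trans (*-congˡ inv) (*-identityʳ _)) ⟨
      (c′ zero * (c zero * s)) * b zero y   ≈⟨ solve 4 (λ d c s b → (d :* (c :* s)) :* b := (d :* s) :* (c :* b))
          refl (c′ zero) (c zero) s (b zero y) ⟩
      (c′ zero * s) * (c zero * b zero y)   ≈⟨ *-congˡ (single c u≈ y) ⟨
      (c′ zero * s) * u y                   ∎
  thin-line {suc (suc _)} (s≤s ())

  hat : Fin n → V
  hat x y = if does (x ≟ y) then 1# else 0#

  *ᵛ-hat : ∀ B x y → (B *ᵛ hat x) y ≈ B y x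
  *ᵛ-hat B x y = trans
    (sum-single x (λ z z≢x → *-zeroʳ⇐ _ (if-no (x ≟ z) (z≢x ∘ ≡.sym))))
    (trans (*-congˡ (if-yes (x ≟ x) ≡.refl)) (*-identityʳ _))

  module _ (E : Family) (prim : ∀ j → IsPrimitive (E j)) (distinct : ∀ i j → E i ≈ᴹ E j → i ≡ j)
           (complete : ∀ B → IsPrimitive B → ∃ λ j → B ≈ᴹ E j) (x : Fin n) where
    open Idempotents E prim distinct complete

    M-cl : ∀ {W} → Invariant E (E* x) W → ∀ {B} → B ∈ M → ∀ {v} → v ∈ W → B *ᵛ v ∈ W
    M-cl {W} inv {B} B∈M {v} v∈W = resp (subspace inv) eq
      (sum-cl (subspace inv) _ (λ j → ∙-cl (subspace inv) (proj₁ (expand B∈M) j) (E-cl inv j v∈W)))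
      where
      eq : sumᵛ (λ j → proj₁ (expand B∈M) j ∙ᵛ (E j *ᵛ v)) ≈ᵛ B *ᵛ v
      eq y = trans (sum-sum-* (proj₁ (expand B∈M)) (λ j → E j y) v)
        (sum-cong (λ z → *-congʳ (sym (proj₂ (expand B∈M) y z))))

    A* : Fin (suc D) → Mat
    A* j = diag (λ y → (n · 1#) * E j x y)

    A*-cl : ∀ {W} → Invariant E (E* x) W → ∀ j {v} → v ∈ W → A* j *ᵛ v ∈ W
    A*-cl {W} inv j {v} v∈W = resp (subspace inv) eq
      (sum-cl (subspace inv) _ (λ i → ∙-cl (subspace inv) ((n · 1#) * proj₁ (E∈M j) i) (F-cl inv i v∈W)))
      where
      eq : sumᵛ (λ i → ((n · 1#) * proj₁ (E∈M j) i) ∙ᵛ (E* x i *ᵛ v)) ≈ᵛ A* j *ᵛ v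
      eq y = trans (E*-combination x (λ i → (n · 1#) * proj₁ (E∈M j) i) v y)
        (trans (*-congʳ (*-congˡ (sym (proj₂ (E∈M j) x y)))) (sym (diag-*ᵛ (λ y → (n · 1#) * E j x y) v y)))

    -- Row x of an expansion of A_i in the E_j expresses |X| E*_i through the A*_j, and |X| is
    -- invertible.
    E*-cl : ∀ {W} → Subspace W → (∀ j {v} → v ∈ W → A* j *ᵛ v ∈ W) → ∀ i {v} → v ∈ W → E* x i *ᵛ v ∈ W
    E*-cl {W} sub cl i {v} v∈W = ∙-cancel-cl sub (multiple≉0 x)
      (resp sub eq (sum-cl sub _ (λ j → ∙-cl sub (c j) (cl j v∈W))))
      where
      open ≈-Reasoning
      c : Fin (suc D) → Carrier
      c = proj₁ (expand (A∈M i))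
      eq : sumᵛ (λ j → c j ∙ᵛ (A* j *ᵛ v)) ≈ᵛ (n · 1#) ∙ᵛ (E* x i *ᵛ v)
      eq y = begin
        sum (λ j → c j * (A* j *ᵛ v) y)
          ≈⟨ sum-cong (λ j → trans (*-congˡ (diag-*ᵛ (λ y → (n · 1#) * E j x y) v y))
               (solve 4 (λ c m e v → c :* ((m :* e) :* v) := (c :* e) :* (m :* v)) refl (c j) (n · 1#) (E j x y)
                   (v y))) ⟩
        sum (λ j → (c j * E j x y) * ((n · 1#) * v y))
          ≈⟨ *-sumʳ _ _ ⟨
        combination c E x y * ((n · 1#) * v y)
          ≈⟨ *-congʳ (proj₂ (expand (A∈M i)) x y) ⟨
        A i x y * ((n · 1#) * v y)
          ≈⟨ solve 3 (λ a m v → a :* (m :* v) := m :* (a :* v)) refl (A i x y) (n · 1#) (v y) ⟩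
        (n · 1#) * (A i x y * v y)
          ≈⟨ *-congˡ (diag-*ᵛ (A i x) v y) ⟨
        (n · 1#) * (E* x i *ᵛ v) y
          ∎

    A*-† : ∀ j → A* j † ≈ᴹ A* j
    A*-† j = †-diag _ (λ y → trans (conj-* _ _) (*-cong (conj-multiple n) (E-real j x y)))

    -- (M x̂)^⊥
    PrimaryPerp : Pred V 0ℓ
    PrimaryPerp v = ∀ B → B ∈ M → ⟨ v , B *ᵛ hat x ⟩ ≈ 0#

    -- M x̂ is closed under both self-adjoint families: E_j B stays in M, and E*_i B x̂ = (A_i ∘ B)
    -- x̂ with an entrywise product in M.
    primaryPerp-invariant : Invariant E (E* x) PrimaryPerp
    primaryPerp-invariant = record
      { subspace = ⋂-subspace (λ B → ⋂-subspace (λ _ → ⟂-subspace (B *ᵛ hat x)))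
      ; E-cl = λ j {v} v⟂ B B∈M → trans (Resolution.selfAdj resolution j v (B *ᵛ hat x))
          (trans (⟨⟩-cong {u = v} ≈ᵛ-refl (≈ᵛ-sym (*ᵛ-assoc (E j) B (hat x)))) (v⟂ (E j *ᴹ B) (M-* (E∈M j) B∈M)))
      ; F-cl = λ i {v} v⟂ B B∈M → trans (Resolution.selfAdj (E*-resolution x) i v (B *ᵛ hat x))
          (trans (⟨⟩-cong {u = v} ≈ᵛ-refl (restrict i B)) (v⟂ _ (M-∘ (A∈M i) B∈M)))
      }
      where
      restrict : ∀ i B → E* x i *ᵛ (B *ᵛ hat x) ≈ᵛ (λ y z → A i y z * B y z) *ᵛ hat x
      restrict i B y = trans (diag-*ᵛ (A i x) (B *ᵛ hat x) y) (trans
        (*-cong (M-symmetric (A∈M i) x y) (*ᵛ-hat B x y))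
        (sym (*ᵛ-hat (λ y z → A i y z * B y z) x y)))

    -- x̂ = A₀ x̂ belongs to M x̂, so v vanishes at x, the only coordinate that E*₀ retains.
    primaryPerp-E*₀ : ∀ {v} → v ∈ PrimaryPerp → E* x zero *ᵛ v ≈ᵛ 0ᵛ
    primaryPerp-E*₀ {v} v⟂ y = trans (diag-*ᵛ (A zero x) v y) (entry y (x ≟ y))
      where
      vₓ≈0 : v x ≈ 0#
      vₓ≈0 = begin
        v x                          ≈⟨ *-identityʳ _ ⟨
        v x * 1#                     ≈⟨ *-congˡ (trans (conj-cong (A-≡ (Equivalence.from (diagonal x x) ≡.refl)))
            conj-1) ⟨
        v x * conj (A zero x x)      ≈⟨ *-congˡ (conj-cong (*ᵛ-hat (A zero) x x)) ⟨
        v x * conj ((A zero *ᵛ hat x) x)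
          ≈⟨ sum-single x (λ z z≢x → *-zeroʳ⇐ _ (conj-≈0 (trans (*ᵛ-hat (A zero) x z)
               (A-≢ (λ eq → z≢x (Equivalence.to (diagonal z x) eq)))))) ⟨
        ⟨ v , A zero *ᵛ hat x ⟩      ≈⟨ v⟂ (A zero) (A∈M zero) ⟩
        0#                           ∎
        where open ≈-Reasoning
      entry : ∀ y → Dec (x ≡ y) → A zero x y * v y ≈ 0#
      entry y (yes ≡.refl) = *-zeroʳ⇐ _ vₓ≈0
      entry y (no x≢y)     = *-zeroˡ⇐ _ (A-≢ (λ eq → x≢y (Equivalence.to (diagonal x y) eq)))

-- Passage between the definitions of the statement and the abstract setting.

module Translation (em : ∀ {ℓ} → ExcludedMiddle ℓ) (ℝ : CompleteOrderedField) {n D : ℕ}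
                   (𝓢 : SymmetricAssociationScheme n D) (E : Fin (suc D) → LinearAlgebra.Mat ℝ n) where
  K : StarField
  K = ComplexField.complexField ℝ em

  module C = Sums K
  module G = Linear K n
  module L = LinearAlgebra ℝ n
  module BM = BoseMesner ℝ 𝓢
  module Tw = Terwilliger ℝ 𝓢 E
  module S = Scheme K em 𝓢
  module P = Pairing K em 𝓢
  module Mod = Modules K em n D
  open FiniteSets em

  -- With the sum unfolded, matrix products, actions and inner products agree definitionally on both
  -- sides; only predicates have to be converted.
  opaque
    unfolding Sums.sum

    M⇒ : ∀ {B} → B ∈ BM.M → B ∈ S.M
    M⇒ {B} (c , eq) = c , λ y z → C.trans {B y z} (eq y z) (S.A-coeff c y z)

    M⇐ : ∀ {B} → B ∈ S.M → B ∈ BM.M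
    M⇐ {B} (c , eq) = c , λ y z → C.trans {B y z} (eq y z) (C.sym {S.combination c S.A y z} (S.A-coeff c y z))

    primitive⇒ : ∀ {B} → B ∈ BM.IsPrimitiveIdempotent → S.IsPrimitive B
    primitive⇒ (B∈M , B² , B≉0 , prim) = M⇒ B∈M , B² , B≉0 , λ F G F∈M G∈M → prim F G (M⇐ F∈M) (M⇐ G∈M)

    primitive⇐ : ∀ {B} → S.IsPrimitive B → B ∈ BM.IsPrimitiveIdempotent
    primitive⇐ (B∈M , B² , B≉0 , prim) = M⇐ B∈M , B² , B≉0 , λ F G F∈M G∈M → prim F G (M⇒ F∈M) (M⇒ G∈M)

    subspace⇒ : ∀ {W} → L.IsSubspace W → G.Subspace W
    subspace⇒ sub = record
      { resp = λ {u} {v} → L.IsSubspace.resp-≈ sub {u} {v} ; 0-cl = L.IsSubspace.0-closed sub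
      ; +-cl = L.IsSubspace.+-closed sub ; ∙-cl = L.IsSubspace.∙-closed sub }

    subspace⇐ : ∀ {W} → G.Subspace W → L.IsSubspace W
    subspace⇐ sub = record
      { resp-≈ = λ {u} {v} → G.Subspace.resp sub {u} {v} ; 0-closed = G.Subspace.0-cl sub
      ; +-closed = G.Subspace.+-cl sub ; ∙-closed = G.Subspace.∙-cl sub }

    meets⇒ : ∀ {B W} → ¬ L.IsZero (L.image B W) → ∃ λ v → v ∈ W × ¬ (B G.*ᵛ v G.≈ᵛ G.0ᵛ)
    meets⇒ {B} {W} nz = decidable-stable em λ none → nz λ { {v} (w , w∈W , v≈Bw) y →
      C.trans {v y} {(B G.*ᵛ w) y} (v≈Bw y) (decidable-stable em (λ Bw≉0 → none (w , w∈W , Bw≉0)) y) }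

    meets⇐ : ∀ {B W} → (∃ λ v → v ∈ W × ¬ (B G.*ᵛ v G.≈ᵛ G.0ᵛ)) → ¬ L.IsZero (L.image B W)
    meets⇐ {B} (w , w∈W , Bw≉0) isZero = Bw≉0 (isZero {B G.*ᵛ w} (w , w∈W , λ y → C.refl {(B G.*ᵛ w) y}))

  module _ (ord : BM.IsIdempotentOrdering E) (metric : SymmetricAssociationScheme.Metric 𝓢)
           (cometric : BM.Cometric E) (1≤D : 1 ≤ D) (x : Fin n) where
    open BM.IsIdempotentOrdering ord using (isPrimitive; distinct)

    one : Fin (suc D)
    one = fromℕ< (s≤s 1≤D)

    one≡1 : toℕ one ≡ 1
    one≡1 = Finₚ.toℕ-fromℕ< (s≤s 1≤D)

    E* : Fin (suc D) → G.Mat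
    E* = P.E* x

    opaque
      unfolding Sums.sum

      prim : ∀ j → S.IsPrimitive (E j)
      prim j = primitive⇒ (isPrimitive j)

      complete : ∀ B → S.IsPrimitive B → ∃ λ j → B G.≈ᴹ E j
      complete B primB = BM.IsIdempotentOrdering.complete ord B (primitive⇐ primB)

      polynomials : ∀ j → ∃ λ (c : Fin (suc (toℕ j)) → C.Carrier) → ¬ (c (fromℕ (toℕ j)) C.≈ C.0#) ×
        (∀ y z → E j y z C.≈ C.sum (λ k → c k C.* (E one y z C.^ toℕ k)))
      polynomials = cometric one one≡1

    module I = S.Idempotents E prim distinct complete

    resE : Mod.Resolution E
    resE = I.resolution

    resF : Mod.Resolution E*
    resF = P.E*-resolution x

    compE : Mod.Companion E E*
    compE = Metricity.Adjacency.metric-companion K em 𝓢 (proj₂ metric) one one≡1 E prim distinct complete x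

    compF : Mod.Companion E* E
    compF = Cometricity.cometric-companion K em 𝓢 E prim distinct complete one one≡1 polynomials x

    module TM = TerwilligerModules K em 𝓢

    PrimaryPerp : Pred G.V 0ℓ
    PrimaryPerp = TM.PrimaryPerp E prim distinct complete x

    module D₂ = Duality K em em n D
    module TS = D₂.TwoSided resE resF compE compF

    opaque
      unfolding Sums.sum

      invariant⇒ : ∀ {W} → Tw.IsModule x W → Mod.Invariant E E* W
      invariant⇒ {W} (sub , cl) = record
        { subspace = subspace⇒ sub
        ; E-cl = λ j {v} → cl {E j} {v} (Tw.fromM (M⇐ (I.E∈M j)))
        ; F-cl = λ i {v} → TM.E*-cl E prim distinct complete x (subspace⇒ sub)
            (λ j {v} → cl {Tw.A* x j} {v} (Tw.fromA* j)) i {v}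
        }

      T-cl : ∀ {W} → Mod.Invariant E E* W → ∀ {B} → B ∈ Tw.T x → ∀ {v} → v ∈ W → B G.*ᵛ v ∈ W
      T-cl inv (Tw.fromM B∈M) v∈W = TM.M-cl E prim distinct complete x inv (M⇒ B∈M) v∈W
      T-cl inv (Tw.fromA* i) v∈W = TM.A*-cl E prim distinct complete x inv i v∈W
      T-cl inv (Tw.add {B} {C} B∈T C∈T) {v} v∈W =
        G.Subspace.resp (Mod.Invariant.subspace inv) (G.≈ᵛ-sym (G.*ᵛ-distribʳ B C v))
          (G.Subspace.+-cl (Mod.Invariant.subspace inv) (T-cl inv B∈T v∈W) (T-cl inv C∈T v∈W))
      T-cl inv (Tw.scale c {B} B∈T) {v} v∈W =
        G.Subspace.resp (Mod.Invariant.subspace inv) (G.≈ᵛ-sym (G.∙ᴹ-*ᵛ c B v))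
          (G.Subspace.∙-cl (Mod.Invariant.subspace inv) c (T-cl inv B∈T v∈W))
      T-cl inv (Tw.mul {B} {C} B∈T C∈T) {v} v∈W =
        G.Subspace.resp (Mod.Invariant.subspace inv) (G.≈ᵛ-sym (G.*ᵛ-assoc B C v))
          (T-cl inv B∈T (T-cl inv C∈T v∈W))
      T-cl inv (Tw.resp B≈C B∈T) {v} v∈W =
        G.Subspace.resp (Mod.Invariant.subspace inv) (G.*ᵛ-congˡ v B≈C) (T-cl inv B∈T v∈W)

      irreducible⇐ : ∀ {W} → Mod.Irreducible E E* W → Tw.IsIrreducible x W
      irreducible⇐ {W} irr =
        (subspace⇐ (Mod.Invariant.subspace inv) , λ B∈T v∈W → T-cl inv B∈T v∈W) ,
        (λ isZero → proj₂ (proj₂ nz) (isZero (proj₁ (proj₂ nz)))) ,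
        λ W′ mod W′⊆W → dichotomy W′ mod W′⊆W em
        where
        inv : Mod.Invariant E E* W
        inv = Mod.Irreducible.invariant irr
        nz : ∃ λ v → v ∈ W × ¬ (v G.≈ᵛ G.0ᵛ)
        nz = Mod.Irreducible.nonzero irr
        dichotomy : ∀ W′ → Tw.IsModule x W′ → (∀ {v} → v ∈ W′ → v ∈ W) →
                    Dec (∃ λ v → v ∈ W′ × ¬ (v G.≈ᵛ G.0ᵛ)) → L.IsZero W′ ⊎ W ⊆ W′
        dichotomy W′ mod W′⊆W (yes nz′) = inj₂ (Mod.Irreducible.minimal irr W′ (invariant⇒ mod) W′⊆W nz′)
        dichotomy W′ mod W′⊆W (no none) = inj₁ λ {v} v∈W′ → decidable-stable em λ v≉0 → none (v , v∈W′ , v≉0)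

      displacement⇐ : ∀ {W r} → TS.Balanced W r → Tw.Displacement x W 0ℤ × Tw.Endpoint x W r
      displacement⇐ {W} {r} bal =
        -- The diameter is D - 2r, so r + r + d = D and the displacement is zero.
        (r , r , D ∸ (toℕ r ℕ.+ toℕ r) ,
          endpoint , ((meets⇐ meets-E) , λ j m → min-E j (meets⇒ m)) ,
          (subset (Mod.Meets E* W) ,
            (λ i → mk⇔ (λ i∈ → meets⇐ (∈-subset⁻ (Mod.Meets E* W) i∈))
                (λ m → ∈-subset⁺ (Mod.Meets E* W) (meets⇒ m))) ,
            size) ,
          ≡.sym (≡.trans (≡.cong (λ m → ℤ.+ m ℤ.- ℤ.+ D) (ℕₚ.m+[n∸m]≡n 2r≤D)) (ℤₚ.+-inverseʳ (ℤ.+ D)))) ,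
        endpoint
        where
        open TS.Balanced bal
        endpoint : Tw.Endpoint x W r
        endpoint = meets⇐ meets-F , λ i m → min-F i (meets⇒ m)
        r≤D : toℕ r ≤ D
        r≤D = ℕₚ.≤-pred (Finₚ.toℕ<n r)
        2r≤D : toℕ r ℕ.+ toℕ r ≤ D
        2r≤D = ℕₚ.≤-trans (ℕₚ.+-monoˡ-≤ (toℕ r) (max-F r meets-F)) (ℕₚ.≤-reflexive (ℕₚ.m∸n+n≡m r≤D))
        size : ∣ subset (Mod.Meets E* W) ∣ ≡ suc (D ∸ (toℕ r ℕ.+ toℕ r))
        size = ≡.trans (≡.sym (ℕₚ.m+n∸n≡m _ (toℕ r ℕ.+ toℕ r)))
          (≡.trans (≡.cong (_∸ (toℕ r ℕ.+ toℕ r)) size-F) (ℕₚ.+-∸-assoc 1 2r≤D))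

      thin⇒ : ∀ {W} → Tw.Thin x W → Mod.Thin E* W
      thin⇒ {W} thin i {u} {v} u∈W v∈W Eu≉0 = line (thin i)
        where
        line : (∃ λ d → L.HasDim (L.image (E* i) W) d × d ≤ 1) → ∃ λ c → E* i G.*ᵛ v G.≈ᵛ c G.∙ᵛ (E* i G.*ᵛ u)
        line (d , (b , _ , _ , spans) , d≤1) = TM.thin-line d≤1 b {E* i G.*ᵛ u} {E* i G.*ᵛ v}
          (spans (E* i G.*ᵛ u) (u , u∈W , λ y → C.refl {(E* i G.*ᵛ u) y}))
          (spans (E* i G.*ᵛ v) (v , v∈W , λ y → C.refl {(E* i G.*ᵛ v) y})) Eu≉0

      -- M is closed under conjugation and consists of symmetric matrices, and the A*_j are real
      -- diagonal; so F may be moved to the other side of the inner product.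
      T-† : ∀ {B} → B ∈ Tw.T x → B TM.† ∈ Tw.T x
      T-† (Tw.fromM B∈M) = Tw.fromM (M⇐ (TM.†-M (M⇒ B∈M)))
      T-† (Tw.fromA* i) = Tw.resp (λ y z → C.sym {(Tw.A* x i TM.†) y z} (TM.A*-† E prim distinct complete x i y z))
          (Tw.fromA* i)
      T-† (Tw.add {B} {C} B∈T C∈T) = Tw.resp (λ y z → C.sym {((B G.+ᴹ C) TM.†) y z} (TM.†-+ B C y z))
          (Tw.add (T-† B∈T) (T-† C∈T))
      T-† (Tw.scale c {B} B∈T) = Tw.resp (λ y z → C.sym {((c G.∙ᴹ B) TM.†) y z} (TM.†-∙ c B y z))
          (Tw.scale (C.conj c) (T-† B∈T))
      T-† (Tw.mul {B} {C} B∈T C∈T) = Tw.resp (λ y z → C.sym {((B G.*ᴹ C) TM.†) y z} (TM.†-* B C y z))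
          (Tw.mul (T-† C∈T) (T-† B∈T))
      T-† (Tw.resp B≈C B∈T) = Tw.resp (TM.†-cong B≈C) (T-† B∈T)

      below⇒ : ∀ {F : Fin (suc D) → G.Mat} → Mod.Resolution F → ∀ i {v} →
               v ∈ L.sumUpTo i (λ k → L.image (F k) U) → v ∈ Mod.Below F (suc i)
      below⇒ {F} res i {v} (u , low , high , v≈Σu) = G.Subspace.resp (Mod.belowSubspace F (suc i))
        (λ y → C.sym {v y} (v≈Σu y))
        (TM.below-upto res i u (λ k k≤i → proj₁ (low k k≤i) , proj₂ (proj₂ (low k k≤i))) high)

      primaryPerp⇒ : ∀ {v} → v ∈ (BM.Mhat x L.⟂) → v ∈ PrimaryPerp
      primaryPerp⇒ v⟂ B B∈M = v⟂ (B G.*ᵛ TM.hat x) (B , M⇐ B∈M , λ y → C.refl {(B G.*ᵛ TM.hat x) y})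

    module _ {χ : G.V} {δ δ* : Fin (suc D)} (isδ : Tw.Isδ x χ δ) (isδ* : Tw.Isδ* χ δ*) {t : ℕ}
             (few : ∀ r → 1 ≤ r → r ≤ t → Tw.FewBetween (Tw.supp χ) r δ ⊎ Tw.FewBetween (Tw.supp* x χ) r δ*)
             (thin : ∀ W → Tw.IsIrreducible x W → Tw.Displacement x W 0ℤ → ∀ r → Tw.Endpoint x W r → toℕ r ≤ t →
                 Tw.Thin x W)
             where

      opaque
        unfolding Sums.sum

        low⇒ : ∀ {F : Fin (suc D) → G.Mat} {δ} → IsMin (λ i → i ≢ zero × ¬ (F i G.*ᵛ χ G.≈ᵛ G.0ᵛ)) δ →
            TS.Low F χ (toℕ δ)
        low⇒ (_ , min) i 1≤i i<δ = decidable-stable em λ Fχ≉0 →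
          ℕₚ.<⇒≱ i<δ (min i ((λ { ≡.refl → ℕₚ.n≮0 1≤i }) , Fχ≉0))

        few⇒ : ∀ {F : Fin (suc D) → G.Mat} {r δ} → Tw.FewBetween (λ i → ¬ (F i G.*ᵛ χ G.≈ᵛ G.0ᵛ)) r δ → TS.Few F χ r
            (toℕ δ)
        few⇒ (m , (S , S⇔ , ∣S∣≡m) , m+r≤δ) = S ,
          (λ i r≤i i≤D-r Fχ≉0 → Equivalence.from (S⇔ i) (r≤i , i≤D-r , Fχ≉0)) ,
          ℕₚ.≤-trans (ℕₚ.≤-reflexive (≡.cong (ℕ._+ _) ∣S∣≡m)) m+r≤δ

        orthogonality : ∀ F → F ∈ Tw.T x → ∀ a b → a ℕ.+ b ≤ D → a ≤ t ⊎ b ≤ t →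
          ∀ v → v ∈ Tw.Vᵢⱼ x a b ∩ (BM.Mhat x L.⟂) → L.⟨ F L.*ᵛ χ , v ⟩ C.≈ C.0#
        orthogonality F F∈T a b a+b≤D a⊎b≤t v ((v∈F , v∈E) , v⟂) =
          -- ⟨F χ , v⟩ is the conjugate of ⟨F† v , χ⟩, where F† keeps each irreducible component of
          -- v inside its module.
          C.trans {G.⟨ F G.*ᵛ χ , v ⟩} (TM.adjoint F χ v) (G.⟨⟩-swap-0 {(F TM.†) G.*ᵛ v} {χ} (TS.cornerPerp
            (low⇒ {E*} {δ} isδ) (low⇒ {E} {δ*} isδ*)
            (λ r 1≤r r≤t → [ (λ f → inj₁ (few⇒ {E} {r} {δ} f)) , (λ f → inj₂ (few⇒ {E*} {r} {δ*} f)) ]′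
                (few r 1≤r r≤t))
            (λ W irr r bal r≤t → thin⇒ (thin W (irreducible⇐ irr) (proj₁ (displacement⇐ bal)) r
                (proj₂ (displacement⇐ bal)) r≤t))
            (TM.primaryPerp-E*₀ E prim distinct complete x)
            -- The induction starts from the fact that no n + 1 nonzero vectors are pairwise
            -- orthogonal.
            (suc n) PrimaryPerp (Projection.orthogonal-bound K em n)
                (TM.primaryPerp-invariant E prim distinct complete x) id
            -- `Below` has strict bounds, so both indices grow by one, and a + b ≤ D becomes h + k ≤
            -- D + 2.
            v (suc a) (suc b) (primaryPerp⇒ v⟂)
            (s≤s (ℕₚ.≤-trans (ℕₚ.≤-reflexive (ℕₚ.+-suc a b)) (s≤s a+b≤D)))
            ([ (λ a≤t → inj₁ (s≤s a≤t)) , (λ b≤t → inj₂ (s≤s b≤t)) ]′ a⊎b≤t)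
            (below⇒ resF a v∈F) (below⇒ resE b v∈E)
            (F TM.†) (λ W inv v∈W → T-cl inv (T-† F∈T) v∈W)))

theorem5p2 : (em : ∀ {ℓ} → ExcludedMiddle ℓ)
    (ℝ : CompleteOrderedField)
    {n D : ℕ} (𝓢 : SymmetricAssociationScheme n D) →
    let open Complex ℝ
        open LinearAlgebra ℝ n
        open BoseMesner ℝ 𝓢
    in
    (E : Fin (suc D) → Mat) →
    let open Terwilliger ℝ 𝓢 E in
    IsIdempotentOrdering E →
    SymmetricAssociationScheme.Metric 𝓢 →
    Cometric E →
    (x : Fin n) (χ : V) → IsCode χ →
    (δ δ* : Fin (suc D)) → Isδ x χ δ → Isδ* χ δ* →
    (t : ℕ) → 1 ≤ t → t ≤ D →
    (∀ r → 1 ≤ r → r ≤ t →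
      FewBetween (supp χ) r δ ⊎ FewBetween (supp* x χ) r δ*) →
    (∀ (W : Pred V 0ℓ) → IsIrreducible x W → Displacement x W 0ℤ →
      ∀ r → Endpoint x W r → toℕ r ≤ t → Thin x W) →
    (∀ F → F ∈ T x → ∀ i → 1 ≤ i → i ≤ t →
      ∀ v → v ∈ Vᵢⱼ x i (D ∸ i) ∩ (Mhat x ⟂) → ⟨ F *ᵛ χ , v ⟩ ≈ 0#)
    ×
    (∀ F → F ∈ T x → ∀ j → 1 ≤ j → j ≤ t →
      ∀ v → v ∈ Vᵢⱼ x (D ∸ j) j ∩ (Mhat x ⟂) → ⟨ F *ᵛ χ , v ⟩ ≈ 0#)
theorem5p2 em ℝ {D = D} 𝓢 E ord metric cometric x χ _ δ δ* isδ isδ* t 1≤t t≤D few thin =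
  (λ F F∈T i _ i≤t → orthogonal F F∈T i (D ∸ i) (ℕₚ.≤-reflexive (ℕₚ.m+[n∸m]≡n (ℕₚ.≤-trans i≤t t≤D))) (inj₁ i≤t)) ,
  (λ F F∈T j _ j≤t → orthogonal F F∈T (D ∸ j) j (ℕₚ.≤-reflexive (ℕₚ.m∸n+n≡m (ℕₚ.≤-trans j≤t t≤D))) (inj₂ j≤t))
  where
  -- From 1 ≤ t ≤ D it follows that D ≥ 1, which provides the index of A₁ and E₁.
  orthogonal = Translation.orthogonality em ℝ 𝓢 E ord metric cometric (ℕₚ.≤-trans 1≤t t≤D) x
    {χ} {δ} {δ*} isδ isδ* {t} few thin
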